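{- Let $k\ge 2$ and $N=G_k=2^{2k+1}+2^{k+1}+1$. Let $m$ be an integer coprime to $N$ which is a fourth power modulo $N$, let $E:y^2=x^3-mx$ with arithmetic modulo $N$, and let $\eta=1+i$ be the endomorphism described in the context. Let $P=(x,y)$ be a point on $E$ with $x$ a quadratic non-residue modulo $N$. Then $N$ is prime if and only if $\eta^{2k-1}P\in E[2]\setminus\{\infty\}$, i.e. $\eta^{2k-1}P\in\{(0,0),(\sqrt m,0),(-\sqrt m,0)\}$.
   Context: Let $i$ be a square root of $-1$ modulo $N$ and $\sqrt m$ a square root of $m$ modulo $N$. The map $[i](x,y)=(-x,iy)$ is an automorphism of $E$, and $\eta=[1+i]$ is the endomorphism $\eta(x,y)=(x,y)+[i](x,y)$ (elliptic curve addition, identity $\infty$ the point at infinity); for $x\neq0$ the $x$-coordinate of $\eta(x,y)$ is $\frac{x^2-m}{2ix}$. $\eta^j$ is the $j$-fold iterate. $E[2]$ denotes the $2$-torsion $\{\infty,(0,0),(\pm\sqrt m,0)\}$. When $N$ is composite, the condition is understood as the result of carrying out these computations modulo $N$ (equivalently, holding on the reduction of $E$ modulo prime divisors of $N$). -}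

module Defs where

open import Data.Nat as ℕ using (ℕ; zero; suc; NonZero; _≟_)
open import Data.Integer as ℤ using (ℤ; +_; _%ℕ_)
open import Data.Integer.Divisibility using () renaming (_∣_ to _∣ℤ_)
open import Data.Nat.Coprimality using (Coprime)
open import Data.Nat.Primality using (Prime)
open import Data.Nat.Divisibility using (_∣_)
open import Data.Product using (Σ; ∃; _×_)
open import Data.Sum using (_⊎_)
open import Relation.Nullary using (¬_; yes; no)
open import Relation.Binary.PropositionalEquality using (_≡_)

G : ℕ → ℕ
G k = 2 ℕ.^ (2 ℕ.* k ℕ.+ 1) ℕ.+ 2 ℕ.^ (k ℕ.+ 1) ℕ.+ 1

_≡_[mod_] : ℤ → ℤ → ℕ → Set
a ≡ b [mod n ] = (+ n) ∣ℤ (a ℤ.- b)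

QNR : ℕ → ℤ → Set
QNR n x = Coprime ℤ.∣ x ∣ n × ¬ (∃ λ z → (z ℤ.* z) ≡ x [mod n ])

-- Arithmetic on the curve E : y^2 = x^3 - m x over F_p (p a prime),
-- with field elements represented by their reduced residues in ℕ.
module CurveFp (p : ℕ) .{{_ : NonZero p}} (m i : ℤ) where

  red : ℤ → ℕ
  red z = z %ℕ p

  _⊕_ _⊗_ _⊖_ : ℕ → ℕ → ℕ
  a ⊕ b = (a ℕ.+ b) ℕ.% p
  a ⊗ b = (a ℕ.* b) ℕ.% p
  a ⊖ b = red (+ a ℤ.- + b)

  powF : ℕ → ℕ → ℕ
  powF a zero = 1 ℕ.% p
  powF a (suc n) = a ⊗ powF a n

  -- inverse in F_p (Fermat), valid for p prime and a ≢ 0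
  inv : ℕ → ℕ
  inv a = powF a (p ℕ.∸ 2)

  aE : ℕ
  aE = red (ℤ.- m)

  data Point : Set where
    ∞   : Point
    aff : ℕ → ℕ → Point

  _+E_ : Point → Point → Point
  ∞ +E Q = Q
  P +E ∞ = P
  aff x₁ y₁ +E aff x₂ y₂ with x₁ ≟ x₂
  ... | no _ =
    let l  = (y₂ ⊖ y₁) ⊗ inv (x₂ ⊖ x₁)
        x₃ = ((l ⊗ l) ⊖ x₁) ⊖ x₂
    in aff x₃ ((l ⊗ (x₁ ⊖ x₃)) ⊖ y₁)
  ... | yes _ with (y₁ ⊕ y₂) ≟ 0
  ...   | yes _ = ∞
  ...   | no _ =
    let l  = ((3 ⊗ (x₁ ⊗ x₁)) ⊕ aE) ⊗ inv (2 ⊗ y₁)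
        x₃ = ((l ⊗ l) ⊖ x₁) ⊖ x₁
    in aff x₃ ((l ⊗ (x₁ ⊖ x₃)) ⊖ y₁)

  iMap : Point → Point
  iMap ∞ = ∞
  iMap (aff x y) = aff (0 ⊖ x) (red i ⊗ y)

  η : Point → Point
  η Q = Q +E iMap Q

  ηPow : ℕ → Point → Point
  ηPow zero Q = Q
  ηPow (suc j) Q = η (ηPow j Q)

  pt : ℤ → ℤ → Point
  pt x y = aff (red x) (red y)

  InE2∖∞ : (sqrtm : ℤ) → Point → Set
  InE2∖∞ sqrtm Q = Q ≡ aff 0 0 ⊎ Q ≡ aff (red sqrtm) 0 ⊎ Q ≡ aff (red (ℤ.- sqrtm)) 0

-- The condition η^j P ∈ E[2] ∖ {∞} "computed modulo N": it holds on the
-- reduction of E modulo every prime divisor p of N.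
EtaCond : (N : ℕ) (m i sqrtm x y : ℤ) (j : ℕ) → Set
EtaCond N m i sqrtm x y j =
  ∀ (p : ℕ) → (pr : Prime p) → p ∣ N →
    let instance nz : NonZero p
                 nz = nzPrime pr
        open CurveFp p m i
    in InE2∖∞ sqrtm (ηPow j (pt x y))
  where
  nzPrime : ∀ {p} → Prime p → NonZero p
  nzPrime {suc p} _ = _
  nzPrime {zero} ()

{-# OPTIONS --safe #-}

-- The group law of E : y² = x³ − m x is replaced by the relation "P, Q, R are the intersections of E with
-- a line", which η preserves. The fibres of η are the pairs {R, R + T} with T = (0, 0), so as long as
-- T ∈ ηʰ E(F_p), the step from ηʰ E(F_p) to ηʰ⁺¹ E(F_p) halves the number of points; and T does lie in
-- ηʰ E(F_p) when that number is even, since negation fixes only ∞ and the 2-torsion points.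
--
-- If η²ᵏ⁻¹ P is a 2-torsion point ≠ ∞ modulo a prime p ∣ N, then T ∈ η²ᵏ⁻¹ E(F_p), hence
-- 2²ᵏ ≤ #E(F_p) ≤ 2 p + 1, which is impossible when p² ≤ N.
--
-- If N = p is prime, then #E(F_p) = p + 1 + S, where S² + S′² = 4 p by Jacobsthal's identity. Since
-- p = (1 + 2ᵏ)² + 2²ᵏ is essentially the only representation of p as a sum of two squares and
-- 8 ∣ #E(F_p), this gives S = −2 (1 + 2ᵏ) and #E(F_p) = 2²ᵏ⁺¹. So η²ᵏ⁺¹ annihilates E(F_p), while η²ᵏ
-- annihilates no point outside η E(F_p), in particular no point whose x-coordinate is a nonsquare.

module Submission where

open import Defs
open import Algebra.Bundles using (AbelianGroup; CommutativeRing)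
open import Algebra.Core using (Op₁; Op₂)
import Algebra.Properties.CommutativeMonoid.Sum as Product
import Algebra.Properties.Group as GroupProperties
import Algebra.Properties.Ring as RingProperties
import Algebra.Solver.Ring as Solver
open import Algebra.Solver.Ring.AlmostCommutativeRing using (fromCommutativeRing; _-Raw-AlmostCommutative⟶_)
open import Algebra.Structures using (IsCommutativeRing)
open import Data.Fin as Fin using (Fin; toℕ; fromℕ<)
open import Data.Fin.Permutation using (permutation)
import Data.Fin.Properties as Fin
open import Data.Integer as ℤ using (ℤ; +_; 0ℤ; 1ℤ; -1ℤ; _^_)
open import Data.Integer.DivMod using (_%ℕ_; _/ℕ_; n%ℕd<d; a≡a%ℕn+[a/ℕn]*n)
open import Data.Integer.Divisibility.Signed using (_∣_; divides; ∣⇒∣ᵤ; ∣ᵤ⇒∣)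
import Data.Integer.Properties as ℤ
open import Data.Integer.Tactic.RingSolver using (solve-∀)
open import Data.List using (List; []; _∷_; _++_; map; length; allFin; cartesianProductWith)
open import Data.List.Membership.Propositional using (_∈_; lose)
open import Data.List.Membership.Propositional.Properties using (∈-allFin; ∈-cartesianProductWith⁺)
open import Data.List.Properties using (length-tabulate)
open import Data.List.Relation.Unary.All as All using (All; []; _∷_)
import Data.List.Relation.Unary.All.Properties as All
open import Data.List.Relation.Unary.AllPairs using ([]; _∷_)
open import Data.List.Relation.Unary.Any as Any using (here; there)
open import Data.List.Relation.Unary.Unique.Propositional using (Unique)
open import Data.List.Relation.Unary.Unique.Propositional.Properties using (allFin⁺; cartesianProductWith⁺)
open import Data.Maybe using (Maybe; just; nothing)
open import Data.Nat as ℕ using (ℕ; zero; suc; _≤_; _∸_)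
open import Data.Nat.Coprimality using (Coprime; prime⇒coprime; coprime-Bézout)
import Data.Nat.Divisibility as ℕ
open import Data.Nat.DivMod using (m<n⇒m%n≡m)
open import Data.Nat.GCD using (module Bézout)
open import Data.Nat.ListAction using (product)
open import Data.Nat.Primality using (Prime; prime?; prime⇒irreducible; euclidsLemma; ¬prime⇒composite; composite; ¬prime[0]; ¬prime[1])
open import Data.Nat.Primality.Factorisation using (factorise; module PrimeFactorisation)
import Data.Nat.Properties as ℕ
import Data.Nat.Tactic.RingSolver as ℕ-solver
open import Data.Product using (∃; _×_; _,_; proj₁; proj₂)
open import Data.Sum as Sum using (_⊎_; inj₁; inj₂)
open import Data.Unit using (⊤; tt)
open import Function using (_∘_; id)
open import Function.Bundles using (_⇔_; mk⇔)
open import Level using (0ℓ)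
open import Relation.Binary.Definitions using (DecidableEquality; tri<; tri≈; tri>)
open import Relation.Binary.PropositionalEquality
open import Relation.Nullary using (¬_; Dec; yes; no; contradiction)
open import Relation.Nullary.Decidable using (map′; _×-dec_)

-- Three consequences of the group law carry the proof: η is additive, adding T maps ηʰ E(F_p) to
-- itself once T lies in it, and two points outside η E(F_p) add up to a point inside. The relation
-- of being the three intersections with a line expresses all of them.
--
-- The constants fit together as follows. η² is doubling up to the unit i, so η(±√m, 0) = T and η T
-- = ∞. When #E = 2²ᵏ⁺¹, a point outside η E reaches T after 2 k steps, hence stands at (±√m, 0)
-- after 2 k - 1.
--
-- Since m is a fourth power and -1 = i², √m = ± t² is a square. So (√m, 0) lies in η E, T lies in
-- η² E, and the sizes halve three times: this is the factor 8, which fixes both the sign of S and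
-- which of the two squares it comes from.
--
-- Membership in η E is read off from the square class of x: the abscissa of an image is the square
-- of y / ((1 + i) x), and a preimage of a point with x = r² ≠ 0 can be written down.

-- Indicators and finite sums

module FiniteSums where

  private variable
    A B P Q : Set

  𝟙 : Dec P → ℤ
  𝟙 (yes _) = 1ℤ
  𝟙 (no _) = 0ℤ

  𝟙-yes : P → (P? : Dec P) → 𝟙 P? ≡ 1ℤ
  𝟙-yes p (yes _) = refl
  𝟙-yes p (no ¬p) = contradiction p ¬p

  𝟙-no : ¬ P → (P? : Dec P) → 𝟙 P? ≡ 0ℤ
  𝟙-no ¬p (yes p) = contradiction p ¬p
  𝟙-no ¬p (no _) = refl

  𝟙-cong : (P → Q) → (Q → P) → (P? : Dec P) (Q? : Dec Q) → 𝟙 P? ≡ 𝟙 Q?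
  𝟙-cong to from (yes p) Q? = sym (𝟙-yes (to p) Q?)
  𝟙-cong to from (no ¬p) Q? = sym (𝟙-no (¬p ∘ from) Q?)

  𝟙-nonneg : (P? : Dec P) → 0ℤ ℤ.≤ 𝟙 P?
  𝟙-nonneg (yes _) = ℤ.+≤+ ℕ.z≤n
  𝟙-nonneg (no _) = ℤ.≤-refl

  sum : List A → (A → ℤ) → ℤ
  sum [] f = 0ℤ
  sum (x ∷ xs) f = f x ℤ.+ sum xs f

  sum-cong : ∀ (xs : List A) {f g : A → ℤ} → (∀ x → f x ≡ g x) → sum xs f ≡ sum xs g
  sum-cong [] eq = refl
  sum-cong (x ∷ xs) eq = cong₂ ℤ._+_ (eq x) (sum-cong xs eq)

  sum-+ : ∀ (xs : List A) (f g : A → ℤ) → sum xs (λ x → f x ℤ.+ g x) ≡ sum xs f ℤ.+ sum xs g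
  sum-+ [] f g = refl
  sum-+ (x ∷ xs) f g = trans (cong (ℤ._+_ (f x ℤ.+ g x)) (sum-+ xs f g)) (interchange (f x) (g x) _ _)
    where
    interchange : ∀ a b c d → (a ℤ.+ b) ℤ.+ (c ℤ.+ d) ≡ (a ℤ.+ c) ℤ.+ (b ℤ.+ d)
    interchange = solve-∀

  sum-*ˡ : ∀ (xs : List A) c (f : A → ℤ) → sum xs (λ x → c ℤ.* f x) ≡ c ℤ.* sum xs f
  sum-*ˡ [] c f = sym (ℤ.*-zeroʳ c)
  sum-*ˡ (x ∷ xs) c f = trans (cong (ℤ._+_ (c ℤ.* f x)) (sum-*ˡ xs c f)) (sym (ℤ.*-distribˡ-+ c (f x) _))

  sum-0 : ∀ (xs : List A) → sum xs (λ _ → 0ℤ) ≡ 0ℤ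
  sum-0 [] = refl
  sum-0 (x ∷ xs) = trans (ℤ.+-identityˡ _) (sum-0 xs)

  sum-1 : ∀ (xs : List A) → sum xs (λ _ → 1ℤ) ≡ + length xs
  sum-1 [] = refl
  sum-1 (x ∷ xs) = cong (ℤ._+_ 1ℤ) (sum-1 xs)

  sum-swap : ∀ (xs : List A) (ys : List B) (f : A → B → ℤ) →
             sum xs (λ x → sum ys (f x)) ≡ sum ys (λ y → sum xs (λ x → f x y))
  sum-swap [] ys f = sym (sum-0 ys)
  sum-swap (x ∷ xs) ys f = trans (cong (ℤ._+_ (sum ys (f x))) (sum-swap xs ys f)) (sym (sum-+ ys (f x) _))

  sum-nonneg : ∀ (xs : List A) {f : A → ℤ} → (∀ x → 0ℤ ℤ.≤ f x) → 0ℤ ℤ.≤ sum xs f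
  sum-nonneg [] pos = ℤ.≤-refl
  sum-nonneg (x ∷ xs) pos = ℤ.+-mono-≤ (pos x) (sum-nonneg xs pos)

  term≤sum : ∀ {xs : List A} {f : A → ℤ} {x} → (∀ x → 0ℤ ℤ.≤ f x) → x ∈ xs → f x ℤ.≤ sum xs f
  term≤sum {xs = x ∷ xs} {f} pos (here refl) =
    subst (ℤ._≤ f x ℤ.+ sum xs f) (ℤ.+-identityʳ (f x)) (ℤ.+-monoʳ-≤ (f x) (sum-nonneg xs pos))
  term≤sum {xs = y ∷ xs} {f} {x} pos (there x∈xs) =
    subst (ℤ._≤ f y ℤ.+ sum xs f) (ℤ.+-identityˡ (f x)) (ℤ.+-mono-≤ (pos y) (term≤sum pos x∈xs))

  sum-mono : ∀ (xs : List A) {f g : A → ℤ} → (∀ x → f x ℤ.≤ g x) → sum xs f ℤ.≤ sum xs g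
  sum-mono [] le = ℤ.≤-refl
  sum-mono (x ∷ xs) le = ℤ.+-mono-≤ (le x) (sum-mono xs le)

  record Finite (A : Set) : Set where
    infix 4 _≟_
    field
      elements : List A
      unique   : Unique elements
      complete : ∀ x → x ∈ elements
      _≟_      : DecidableEquality A

    ∑ : (A → ℤ) → ℤ
    ∑ = sum elements

    any? : {P : A → Set} → (∀ x → Dec (P x)) → Dec (∃ P)
    any? P? with Any.any? P? elements
    ... | yes p = yes (Any.satisfied p)
    ... | no ¬p = no λ (x , px) → ¬p (lose (complete x) px)

    -- Uniqueness lets the indicator contribute at most once, completeness at least once. Inserting
    -- this sum and swapping the order of summation is how `∑-reindex` and `size-halves` regroup
    -- their terms.
    ∑-point : ∀ a (f : A → ℤ) → ∑ (λ x → 𝟙 (x ≟ a) ℤ.* f x) ≡ f a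
    ∑-point a f = present elements unique (complete a)
      where
      absent : ∀ xs → All.All (a ≢_) xs → sum xs (λ x → 𝟙 (x ≟ a) ℤ.* f x) ≡ 0ℤ
      absent [] [] = refl
      absent (x ∷ xs) (a≢x ∷ a∉xs) =
        cong₂ (λ u v → u ℤ.* f x ℤ.+ v) (𝟙-no (a≢x ∘ sym) (x ≟ a)) (absent xs a∉xs)

      present : ∀ xs → Unique xs → a ∈ xs → sum xs (λ x → 𝟙 (x ≟ a) ℤ.* f x) ≡ f a
      present (x ∷ xs) (x∉xs ∷ _) (here refl) = trans
        (cong₂ (λ u v → u ℤ.* f a ℤ.+ v) (𝟙-yes refl (a ≟ a)) (absent xs x∉xs))
        (trans (ℤ.+-identityʳ _) (ℤ.*-identityˡ (f a)))
      present (x ∷ xs) (x∉xs ∷ u) (there a∈xs) = trans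
        (cong₂ (λ u v → u ℤ.* f x ℤ.+ v) (𝟙-no (All.lookup x∉xs a∈xs) (x ≟ a)) (present xs u a∈xs))
        (ℤ.+-identityˡ (f a))

    ∑-point-1 : ∀ a → ∑ (λ x → 𝟙 (x ≟ a)) ≡ 1ℤ
    ∑-point-1 a = trans (sum-cong elements (λ x → sym (ℤ.*-identityʳ _))) (∑-point a (λ _ → 1ℤ))

    ∑-reindex : ∀ (f g : A → A) → (∀ x → f (g x) ≡ x) → (∀ x → g (f x) ≡ x) →
                ∀ (h : A → ℤ) → ∑ (h ∘ f) ≡ ∑ h
    ∑-reindex f g fg gf h = begin
      ∑ (h ∘ f)
        ≡⟨ sum-cong elements (λ x → sym (∑-point (f x) h)) ⟩
      ∑ (λ x → ∑ (λ y → 𝟙 (y ≟ f x) ℤ.* h y))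
        ≡⟨ sum-swap elements elements _ ⟩
      ∑ (λ y → ∑ (λ x → 𝟙 (y ≟ f x) ℤ.* h y))
        ≡⟨ sum-cong elements (λ y → sum-cong elements (λ x → cong (ℤ._* h y)
             (𝟙-cong (λ e → trans (sym (gf x)) (cong g (sym e))) (λ e → trans (sym (fg y)) (cong f (sym e)))
                     (y ≟ f x) (x ≟ g y)))) ⟩
      ∑ (λ y → ∑ (λ x → 𝟙 (x ≟ g y) ℤ.* h y))
        ≡⟨ sum-cong elements (λ y → ∑-point (g y) (λ _ → h y)) ⟩
      ∑ h ∎
      where open ≡-Reasoning

  sum-++ : ∀ (xs ys : List A) (f : A → ℤ) → sum (xs ++ ys) f ≡ sum xs f ℤ.+ sum ys f
  sum-++ [] ys f = sym (ℤ.+-identityˡ _)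
  sum-++ (x ∷ xs) ys f = trans (cong (ℤ._+_ (f x)) (sum-++ xs ys f)) (sym (ℤ.+-assoc (f x) _ _))

  sum-map : ∀ (g : A → B) xs (f : B → ℤ) → sum (map g xs) f ≡ sum xs (f ∘ g)
  sum-map g [] f = refl
  sum-map g (x ∷ xs) f = cong (ℤ._+_ (f (g x))) (sum-map g xs f)

  sum-cartesianProductWith : ∀ {C : Set} (g : A → B → C) xs ys (f : C → ℤ) →
    sum (cartesianProductWith g xs ys) f ≡ sum xs (λ x → sum ys (λ y → f (g x y)))
  sum-cartesianProductWith g [] ys f = refl
  sum-cartesianProductWith g (x ∷ xs) ys f = trans (sum-++ (map (g x) ys) _ f)
    (cong₂ ℤ._+_ (sum-map (g x) ys f) (sum-cartesianProductWith g xs ys f))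

  Fin-finite : ∀ n → Finite (Fin n)
  Fin-finite n = record
    { elements = allFin n ; unique = allFin⁺ n ; complete = ∈-allFin ; _≟_ = Fin._≟_ }

open FiniteSums

-- Finite fields on `Fin q`

-- The carrier `Fin q` brings an enumeration, decidable equality and a linear order with it; `ι`
-- supplies the integer constants. Keeping the operations abstract prevents residue arithmetic from
-- unfolding in the algebra.
record FieldOn (q : ℕ) : Set where
  infixl 6 _+_
  infixl 7 _*_
  infix 8 -_
  field
    _+_ _*_ : Op₂ (Fin q)
    -_ inv : Op₁ (Fin q)
    ι : ℤ → Fin q
    isCommutativeRing : IsCommutativeRing _≡_ _+_ _*_ -_ (ι 0ℤ) (ι 1ℤ)
    ι-+ : ∀ a b → ι (a ℤ.+ b) ≡ ι a + ι b
    ι-* : ∀ a b → ι (a ℤ.* b) ≡ ι a * ι b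
    ι-neg : ∀ a → ι (ℤ.- a) ≡ - ι a
    1≢0 : ι 1ℤ ≢ ι 0ℤ
    -- With this convention `inv` is an involution of the whole field, and sums can be reindexed by
    -- it.
    inv-0 : inv (ι 0ℤ) ≡ ι 0ℤ
    *-inv : ∀ x → x ≢ ι 0ℤ → x * inv x ≡ ι 1ℤ

  commutativeRing : CommutativeRing 0ℓ 0ℓ
  commutativeRing = record { isCommutativeRing = isCommutativeRing }

module FieldProperties {q : ℕ} (K : FieldOn q) where

  open FieldOn K public
  open CommutativeRing commutativeRing public
    using (0#; 1#; _-_; +-identityʳ; -‿inverseʳ; *-comm; *-assoc; zeroˡ; zeroʳ; ring; +-group)
  open RingProperties ring public using (-‿distribˡ-*)
  open GroupProperties +-group public using () renaming (⁻¹-involutive to -‿involutive; ε⁻¹≈ε to -0≡0)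

  private
    ι-hom : ℤ.+-*-rawRing -Raw-AlmostCommutative⟶ fromCommutativeRing commutativeRing
    ι-hom = record
      { ⟦_⟧ = ι ; +-homo = ι-+ ; *-homo = ι-* ; -‿homo = ι-neg ; 0-homo = refl ; 1-homo = refl }

    -- Coefficients are compared in ℤ, so the identities given to `solve` are identities of integer
    -- polynomials, valid in every characteristic.
    _≟ι_ : ∀ a b → Maybe (ι a ≡ ι b)
    a ≟ι b with a ℤ.≟ b
    ... | yes a≡b = just (cong ι a≡b)
    ... | no _ = nothing

  open Solver ℤ.+-*-rawRing (fromCommutativeRing commutativeRing) ι-hom _≟ι_ public
    using (solve; con; _:=_; _:+_; _:*_; _:-_; :-_)

  F : Set
  F = Fin q

  infix 4 _≟_
  _≟_ : (x y : F) → Dec (x ≡ y)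
  _≟_ = Fin._≟_

  -- The identity to be supplied is a − b = c (u − v) with both sides moved; nested uses give
  -- linear combinations of several hypotheses.
  lin : ∀ {a b u v} c → u ≡ v → a + c * v ≡ b + c * u → a ≡ b
  lin {a} {b} {u} {v} c refl eq = begin
    a                     ≡⟨ solve 2 (λ a e → a := (a :+ e) :- e) refl a (c * v) ⟩
    (a + c * v) - c * v   ≡⟨ cong (_- c * v) eq ⟩
    (b + c * v) - c * v   ≡⟨ solve 2 (λ a e → (a :+ e) :- e := a) refl b (c * v) ⟩
    b                     ∎
    where open ≡-Reasoning

  x-y≡0⇒x≡y : ∀ {x y} → x - y ≡ 0# → x ≡ y
  x-y≡0⇒x≡y {x} {y} e = lin 1# e (solve 2 (λ x y → x :+ con 1ℤ :* con 0ℤ := y :+ con 1ℤ :* (x :- y)) refl x y)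

  *-cancelˡ : ∀ {x y z} → x ≢ 0# → x * y ≡ x * z → y ≡ z
  *-cancelˡ {x} {y} {z} x≢0 e =
    lin (y - z) (sym (*-inv x x≢0)) (lin (inv x) e
      (solve 4 (λ x y z w → (y :+ (y :- z) :* (x :* w)) :+ w :* (x :* z)
                         := (z :+ (y :- z) :* con 1ℤ) :+ w :* (x :* y)) refl x y z (inv x)))

  xy≡0⇒x≡0∨y≡0 : ∀ {x y} → x * y ≡ 0# → x ≡ 0# ⊎ y ≡ 0#
  xy≡0⇒x≡0∨y≡0 {x} {y} e with x ≟ 0#
  ... | yes x≡0 = inj₁ x≡0
  ... | no x≢0 = inj₂ (*-cancelˡ x≢0 (trans e (sym (zeroʳ x))))

  xx≡0⇒x≡0 : ∀ {x} → x * x ≡ 0# → x ≡ 0#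
  xx≡0⇒x≡0 e with xy≡0⇒x≡0∨y≡0 e
  ... | inj₁ x≡0 = x≡0
  ... | inj₂ x≡0 = x≡0

  *-nonzero : ∀ {x y} → x ≢ 0# → y ≢ 0# → x * y ≢ 0#
  *-nonzero x≢0 y≢0 e with xy≡0⇒x≡0∨y≡0 e
  ... | inj₁ x≡0 = x≢0 x≡0
  ... | inj₂ y≡0 = y≢0 y≡0

  inv-nonzero : ∀ {x} → x ≢ 0# → inv x ≢ 0#
  inv-nonzero {x} x≢0 e = 1≢0 (trans (sym (*-inv x x≢0)) (trans (cong (x *_) e) (zeroʳ x)))

  xx≡yy⇒x≡±y : ∀ {x y} → x * x ≡ y * y → x ≡ y ⊎ x ≡ - y
  xx≡yy⇒x≡±y {x} {y} e with xy≡0⇒x≡0∨y≡0 {x - y} {x + y}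
    (lin 1# e (solve 2 (λ x y → (x :- y) :* (x :+ y) :+ con 1ℤ :* (y :* y) := con 0ℤ :+ con 1ℤ :* (x :* x)) refl x y))
  ... | inj₁ z = inj₁ (x-y≡0⇒x≡y z)
  ... | inj₂ z = inj₂ (lin 1# z (solve 2 (λ x y → x :+ con 1ℤ :* con 0ℤ := :- y :+ con 1ℤ :* (x :+ y)) refl x y))

  neg-nonzero : ∀ {x} → x ≢ 0# → - x ≢ 0#
  neg-nonzero {x} x≢0 e = x≢0 (trans (sym (-‿involutive x)) (trans (cong -_ e) -0≡0))

  pow : F → ℕ → F
  pow x ℕ.zero = 1#
  pow x (suc k) = x * pow x k

  Square : F → Set
  Square x = ∃ λ r → r * r ≡ x

  x+x≡0⇒x≡0 : ι (+ 2) ≢ 0# → ∀ {x} → x + x ≡ 0# → x ≡ 0#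
  x+x≡0⇒x≡0 2≢0 {x} e with xy≡0⇒x≡0∨y≡0 {ι (+ 2)} {x} (trans (solve 1 (λ x → con (+ 2) :* x := x :+ x) refl x) e)
  ... | inj₁ 2≡0 = contradiction 2≡0 2≢0
  ... | inj₂ x≡0 = x≡0

-- The endomorphism η and the sizes of its iterated images

*-small : ∀ {n r} .{{_ : ℕ.NonZero r}} → r ℕ.< n → ∀ j → + n ℤ.* j ≢ + r
*-small {n} {r} r<n j e = ℕ.<⇒≱ r<n (ℕ.∣⇒≤ (ℕ.divides ℤ.∣ j ∣ (trans (cong ℤ.∣_∣ (sym e)) (trans (ℤ.abs-* (+ n) j) (ℕ.*-comm n _)))))

module _ {q : ℕ} (K : FieldOn q) where

  open FieldProperties K

  -- The quadratic relation for d says that 1 - 2 d is a square root of -1. Taking d instead of i as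
  -- the parameter makes every identity below polynomial in d, with one relation to reduce by.
  module Curve (m d : F) (m≢0 : m ≢ 0#) (2≢0 : ι (+ 2) ≢ 0#) (d-eq : ι (+ 2) * (d * d) ≡ ι (+ 2) * d - 1#) where

    2# : F
    2# = ι (+ 2)

    -- (1 + i)⁴ = -4. In this form the relation for d enters the proofs that images lie on the curve
    -- and that η preserves collinearity.
    4d⁴≡-1 : ι (+ 4) * (d * d * (d * d)) ≡ - 1#
    4d⁴≡-1 = lin (2# * (d * d) + (2# * d - 1#) + 2#) d-eq (solve 1 (λ d →
      let 2: = con (+ 2) ; w = 2: :* d :- con 1ℤ ; c = 2: :* (d :* d) :+ w :+ 2: in
      con (+ 4) :* (d :* d :* (d :* d)) :+ c :* w := :- con 1ℤ :+ c :* (2: :* (d :* d))) refl d)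

    data Point : Set where
      ∞   : Point
      aff : F → F → Point

    T : Point
    T = aff 0# 0#

    On : Point → Set
    On ∞ = ⊤
    On (aff x y) = y * y ≡ x * x * x - m * x

    neg : Point → Point
    neg ∞ = ∞
    neg (aff x y) = aff x (- y)

    neg-involutive : ∀ P → neg (neg P) ≡ P
    neg-involutive ∞ = refl
    neg-involutive (aff x y) = cong (aff x) (-‿involutive y)

    neg-T : neg T ≡ T
    neg-T = cong (aff 0#) -0≡0

    neg-On : ∀ {P} → On P → On (neg P)
    neg-On {∞} on = tt
    neg-On {aff x y} on = trans (solve 1 (λ y → :- y :* :- y := y :* y) refl y) on

    On-y≡0 : ∀ {x y} → On (aff x y) → x ≡ 0# → y ≡ 0#
    On-y≡0 {x} {y} on refl = xx≡0⇒x≡0 (trans on (solve 1 (λ m → con 0ℤ :* con 0ℤ :* con 0ℤ :- m :* con 0ℤ := con 0ℤ) refl m))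

    -- d = 1/(1+i), and the slope of the chord through P = (x, y) and iP is d s, with s = y/x.
    image : F → F → Point
    image x s = aff (d * s * (d * s)) (d * d * d * (s * (2# * x - s * s)))

    η : Point → Point
    η ∞ = ∞
    η (aff x y) with x ≟ 0#
    ... | yes _ = ∞
    ... | no _ = image x (y * inv x)

    η^ : ℕ → Point → Point
    η^ zero P = P
    η^ (suc h) P = η (η^ h P)

    η-0 : ∀ {x y} → x ≡ 0# → η (aff x y) ≡ ∞
    η-0 {x} x≡0 with x ≟ 0#
    ... | yes _ = refl
    ... | no x≢0 = contradiction x≡0 x≢0

    η-image : ∀ {x y} s → x ≢ 0# → s * x ≡ y → η (aff x y) ≡ image x s
    η-image {x} s x≢0 refl with x ≟ 0#
    ... | yes x≡0 = contradiction x≡0 x≢0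
    ... | no _ = cong (image x) (lin s (*-inv x x≢0)
      (solve 3 (λ s x w → s :* x :* w :+ s :* con 1ℤ := s :+ s :* (x :* w)) refl s x (inv x)))

    slope*x : ∀ {x y} → x ≢ 0# → y * inv x * x ≡ y
    slope*x {x} {y} x≢0 = lin y (*-inv x x≢0)
      (solve 3 (λ x y w → y :* w :* x :+ y :* con 1ℤ := y :+ y :* (x :* w)) refl x y (inv x))

    -- With y = s x the cubic loses a factor x. For a given slope the curve becomes a quadratic in
    -- x, and its second root will be the abscissa of P + T.
    slope-eq : ∀ {x y s} → x ≢ 0# → s * x ≡ y → On (aff x y) → x * x ≡ s * s * x + m
    slope-eq {x} {s = s} x≢0 refl on = *-cancelˡ x≢0 (lin (- 1#) on (solve 3 (λ x s m →
      let c = :- con 1ℤ in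
      x :* (x :* x) :+ c :* (x :* x :* x :- m :* x) := x :* (s :* s :* x :+ m) :+ c :* (s :* x :* (s :* x))) refl x s m))

    slope-On : ∀ {x s} → x * x ≡ s * s * x + m → On (aff x (s * x))
    slope-On {x} {s} e = lin (- x) e (solve 3 (λ x s m →
      s :* x :* (s :* x) :+ :- x :* (s :* s :* x :+ m) := (x :* x :* x :- m :* x) :+ :- x :* (x :* x)) refl x s m)

    image-On : ∀ {x s} → x * x ≡ s * s * x + m → On (image x s)
    image-On {x} {s} e = lin (ι (+ 4) * (d * d * d * (d * d * d)) * (s * s)) e (lin (m * (d * d) * (s * s)) 4d⁴≡-1
      (solve 4 (λ d x s m → let
         X = d :* s :* (d :* s)
         Y = d :* d :* d :* (s :* (con (+ 2) :* x :- s :* s))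
         c = con (+ 4) :* (d :* d :* d :* (d :* d :* d)) :* (s :* s)
         e = m :* (d :* d) :* (s :* s)
        in Y :* Y :+ c :* (s :* s :* x :+ m) :+ e :* :- con 1ℤ
           := (X :* X :* X :- m :* X) :+ c :* (x :* x) :+ e :* (con (+ 4) :* (d :* d :* (d :* d)))) refl d x s m))

    η-On : ∀ {P} → On P → On (η P)
    η-On {∞} on = tt
    η-On {aff x y} on = lemma (x ≟ 0#)
      where
      lemma : Dec (x ≡ 0#) → On (η (aff x y))
      lemma (yes x≡0) = subst On (sym (η-0 x≡0)) tt
      lemma (no x≢0) = subst On (sym (η-image (y * inv x) x≢0 (slope*x x≢0)))
        (image-On (slope-eq x≢0 (slope*x x≢0) on))

    η^-On : ∀ h {P} → On P → On (η^ h P)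
    η^-On zero on = on
    η^-On (suc h) on = η-On (η^-On h on)

    image-neg : ∀ x s → image x (- s) ≡ neg (image x s)
    image-neg x s = cong₂ aff
      (solve 2 (λ d s → d :* :- s :* (d :* :- s) := d :* s :* (d :* s)) refl d s)
      (solve 3 (λ d x s → d :* d :* d :* (:- s :* (con (+ 2) :* x :- :- s :* :- s))
                       := :- (d :* d :* d :* (s :* (con (+ 2) :* x :- s :* s)))) refl d x s)

    η-neg : ∀ P → η (neg P) ≡ neg (η P)
    η-neg ∞ = refl
    η-neg (aff x y) with x ≟ 0#
    ... | yes _ = refl
    ... | no _ = trans (cong (image x) (sym (-‿distribˡ-* y (inv x)))) (image-neg x (y * inv x))

    η^-neg : ∀ h P → η^ h (neg P) ≡ neg (η^ h P)
    η^-neg zero P = refl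
    η^-neg (suc h) P = trans (cong η (η^-neg h P)) (η-neg (η^ h P))

    -- The points over x₁, x₂, x₃ on the line y = l x + v are its three intersections with the curve:
    -- x³ − m x − (l x + v)² = (x − x₁)(x − x₂)(x − x₃).
    record Secant (l v x₁ x₂ x₃ : F) : Set where
      constructor secant
      field
        e₁ : x₁ + x₂ + x₃ ≡ l * l
        e₂ : x₁ * x₂ + x₁ * x₃ + x₂ * x₃ ≡ - m - 2# * (l * v)
        e₃ : x₁ * x₂ * x₃ ≡ v * v

    -- P + Q + R = ∞ in the group law, which is never needed itself.
    data Collinear : Point → Point → Point → Set where
      line : ∀ {x₁ x₂ x₃} l v → Secant l v x₁ x₂ x₃ →
             Collinear (aff x₁ (l * x₁ + v)) (aff x₂ (l * x₂ + v)) (aff x₃ (l * x₃ + v))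
      ∞₁ : ∀ {P Q} → P ≡ neg Q → Collinear ∞ P Q
      ∞₂ : ∀ {P Q} → P ≡ neg Q → Collinear P ∞ Q
      ∞₃ : ∀ {P Q} → P ≡ neg Q → Collinear P Q ∞

    Secant-swap₁₂ : ∀ {l v x₁ x₂ x₃} → Secant l v x₁ x₂ x₃ → Secant l v x₂ x₁ x₃
    Secant-swap₁₂ {x₁ = x₁} {x₂} {x₃} (secant e₁ e₂ e₃) = secant
      (trans (solve 3 (λ a b c → b :+ a :+ c := a :+ b :+ c) refl x₁ x₂ x₃) e₁)
      (trans (solve 3 (λ a b c → b :* a :+ b :* c :+ a :* c := a :* b :+ a :* c :+ b :* c) refl x₁ x₂ x₃) e₂)
      (trans (solve 3 (λ a b c → b :* a :* c := a :* b :* c) refl x₁ x₂ x₃) e₃)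

    Secant-swap₁₃ : ∀ {l v x₁ x₂ x₃} → Secant l v x₁ x₂ x₃ → Secant l v x₃ x₂ x₁
    Secant-swap₁₃ {x₁ = x₁} {x₂} {x₃} (secant e₁ e₂ e₃) = secant
      (trans (solve 3 (λ a b c → c :+ b :+ a := a :+ b :+ c) refl x₁ x₂ x₃) e₁)
      (trans (solve 3 (λ a b c → c :* b :+ c :* a :+ b :* a := a :* b :+ a :* c :+ b :* c) refl x₁ x₂ x₃) e₂)
      (trans (solve 3 (λ a b c → c :* b :* a := a :* b :* c) refl x₁ x₂ x₃) e₃)

    -- At x = x₁ the product (x - x₁)(x - x₂)(x - x₃) vanishes; expanding it by the three symmetric
    -- functions gives the curve equation. Hence the weights -x₁², x₁ and -1.
    Secant-On : ∀ {l v x₁ x₂ x₃} → Secant l v x₁ x₂ x₃ → On (aff x₁ (l * x₁ + v))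
    Secant-On {l} {v} {x₁} {x₂} {x₃} (secant e₁ e₂ e₃) =
      lin (- (x₁ * x₁)) e₁ (lin x₁ e₂ (lin (- 1#) e₃ (solve 6 (λ l v x₁ x₂ x₃ m → let
        y = l :* x₁ :+ v
       in y :* y :+ :- (x₁ :* x₁) :* (l :* l) :+ x₁ :* (:- m :- con (+ 2) :* (l :* v)) :+ :- con 1ℤ :* (v :* v)
          := (x₁ :* x₁ :* x₁ :- m :* x₁) :+ :- (x₁ :* x₁) :* (x₁ :+ x₂ :+ x₃)
             :+ x₁ :* (x₁ :* x₂ :+ x₁ :* x₃ :+ x₂ :* x₃) :+ :- con 1ℤ :* (x₁ :* x₂ :* x₃))
       refl l v x₁ x₂ x₃ m)))

    line′ : ∀ {x₁ y₁ x₂ y₂ x₃ y₃} l v → Secant l v x₁ x₂ x₃ →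
            y₁ ≡ l * x₁ + v → y₂ ≡ l * x₂ + v → y₃ ≡ l * x₃ + v →
            Collinear (aff x₁ y₁) (aff x₂ y₂) (aff x₃ y₃)
    line′ l v sec refl refl refl = line l v sec

    Collinear-resp : ∀ {P P′ Q Q′ R R′} → P ≡ P′ → Q ≡ Q′ → R ≡ R′ → Collinear P′ Q′ R′ → Collinear P Q R
    Collinear-resp refl refl refl col = col

    -- Images have abscissas (d s)², so passing from the slopes to the abscissas multiplies the
    -- three symmetric functions by d², d⁴ and d⁶. The middle one closes up through 4 d⁴ = -1.
    square-scale-sum : ∀ a b c e → a * a + b * b + c * c ≡ e * e →
      d * a * (d * a) + d * b * (d * b) + d * c * (d * c) ≡ e * d * (e * d)
    square-scale-sum a b c e h = lin (d * d) h (solve 5 (λ d a b c e → let D = d :* d in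
      d :* a :* (d :* a) :+ d :* b :* (d :* b) :+ d :* c :* (d :* c) :+ D :* (e :* e)
      := e :* d :* (e :* d) :+ D :* (a :* a :+ b :* b :+ c :* c)) refl d a b c e)

    square-scale-product : ∀ a b c g → a * b * c ≡ g →
      d * a * (d * a) * (d * b * (d * b)) * (d * c * (d * c)) ≡ d * d * d * g * (d * d * d * g)
    square-scale-product a b c g h = lin (d * d * d * (d * d * d) * (a * b * c + g)) h (solve 5 (λ d a b c g → let
        D = d :* d :* d
        e = D :* D :* (a :* b :* c :+ g)
      in d :* a :* (d :* a) :* (d :* b :* (d :* b)) :* (d :* c :* (d :* c)) :+ e :* g
         := D :* g :* (D :* g) :+ e :* (a :* b :* c)) refl d a b c g)

    square-scale-pairs : ∀ a b c l v k → v * k ≡ 1# →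
      a * a * (b * b) + a * a * (c * c) + b * b * (c * c) ≡ 2# * (m - l * v + m * (l * l) * k * (l + m * k)) →
      d * a * (d * a) * (d * b * (d * b)) + d * a * (d * a) * (d * c * (d * c)) + d * b * (d * b) * (d * c * (d * c))
      ≡ - m - 2# * ((l + m * k) * d * (d * d * d * (v - m * (l * l) * k)))
    square-scale-pairs a b c l v k vk h =
      lin (d * d * (d * d)) h (lin (2# * m * (d * d * (d * d))) vk (lin m 4d⁴≡-1
        (solve 8 (λ d a b c l v k m → let
          D = d :* d
          c₀ = con (+ 2) :* m :* (D :* D)
          X = d :* a :* (d :* a)
          Y = d :* b :* (d :* b)
          Z = d :* c :* (d :* c)
          e = l :+ m :* k
        in X :* Y :+ X :* Z :+ Y :* Z
             :+ D :* D :* (con (+ 2) :* (m :- l :* v :+ m :* (l :* l) :* k :* e)) :+ c₀ :* con 1ℤ :+ m :* :- con 1ℤ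
           := :- m :- con (+ 2) :* (e :* d :* (d :* d :* d :* (v :- m :* (l :* l) :* k)))
             :+ D :* D :* (a :* a :* (b :* b) :+ a :* a :* (c :* c) :+ b :* b :* (c :* c))
             :+ c₀ :* (v :* k) :+ m :* (con (+ 4) :* (D :* D))) refl d a b c l v k m)))

    -- For a line not through T (v ≠ 0, with inverse k), s₁ = y₁/x₁ is l + x₂ x₃ k, so that the
    -- symmetric functions of the images are polynomials in l, v and k: the images lie on the line
    -- with slope d (l + m k) and intercept d³ (v − m l² k).
    module AwayFromT {l v k x₁ x₂ x₃ : F} (sec : Secant l v x₁ x₂ x₃) (vk : v * k ≡ 1#) where
      open Secant sec

      s₁ s₂ s₃ l′ g : F
      s₁ = l + x₂ * x₃ * k
      s₂ = l + x₁ * x₃ * k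
      -- The factors are ordered so that `s₂` and `s₃` are by definition the first slopes of the
      -- lines rearranged by `Secant-swap₁₂` and `Secant-swap₁₃`.
      s₃ = l + x₂ * x₁ * k
      l′ = (l + m * k) * d
      g = v - m * (l * l) * k

      s*x : s₁ * x₁ ≡ l * x₁ + v
      s*x = lin k e₃ (lin v vk (solve 6 (λ l v k x₁ x₂ x₃ →
        (l :+ x₂ :* x₃ :* k) :* x₁ :+ k :* (v :* v) :+ v :* con 1ℤ
        := l :* x₁ :+ v :+ k :* (x₁ :* x₂ :* x₃) :+ v :* (v :* k)) refl l v k x₁ x₂ x₃))

      module _ (x₁≢0 : x₁ ≢ 0#) where

        x² : x₁ * x₁ ≡ s₁ * s₁ * x₁ + m
        x² = slope-eq x₁≢0 s*x (Secant-On sec)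

        -- The slope equation divided by x₁, where 1/x₁ = x₂ x₃ k² because x₁ x₂ x₃ = v².
        s² : s₁ * s₁ ≡ x₁ - m * (x₂ * x₃ * (k * k))
        s² = *-cancelˡ x₁≢0 (lin (- 1#) x² (lin (m * (k * k)) e₃ (lin (m * (v * k + 1#)) vk
          (solve 7 (λ s v k x₁ x₂ x₃ m →
            x₁ :* (s :* s) :+ :- con 1ℤ :* (s :* s :* x₁ :+ m) :+ m :* (k :* k) :* (v :* v)
              :+ m :* (v :* k :+ con 1ℤ) :* con 1ℤ
            := x₁ :* (x₁ :- m :* (x₂ :* x₃ :* (k :* k))) :+ :- con 1ℤ :* (x₁ :* x₁)
              :+ m :* (k :* k) :* (x₁ :* x₂ :* x₃) :+ m :* (v :* k :+ con 1ℤ) :* (v :* k)) refl s₁ v k x₁ x₂ x₃ m))))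

        -- Up to powers of d this is the equation of the image line, ordinate against abscissa s₁².
        s-line : s₁ * (2# * x₁ - s₁ * s₁) ≡ (l + m * k) * (s₁ * s₁) + g
        s-line = lin 1# s*x (lin (- s₁ - l) s² (solve 7 (λ l v k x₁ x₂ x₃ m →
          let s = l :+ x₂ :* x₃ :* k in
          s :* (con (+ 2) :* x₁ :- s :* s) :+ con 1ℤ :* (l :* x₁ :+ v)
            :+ (:- s :- l) :* (x₁ :- m :* (x₂ :* x₃ :* (k :* k)))
          := (l :+ m :* k) :* (s :* s) :+ (v :- m :* (l :* l) :* k) :+ con 1ℤ :* (s :* x₁)
            :+ (:- s :- l) :* (s :* s)) refl l v k x₁ x₂ x₃ m))

        image-line : image x₁ s₁ ≡ aff (d * s₁ * (d * s₁)) (l′ * (d * s₁ * (d * s₁)) + d * d * d * g)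
        image-line = cong (aff (d * s₁ * (d * s₁))) (lin (d * d * d) s-line (solve 7 (λ d s x l m k g →
          let p = s :* (con (+ 2) :* x :- s :* s) ; r = (l :+ m :* k) :* (s :* s) :+ g ; D = d :* d :* d in
          D :* p :+ D :* r := (l :+ m :* k) :* d :* (d :* s :* (d :* s)) :+ D :* g :+ D :* p) refl d s₁ x₁ l m k g))

        η-line : η (aff x₁ (l * x₁ + v)) ≡ aff (d * s₁ * (d * s₁)) (l′ * (d * s₁ * (d * s₁)) + d * d * d * g)
        η-line = trans (η-image s₁ x₁≢0 s*x) image-line

      -- After scaling, this makes the product of the image abscissas the square of the intercept d³
      -- g, which is the third condition of `Secant`.
      s-product : s₁ * s₂ * s₃ ≡ g
      s-product =
        lin (l * l * k) e₂ (lin (l * (k * k) * (x₁ + x₂ + x₃) + k * k * k * (x₁ * x₂ * x₃ + v * v)) e₃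
          (lin (l * (k * k) * (v * v)) e₁ (lin (l * l * l * (v * k - 1#) + v * (k * k * (v * v) + k * v + 1#)) vk
            (solve 7 (λ l v k x₁ x₂ x₃ m → let
              p = x₁ :* x₂ :* x₃
              E = x₁ :+ x₂ :+ x₃
              c₂ = l :* l :* k
              c₃ = l :* (k :* k) :* E :+ k :* k :* k :* (p :+ v :* v)
              c₁ = l :* (k :* k) :* (v :* v)
              c₀ = l :* l :* l :* (v :* k :- con 1ℤ) :+ v :* (k :* k :* (v :* v) :+ k :* v :+ con 1ℤ)
             in (l :+ x₂ :* x₃ :* k) :* (l :+ x₁ :* x₃ :* k) :* (l :+ x₂ :* x₁ :* k)
                  :+ c₂ :* (:- m :- con (+ 2) :* (l :* v)) :+ c₃ :* (v :* v) :+ c₁ :* (l :* l) :+ c₀ :* con 1ℤ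
                := (v :- m :* (l :* l) :* k)
                  :+ c₂ :* (x₁ :* x₂ :+ x₁ :* x₃ :+ x₂ :* x₃) :+ c₃ :* p :+ c₁ :* E :+ c₀ :* (v :* k))
             refl l v k x₁ x₂ x₃ m))))

    module _ {l v k x₁ x₂ x₃ : F} (sec : Secant l v x₁ x₂ x₃) (vk : v * k ≡ 1#)
             (x₁≢0 : x₁ ≢ 0#) (x₂≢0 : x₂ ≢ 0#) (x₃≢0 : x₃ ≢ 0#) where
      open Secant sec
      private
        module L₁ = AwayFromT sec vk
        module L₂ = AwayFromT (Secant-swap₁₂ sec) vk
        module L₃ = AwayFromT (Secant-swap₁₃ sec) vk
      open L₁ using (s₁; s₂; s₃; l′; g)

      private
        s²₁ = L₁.s² x₁≢0
        s²₂ = L₂.s² x₂≢0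
        s²₃ = L₃.s² x₃≢0

      s²-sum : s₁ * s₁ + s₂ * s₂ + s₃ * s₃ ≡ (l + m * k) * (l + m * k)
      s²-sum = trans (cong₂ _+_ (cong₂ _+_ s²₁ s²₂) s²₃)
        (lin 1# e₁ (lin (- m * (k * k)) e₂ (lin (2# * m * l * k) vk (solve 7 (λ l v k x₁ x₂ x₃ m → let
            E = x₁ :+ x₂ :+ x₃
            kk = k :* k
            c₂ = :- m :* kk
            c₀ = con (+ 2) :* m :* l :* k
          in (x₁ :- m :* (x₂ :* x₃ :* kk)) :+ (x₂ :- m :* (x₁ :* x₃ :* kk)) :+ (x₃ :- m :* (x₂ :* x₁ :* kk))
               :+ con 1ℤ :* (l :* l) :+ c₂ :* (:- m :- con (+ 2) :* (l :* v)) :+ c₀ :* con 1ℤ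
             := (l :+ m :* k) :* (l :+ m :* k)
               :+ con 1ℤ :* E :+ c₂ :* (x₁ :* x₂ :+ x₁ :* x₃ :+ x₂ :* x₃) :+ c₀ :* (v :* k))
          refl l v k x₁ x₂ x₃ m))))

      s²-pairs : s₁ * s₁ * (s₂ * s₂) + s₁ * s₁ * (s₃ * s₃) + s₂ * s₂ * (s₃ * s₃)
               ≡ 2# * (m - l * v + m * (l * l) * k * (l + m * k))
      s²-pairs = trans (cong₂ _+_ (cong₂ _+_ (cong₂ _*_ s²₁ s²₂) (cong₂ _*_ s²₁ s²₃)) (cong₂ _*_ s²₂ s²₃))
        (lin (1# - m * (k * k) * (x₁ + x₂ + x₃)) e₂
          (lin (m * (k * k) * (m + 2# * (l * v)) + m * m * (k * k * (k * k)) * (x₁ * x₂ * x₃)) e₁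
            (lin (ι (+ 3) * m * (k * k) + m * m * (k * k * (k * k)) * (l * l)) e₃
              (lin ((v * k + 1#) * (ι (+ 3) * m + m * m * (l * l) * (k * k)) + 2# * m * (l * l * l) * k) vk
                (solve 7 (λ l v k x₁ x₂ x₃ m → let
                    E = x₁ :+ x₂ :+ x₃
                    p = x₁ :* x₂ :* x₃
                    kk = k :* k
                    c₂ = con 1ℤ :- m :* kk :* E
                    c₁ = m :* kk :* (m :+ con (+ 2) :* (l :* v)) :+ m :* m :* (kk :* kk) :* p
                    c₃ = con (+ 3) :* m :* kk :+ m :* m :* (kk :* kk) :* (l :* l)
                    c₀ = (v :* k :+ con 1ℤ) :* (con (+ 3) :* m :+ m :* m :* (l :* l) :* kk)
                         :+ con (+ 2) :* m :* (l :* l :* l) :* k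
                    A = x₁ :- m :* (x₂ :* x₃ :* kk)
                    B = x₂ :- m :* (x₁ :* x₃ :* kk)
                    C = x₃ :- m :* (x₂ :* x₁ :* kk)
                  in A :* B :+ A :* C :+ B :* C :+ c₂ :* (:- m :- con (+ 2) :* (l :* v)) :+ c₁ :* (l :* l)
                       :+ c₃ :* (v :* v) :+ c₀ :* con 1ℤ
                     := con (+ 2) :* (m :- l :* v :+ m :* (l :* l) :* k :* (l :+ m :* k))
                       :+ c₂ :* (x₁ :* x₂ :+ x₁ :* x₃ :+ x₂ :* x₃) :+ c₁ :* E :+ c₃ :* p :+ c₀ :* (v :* k))
                  refl l v k x₁ x₂ x₃ m)))))

      image-secant : Secant l′ (d * d * d * g) (d * s₁ * (d * s₁)) (d * s₂ * (d * s₂)) (d * s₃ * (d * s₃))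
      image-secant = secant
        (square-scale-sum s₁ s₂ s₃ (l + m * k) s²-sum)
        (square-scale-pairs s₁ s₂ s₃ l v k vk s²-pairs)
        (square-scale-product s₁ s₂ s₃ g L₁.s-product)

      η-line-nonzero : Collinear (η (aff x₁ (l * x₁ + v))) (η (aff x₂ (l * x₂ + v))) (η (aff x₃ (l * x₃ + v)))
      η-line-nonzero = Collinear-resp (L₁.η-line x₁≢0) (L₂.η-line x₂≢0) (L₃.η-line x₃≢0)
        (line l′ (d * d * d * g) image-secant)

    -- A line through T has v = 0, so the two other points share the slope l, and x₂ + x₃ = l² makes
    -- 2 x₂ - l² and 2 x₃ - l² opposite.
    η-line-zero : ∀ {l v x₁ x₂ x₃} → Secant l v x₁ x₂ x₃ → x₁ ≡ 0# →
                  η (aff x₂ (l * x₂ + v)) ≡ neg (η (aff x₃ (l * x₃ + v)))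
    η-line-zero {l} {v} {x₁} {x₂} {x₃} (secant e₁ e₂ e₃) refl =
      trans (η-image l x₂≢0 (l*x≡y x₂)) (trans image-neg-eq (cong neg (sym (η-image l x₃≢0 (l*x≡y x₃)))))
      where
      v≡0 : v ≡ 0#
      v≡0 = xx≡0⇒x≡0 (trans (sym e₃) (solve 2 (λ b c → con 0ℤ :* b :* c := con 0ℤ) refl x₂ x₃))

      l*x≡y : ∀ x → l * x ≡ l * x + v
      l*x≡y x = trans (sym (+-identityʳ _)) (cong (_+_ (l * x)) (sym v≡0))

      x₂x₃ : x₂ * x₃ ≡ - m
      x₂x₃ = lin 1# e₂ (lin (- (2# * l)) v≡0 (solve 5 (λ l v b c m →
        b :* c :+ con 1ℤ :* (:- m :- con (+ 2) :* (l :* v)) :+ :- (con (+ 2) :* l) :* con 0ℤ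
        := :- m :+ con 1ℤ :* (con 0ℤ :* b :+ con 0ℤ :* c :+ b :* c) :+ :- (con (+ 2) :* l) :* v) refl l v x₂ x₃ m))

      x₂≢0 : x₂ ≢ 0#
      x₂≢0 e = neg-nonzero m≢0 (trans (sym x₂x₃) (trans (cong (_* x₃) e) (zeroˡ x₃)))

      x₃≢0 : x₃ ≢ 0#
      x₃≢0 e = neg-nonzero m≢0 (trans (sym x₂x₃) (trans (cong (x₂ *_) e) (zeroʳ x₂)))

      image-neg-eq : image x₂ l ≡ neg (image x₃ l)
      image-neg-eq = cong (aff _) (lin (2# * (d * d * d) * l) e₁ (solve 4 (λ d l b c → let
          D = d :* d :* d
          e = con (+ 2) :* D :* l
        in D :* (l :* (con (+ 2) :* b :- l :* l)) :+ e :* (l :* l)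
           := :- (D :* (l :* (con (+ 2) :* c :- l :* l))) :+ e :* (con 0ℤ :+ b :+ c)) refl d l x₂ x₃))

    η-Collinear : ∀ {P Q R} → Collinear P Q R → Collinear (η P) (η Q) (η R)
    η-Collinear (∞₁ {Q = Q} refl) = ∞₁ (η-neg Q)
    η-Collinear (∞₂ {Q = Q} refl) = ∞₂ (η-neg Q)
    η-Collinear (∞₃ {Q = Q} refl) = ∞₃ (η-neg Q)
    η-Collinear (line {x₁} {x₂} {x₃} l v sec) = lemma (x₁ ≟ 0#) (x₂ ≟ 0#) (x₃ ≟ 0#)
      where
      lemma : Dec (x₁ ≡ 0#) → Dec (x₂ ≡ 0#) → Dec (x₃ ≡ 0#) →
              Collinear (η (aff x₁ (l * x₁ + v))) (η (aff x₂ (l * x₂ + v))) (η (aff x₃ (l * x₃ + v)))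
      lemma (yes x₁≡0) _ _ = Collinear-resp (η-0 x₁≡0) refl refl (∞₁ (η-line-zero sec x₁≡0))
      lemma (no _) (yes x₂≡0) _ =
        Collinear-resp refl (η-0 x₂≡0) refl (∞₂ (η-line-zero (Secant-swap₁₂ sec) x₂≡0))
      lemma (no _) (no _) (yes x₃≡0) = Collinear-resp refl refl (η-0 x₃≡0)
        (∞₃ (trans (sym (neg-involutive _)) (cong neg (sym (η-line-zero (Secant-swap₁₃ sec) x₃≡0)))))
      lemma (no x₁≢0) (no x₂≢0) (no x₃≢0) = η-line-nonzero sec (*-inv v v≢0) x₁≢0 x₂≢0 x₃≢0
        where
        v≢0 : v ≢ 0#
        v≢0 e = *-nonzero (*-nonzero x₁≢0 x₂≢0) x₃≢0 (trans (Secant.e₃ sec) (trans (cong (v *_) e) (zeroʳ v)))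

    η^-Collinear : ∀ h {P Q R} → Collinear P Q R → Collinear (η^ h P) (η^ h Q) (η^ h R)
    η^-Collinear zero col = col
    η^-Collinear (suc h) col = η-Collinear (η^-Collinear h col)

    -- The third abscissa is dictated by `e₁`. The difference of the two curve equations, divided by
    -- x₁ - x₂, is `e₂`; the curve equation at x₁ then gives `e₃`.
    chord : ∀ {l v x₁ x₂} → x₁ ≢ x₂ → On (aff x₁ (l * x₁ + v)) → On (aff x₂ (l * x₂ + v)) →
            Secant l v x₁ x₂ (l * l - x₁ - x₂)
    chord {l} {v} {x₁} {x₂} x₁≢x₂ on₁ on₂ = secant
      (solve 3 (λ l a b → a :+ b :+ (l :* l :- a :- b) := l :* l) refl l x₁ x₂)
      e₂
      (lin (- 1#) on₁ (lin x₁ e₂ (solve 5 (λ l v a b m → let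
          c = l :* l :- a :- b
          y = l :* a :+ v
        in a :* b :* c :+ :- con 1ℤ :* (a :* a :* a :- m :* a) :+ a :* (:- m :- con (+ 2) :* (l :* v))
           := v :* v :+ :- con 1ℤ :* (y :* y) :+ a :* (a :* b :+ a :* c :+ b :* c)) refl l v x₁ x₂ m)))
      where
      e₂ : x₁ * x₂ + x₁ * (l * l - x₁ - x₂) + x₂ * (l * l - x₁ - x₂) ≡ - m - 2# * (l * v)
      e₂ = *-cancelˡ (x₁≢x₂ ∘ x-y≡0⇒x≡y) (lin 1# on₁ (lin (- 1#) on₂ (solve 5 (λ l v a b m → let
          c = l :* l :- a :- b
          y = l :* a :+ v
          z = l :* b :+ v
        in (a :- b) :* (a :* b :+ a :* c :+ b :* c) :+ con 1ℤ :* (a :* a :* a :- m :* a)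
             :+ :- con 1ℤ :* (b :* b :* b :- m :* b)
           := (a :- b) :* (:- m :- con (+ 2) :* (l :* v)) :+ con 1ℤ :* (y :* y) :+ :- con 1ℤ :* (z :* z))
        refl l v x₁ x₂ m)))

    On-same-x : ∀ {x y y′} → On (aff x y) → On (aff x y′) → y ≡ y′ ⊎ y ≡ - y′
    On-same-x on on′ = xx≡yy⇒x≡±y (trans on (sym on′))

    -- The condition P ≠ Q keeps tangents out. It can be met in both applications because there the
    -- two points have different images under some `η^ h`.
    third-point : ∀ {P Q} → On P → On Q → P ≢ Q → ∃ λ R → On R × Collinear P Q R
    third-point {∞} {Q} _ on _ = neg Q , neg-On {Q} on , ∞₁ (sym (neg-involutive Q))
    third-point {aff x y} {∞} on _ _ = neg (aff x y) , neg-On {aff x y} on , ∞₂ (sym (neg-involutive (aff x y)))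
    third-point {aff x₁ y₁} {aff x₂ y₂} on₁ on₂ P≢Q with x₁ ≟ x₂
    third-point {aff x₁ y₁} {aff .x₁ y₂} on₁ on₂ P≢Q | yes refl with On-same-x {x₁} on₁ on₂
    ... | inj₁ refl = contradiction refl P≢Q
    ... | inj₂ refl = ∞ , tt , ∞₃ refl
    third-point {aff x₁ y₁} {aff x₂ y₂} on₁ on₂ P≢Q | no x₁≢x₂ =
      _ , Secant-On (Secant-swap₁₃ sec) , line′ l v sec y₁-line y₂-line refl
      where
      w l v : F
      w = inv (x₂ - x₁)
      l = (y₂ - y₁) * w
      v = y₁ - l * x₁

      y₁-line : y₁ ≡ l * x₁ + v
      y₁-line = solve 2 (λ y e → y := e :+ (y :- e)) refl y₁ (l * x₁)

      y₂-line : y₂ ≡ l * x₂ + v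
      y₂-line = lin (y₁ - y₂) (*-inv (x₂ - x₁) (x₁≢x₂ ∘ sym ∘ x-y≡0⇒x≡y)) (solve 5 (λ x₁ y₁ x₂ y₂ w → let l = (y₂ :- y₁) :* w in
        y₂ :+ (y₁ :- y₂) :* con 1ℤ := l :* x₂ :+ (y₁ :- l :* x₁) :+ (y₁ :- y₂) :* ((x₂ :- x₁) :* w)) refl x₁ y₁ x₂ y₂ w)

      sec : Secant l v x₁ x₂ (l * l - x₁ - x₂)
      sec = chord x₁≢x₂ (subst (λ z → On (aff x₁ z)) y₁-line on₁) (subst (λ z → On (aff x₂ z)) y₂-line on₂)

    -- Translation by `T` and the fibres of `η`

    τx : F → F
    τx x = - m * inv x

    -- Translation by T.
    τ : Point → Point
    τ ∞ = T
    τ (aff x y) with x ≟ 0#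
    ... | yes _ = ∞
    ... | no _ = aff (τx x) (- (y * inv x) * τx x)

    τ-0 : ∀ {x y} → x ≡ 0# → τ (aff x y) ≡ ∞
    τ-0 {x} x≡0 with x ≟ 0#
    ... | yes _ = refl
    ... | no x≢0 = contradiction x≡0 x≢0

    τ-slope : ∀ {x s} → x ≢ 0# → τ (aff x (s * x)) ≡ aff (τx x) (- s * τx x)
    τ-slope {x} {s} x≢0 with x ≟ 0#
    ... | yes x≡0 = contradiction x≡0 x≢0
    ... | no _ = cong (aff _) (cong (λ z → - z * τx x) (lin s (*-inv x x≢0)
      (solve 3 (λ s x w → s :* x :* w :+ s :* con 1ℤ := s :+ s :* (x :* w)) refl s x (inv x))))

    -- A point with x ≠ 0 is determined by x and its slope y/x.
    data View : Point → Set where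
      view-∞ : View ∞
      view-T : View T
      view-slope : ∀ {x} s → x ≢ 0# → x * x ≡ s * s * x + m → View (aff x (s * x))

    view : ∀ {P} → On P → View P
    view {∞} on = view-∞
    view {aff x y} on with x ≟ 0#
    ... | yes refl rewrite On-y≡0 on refl = view-T
    ... | no x≢0 = subst (View ∘ aff x) (slope*x x≢0) (view-slope _ x≢0 (slope-eq x≢0 (slope*x x≢0) on))

    module _ {x s : F} (x≢0 : x ≢ 0#) (e : x * x ≡ s * s * x + m) where

      -- Vieta: x and -m/x are the two roots of X² = s² X + m.
      x+τx : x + τx x ≡ s * s
      x+τx = lin (inv x) e (lin (s * s - x) (*-inv x x≢0) (solve 4 (λ x s m w →
        x :+ :- m :* w :+ w :* (s :* s :* x :+ m) :+ (s :* s :- x) :* con 1ℤ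
        := s :* s :+ w :* (x :* x) :+ (s :* s :- x) :* (x :* w)) refl x s m (inv x)))

      τx≢0 : τx x ≢ 0#
      τx≢0 = *-nonzero (neg-nonzero m≢0) (inv-nonzero x≢0)

      τx-slope : τx x * τx x ≡ - s * - s * τx x + m
      τx-slope = lin (τx x) x+τx (lin m (*-inv x x≢0) (solve 4 (λ x s m w → let t = :- m :* w in
        t :* t :+ t :* (s :* s) :+ m :* con 1ℤ := :- s :* :- s :* t :+ m :+ t :* (x :+ t) :+ m :* (x :* w)) refl x s m (inv x)))

      -- The slope changes sign, and 2 x - s² changes sign along with it since x + τx = s².
      image-τ : image (τx x) (- s) ≡ image x s
      image-τ = cong₂ aff
        (solve 2 (λ d s → d :* :- s :* (d :* :- s) := d :* s :* (d :* s)) refl d s)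
        (lin (- (2# * (d * d * d) * s)) x+τx (solve 4 (λ d x s t → let
            D = d :* d :* d
            c = :- (con (+ 2) :* D :* s)
          in D :* (:- s :* (con (+ 2) :* t :- :- s :* :- s)) :+ c :* (s :* s)
             := D :* (s :* (con (+ 2) :* x :- s :* s)) :+ c :* (x :+ t)) refl d x s (τx x)))

    ∞≢aff : ∀ {x y} → ∞ ≢ aff x y
    ∞≢aff ()

    aff-injective : ∀ {x y x′ y′} → aff x y ≡ aff x′ y′ → x ≡ x′ × y ≡ y′
    aff-injective refl = refl , refl

    η-τ : ∀ {P} → On P → η (τ P) ≡ η P
    η-τ on with view on
    ... | view-∞ = η-0 refl
    ... | view-T = trans (cong η (τ-0 refl)) (sym (η-0 refl))
    ... | view-slope s x≢0 e = trans (cong η (τ-slope x≢0))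
      (trans (η-image (- s) (τx≢0 x≢0 e) refl) (trans (image-τ x≢0 e) (sym (η-image s x≢0 refl))))

    -- A fixed point would have τx = x and -s x = s x, so s x = 0; then x + τx = s² gives 2 x² = s
    -- (s x) = 0.
    τ-≢ : ∀ {P} → On P → τ P ≢ P
    τ-≢ on with view on
    ... | view-∞ = λ ()
    ... | view-T = λ τT≡T → ∞≢aff (trans (sym (τ-0 refl)) τT≡T)
    ... | view-slope {x} s x≢0 e = λ τP≡P →
      let (x′≡x , y′≡y) = aff-injective (trans (sym (τ-slope x≢0)) τP≡P)
          sx≡0 : s * x ≡ 0#
          sx≡0 = x+x≡0⇒x≡0 2≢0 (lin (- 1#) y′≡y (lin (- s) x′≡x (solve 3 (λ s x t →
            s :* x :+ s :* x :+ :- con 1ℤ :* (s :* x) :+ :- s :* x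
            := con 0ℤ :+ :- con 1ℤ :* (:- s :* t) :+ :- s :* t) refl s x (τx x))))
          x≡0 = x+x≡0⇒x≡0 2≢0 (*-cancelˡ x≢0 (lin x (x+τx x≢0 e) (lin s sx≡0 (lin (- x) x′≡x (solve 3 (λ s x t →
            x :* (x :+ x) :+ x :* (s :* s) :+ s :* con 0ℤ :+ :- x :* x
            := x :* con 0ℤ :+ x :* (x :+ t) :+ s :* (s :* x) :+ :- x :* t) refl s x (τx x))))))
      in x≢0 x≡0

    d≢0 : d ≢ 0#
    d≢0 refl = 1≢0 (trans (sym (-‿involutive 1#)) (trans (cong -_ (trans (sym 4d⁴≡-1)
      (solve 0 (con (+ 4) :* (con 0ℤ :* con 0ℤ :* (con 0ℤ :* con 0ℤ)) := con 0ℤ) refl))) -0≡0))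

    -- Equal images force s′² = s², so x and x′ are roots of the same quadratic X² = s² X + m:
    -- either they agree or x′ = τx. The ordinates of the images then decide the sign of s′.
    η-fibre : ∀ {P Q} → On P → On Q → η P ≡ η Q → Q ≡ P ⊎ Q ≡ τ P
    η-fibre onP onQ ηP≡ηQ with view onP | view onQ
    ... | view-∞ | view-∞ = inj₁ refl
    ... | view-∞ | view-T = inj₂ refl
    ... | view-∞ | view-slope s x≢0 e = contradiction (trans ηP≡ηQ (η-image s x≢0 refl)) ∞≢aff
    ... | view-T | view-∞ = inj₂ (sym (τ-0 refl))
    ... | view-T | view-T = inj₁ refl
    ... | view-T | view-slope s x≢0 e = contradiction (trans (sym (η-0 refl)) (trans ηP≡ηQ (η-image s x≢0 refl))) ∞≢aff
    ... | view-slope s x≢0 e | view-∞ = contradiction (trans (sym ηP≡ηQ) (η-image s x≢0 refl)) ∞≢aff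
    ... | view-slope s x≢0 e | view-T =
      contradiction (trans (sym (trans ηP≡ηQ (η-0 refl))) (η-image s x≢0 refl)) ∞≢aff
    ... | view-slope {x} s x≢0 e | view-slope {x′} s′ x′≢0 e′ = lemma (xx≡yy⇒x≡±y ds≡±ds′) (x′ ≟ x)
      where
      images : image x s ≡ image x′ s′
      images = trans (sym (η-image s x≢0 refl)) (trans ηP≡ηQ (η-image s′ x′≢0 refl))

      ds≡±ds′ : d * s * (d * s) ≡ d * s′ * (d * s′)
      ds≡±ds′ = proj₁ (aff-injective images)

      ss : s * s ≡ s′ * s′
      ss = *-cancelˡ d≢0 (*-cancelˡ d≢0 (trans (solve 2 (λ d s → d :* (d :* (s :* s)) := d :* s :* (d :* s)) refl d s)
        (trans ds≡±ds′ (solve 2 (λ d s → d :* s :* (d :* s) := d :* (d :* (s :* s))) refl d s′))))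

      Y : s * (2# * x - s * s) ≡ s′ * (2# * x′ - s′ * s′)
      Y = *-cancelˡ (*-nonzero (*-nonzero d≢0 d≢0) d≢0) (proj₂ (aff-injective images))

      to-τ : s′ ≡ - s → x′ ≡ τx x → aff x′ (s′ * x′) ≡ τ (aff x (s * x))
      to-τ refl refl = sym (τ-slope x≢0)

      lemma : d * s ≡ d * s′ ⊎ d * s ≡ - (d * s′) → Dec (x′ ≡ x) →
              aff x′ (s′ * x′) ≡ aff x (s * x) ⊎ aff x′ (s′ * x′) ≡ τ (aff x (s * x))
      lemma (inj₁ ds≡ds′) (yes x′≡x) = inj₁ (cong₂ (λ x s → aff x (s * x)) x′≡x (sym (*-cancelˡ d≢0 ds≡ds′)))
      -- Same abscissa, opposite slopes: comparing ordinates leaves s (2 x - s²) = 0. Either s = 0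
      -- and the points coincide, or 2 x = s² and x = τx.
      lemma (inj₂ ds≡-ds′) (yes refl) = cases (xy≡0⇒x≡0∨y≡0 zero-product)
        where
        s′≡-s : s′ ≡ - s
        s′≡-s = *-cancelˡ d≢0 (lin 1# ds≡-ds′ (solve 3 (λ d s t →
          d :* t :+ con 1ℤ :* :- (d :* t) := d :* :- s :+ con 1ℤ :* (d :* s)) refl d s s′))

        zero-product : s * (2# * x - s * s) ≡ 0#
        zero-product = x+x≡0⇒x≡0 2≢0 (lin 1# Y (lin (2# * x - s * s + s * s′ - s′ * s′) s′≡-s
          (solve 3 (λ s t x → let
            a = s :* (con (+ 2) :* x :- s :* s)
            b = t :* (con (+ 2) :* x :- t :* t)
            c = con (+ 2) :* x :- s :* s :+ s :* t :- t :* t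
            in a :+ a :+ con 1ℤ :* b :+ c :* :- s := con 0ℤ :+ con 1ℤ :* a :+ c :* t) refl s s′ x)))

        cases : s ≡ 0# ⊎ 2# * x - s * s ≡ 0# →
                aff x (s′ * x) ≡ aff x (s * x) ⊎ aff x (s′ * x) ≡ τ (aff x (s * x))
        cases (inj₁ refl) = inj₁ (cong (λ s → aff x (s * x)) (trans s′≡-s -0≡0))
        cases (inj₂ 2x) = inj₂ (to-τ s′≡-s (lin 1# 2x (lin (- 1#) (x+τx x≢0 e) (solve 3 (λ s x t →
          x :+ con 1ℤ :* con 0ℤ :+ :- con 1ℤ :* (s :* s)
          := t :+ con 1ℤ :* (con (+ 2) :* x :- s :* s) :+ :- con 1ℤ :* (x :+ t)) refl s x (τx x)))))
      lemma _ (no x′≢x) = inj₂ (to-τ s′≡-s x′≡τx)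
        where
        sum-roots : x + x′ ≡ s * s
        sum-roots = *-cancelˡ (x′≢x ∘ x-y≡0⇒x≡y) (lin 1# e′ (lin (- 1#) e (lin (- x′) ss (solve 5 (λ s t x z m →
          (z :- x) :* (x :+ z) :+ con 1ℤ :* (t :* t :* z :+ m) :+ :- con 1ℤ :* (s :* s :* x :+ m) :+ :- z :* (t :* t)
          := (z :- x) :* (s :* s) :+ con 1ℤ :* (z :* z) :+ :- con 1ℤ :* (x :* x) :+ :- z :* (s :* s))
          refl s s′ x x′ m))))

        x′≡τx : x′ ≡ τx x
        x′≡τx = lin 1# sum-roots (lin (- 1#) (x+τx x≢0 e) (solve 4 (λ x z t e →
          z :+ con 1ℤ :* e :+ :- con 1ℤ :* e := t :+ con 1ℤ :* (x :+ z) :+ :- con 1ℤ :* (x :+ t)) refl x x′ (τx x) (s * s)))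

        s′≡-s : s′ ≡ - s
        s′≡-s = *-cancelˡ (x′≢x ∘ x-y≡0⇒x≡y) (lin (- 1#) Y (lin (- s′) ss (lin (s - s′) sum-roots (solve 4 (λ s t x z →
          (z :- x) :* t :+ :- con 1ℤ :* (t :* (con (+ 2) :* z :- t :* t)) :+ :- t :* (t :* t) :+ (s :- t) :* (s :* s)
          := (z :- x) :* :- s :+ :- con 1ℤ :* (s :* (con (+ 2) :* x :- s :* s)) :+ :- t :* (s :* s)
             :+ (s :- t) :* (x :+ z)) refl s s′ x x′))))

    -- Sizes of the images ηʰ E(F)

    infix 4 _≟ᴾ_
    _≟ᴾ_ : (P Q : Point) → Dec (P ≡ Q)
    ∞ ≟ᴾ ∞ = yes refl
    ∞ ≟ᴾ aff _ _ = no λ ()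
    aff _ _ ≟ᴾ ∞ = no λ ()
    aff x y ≟ᴾ aff x′ y′ = map′ (λ (e , e′) → cong₂ aff e e′) aff-injective ((x ≟ x′) ×-dec (y ≟ y′))

    On? : ∀ P → Dec (On P)
    On? ∞ = yes tt
    On? (aff x y) = y * y ≟ x * x * x - m * x

    -- All pairs of coordinates are listed, on the curve or off it. Sums stay restricted to the
    -- curve because they are weighted by the indicator of `W`.
    Point-finite : Finite Point
    Point-finite = record
      { elements = ∞ ∷ cartesianProductWith aff (allFin q) (allFin q)
      ; unique = All.cartesianProductWith⁺ (setoid F) (setoid F) aff (allFin q) (allFin q) (λ _ _ → ∞≢aff)
                 ∷ cartesianProductWith⁺ aff aff-injective (allFin⁺ q) (allFin⁺ q)
      ; complete = complete
      ; _≟_ = _≟ᴾ_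
      }
      where
      complete : ∀ P → P ∈ ∞ ∷ cartesianProductWith aff (allFin q) (allFin q)
      complete ∞ = here refl
      complete (aff x y) = there (∈-cartesianProductWith⁺ aff (∈-allFin x) (∈-allFin y))

    private
      module ℙ = Finite Point-finite

    -- ηʰ E(F)
    W : ℕ → Point → Set
    W h Q = ∃ λ P → On P × η^ h P ≡ Q

    W? : ∀ h Q → Dec (W h Q)
    W? h Q = ℙ.any? (λ P → On? P ×-dec (η^ h P ≟ᴾ Q))

    size : ℕ → ℤ
    size h = ℙ.∑ (λ Q → 𝟙 (W? h Q))

    W-On : ∀ h {Q} → W h Q → On Q
    W-On h (P , on , refl) = η^-On h on

    η^-∞ : ∀ h → η^ h ∞ ≡ ∞
    η^-∞ zero = refl
    η^-∞ (suc h) = cong η (η^-∞ h)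

    W-∞ : ∀ h → W h ∞
    W-∞ h = ∞ , tt , η^-∞ h

    η^-suc : ∀ h P → η^ (suc h) P ≡ η^ h (η P)
    η^-suc zero P = refl
    η^-suc (suc h) P = cong η (η^-suc h P)

    W-pred : ∀ h {Q} → W (suc h) Q → W h Q
    W-pred h (P , on , e) = η P , η-On on , trans (sym (η^-suc h P)) e

    W-neg : ∀ h {Q} → W h Q → W h (neg Q)
    W-neg h (P , on , e) = neg P , neg-On {P} on , trans (η^-neg h P) (cong neg e)

    Collinear-T∞ : ∀ {P Q R} → Collinear P Q R → P ≡ T → Q ≡ ∞ → R ≡ T
    Collinear-T∞ (∞₁ _) () _
    Collinear-T∞ (∞₂ {Q = Q} P≡-Q) P≡T _ = trans (sym (neg-involutive Q)) (trans (cong neg (trans (sym P≡-Q) P≡T)) neg-T)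
    Collinear-T∞ (∞₃ refl) P≡T Q≡∞ = contradiction (trans (cong neg (sym Q≡∞)) P≡T) ∞≢aff

    -- A line through T has intercept 0, so its slope is that of Q, and `e₂` reduces to x x₃ = -m:
    -- the third point is -(Q + T).
    Collinear-T : ∀ {P Q R x s} → Collinear P Q R → P ≡ T → Q ≡ aff x (s * x) → x ≢ 0# → R ≡ neg (τ Q)
    Collinear-T {x = x} {s} (line {x₁} {x₂} {x₃} l v (secant e₁ e₂ e₃)) P≡T Q≡ x≢0 =
      trans (cong₂ aff x₃≡τx y₃) (cong neg (trans (sym (τ-slope {x} {s} x≢0)) (cong τ (sym Q≡))))
      where
      x₁≡0 = proj₁ (aff-injective P≡T)
      x₂≡x = proj₁ (aff-injective Q≡)

      v≡0 : v ≡ 0#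
      v≡0 = lin 1# (proj₂ (aff-injective P≡T)) (lin (- l) x₁≡0 (solve 3 (λ l v a →
        v :+ con 1ℤ :* con 0ℤ :+ :- l :* con 0ℤ := con 0ℤ :+ con 1ℤ :* (l :* a :+ v) :+ :- l :* a) refl l v x₁))

      l≡s : l ≡ s
      l≡s = *-cancelˡ x≢0 (lin 1# (proj₂ (aff-injective Q≡)) (lin (- 1#) v≡0 (lin (- l) x₂≡x (solve 5 (λ x s l v x₂ →
        x :* l :+ con 1ℤ :* (s :* x) :+ :- con 1ℤ :* con 0ℤ :+ :- l :* x
        := x :* s :+ con 1ℤ :* (l :* x₂ :+ v) :+ :- con 1ℤ :* v :+ :- l :* x₂) refl x s l v x₂))))

      x₃≡τx : x₃ ≡ τx x
      x₃≡τx = *-cancelˡ x≢0 (lin 1# e₂ (lin (- (x₂ + x₃)) x₁≡0 (lin (- (2# * l)) v≡0 (lin (- x₃) x₂≡x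
        (lin m (*-inv x x≢0) (solve 8 (λ x w l v a b c m →
          x :* c :+ con 1ℤ :* (:- m :- con (+ 2) :* (l :* v)) :+ :- (b :+ c) :* con 0ℤ :+ :- (con (+ 2) :* l) :* con 0ℤ
            :+ :- c :* x :+ m :* con 1ℤ
          := x :* (:- m :* w) :+ con 1ℤ :* (a :* b :+ a :* c :+ b :* c) :+ :- (b :+ c) :* a :+ :- (con (+ 2) :* l) :* v
            :+ :- c :* b :+ m :* (x :* w)) refl x (inv x) l v x₁ x₂ x₃ m))))))

      y₃ : l * x₃ + v ≡ - (- s * τx x)
      y₃ = lin 1# v≡0 (lin x₃ l≡s (lin s x₃≡τx (solve 5 (λ l v c s t →
        l :* c :+ v :+ con 1ℤ :* con 0ℤ :+ c :* s :+ s :* t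
        := :- (:- s :* t) :+ con 1ℤ :* v :+ c :* l :+ s :* c) refl l v x₃ s (τx x))))
    Collinear-T (∞₁ _) () _ _
    Collinear-T (∞₂ _) _ () _
    Collinear-T (∞₃ {Q = Q} P≡-Q) P≡T Q≡ x≢0 =
      contradiction (proj₁ (aff-injective (trans (sym Q≡) (trans (trans (sym (neg-involutive Q)) (cong neg (trans (sym P≡-Q) P≡T))) neg-T)))) x≢0

    -- Pick preimages A of T and B of R. The third point C on the line AB is carried by ηʰ to the
    -- third point on the line through T and R, which is -τ R; so -C is a preimage of τ R.
    W-τ : ∀ h {R} → W h T → W h R → W h (τ R)
    W-τ h {R} T∈W@(A , onA , eA) R∈W@(B , onB , eB) = lemma (view (W-On h R∈W)) refl
      where
      lemma : ∀ {R′} → View R′ → R ≡ R′ → W h (τ R)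
      lemma view-∞ refl = T∈W
      lemma view-T refl = subst (W h) (sym (τ-0 refl)) (W-∞ h)
      lemma (view-slope {x} s x≢0 e) refl =
        let (C , onC , col) = third-point onA onB A≢B
        in neg C , neg-On {C} onC ,
           trans (η^-neg h C) (trans (cong neg (Collinear-T {s = s} (η^-Collinear h col) eA eB x≢0)) (trans
             (neg-involutive (τ (η^ h B))) (cong τ eB)))
        where
        A≢B : A ≢ B
        A≢B refl = x≢0 (proj₁ (aff-injective (trans (sym eB) eA)))

    -- The pairs (R, η R) with R in ηʰ E(F) are counted by their second entry Q: over Q = η R₀ lie
    -- R₀ and τ R₀, the latter in ηʰ E(F) by `W-τ`, and nothing else by `η-fibre`.
    size-halves : ∀ h → W h T → size h ≡ + 2 ℤ.* size (suc h)
    size-halves h T∈W = begin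
      ℙ.∑ (λ R → 𝟙 (W? h R))
        ≡⟨ sum-cong ℙ.elements (λ R → sym (ℙ.∑-point (η R) (λ _ → 𝟙 (W? h R)))) ⟩
      ℙ.∑ (λ R → ℙ.∑ (λ Q → 𝟙 (Q ≟ᴾ η R) ℤ.* 𝟙 (W? h R)))
        ≡⟨ sum-swap ℙ.elements ℙ.elements (λ R Q → 𝟙 (Q ≟ᴾ η R) ℤ.* 𝟙 (W? h R)) ⟩
      ℙ.∑ (λ Q → ℙ.∑ (λ R → 𝟙 (Q ≟ᴾ η R) ℤ.* 𝟙 (W? h R)))
        ≡⟨ sum-cong ℙ.elements fibre ⟩
      ℙ.∑ (λ Q → + 2 ℤ.* 𝟙 (W? (suc h) Q))
        ≡⟨ sum-*ˡ ℙ.elements (+ 2) (λ Q → 𝟙 (W? (suc h) Q)) ⟩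
      + 2 ℤ.* size (suc h) ∎
      where
      open ≡-Reasoning

      fibre : ∀ Q → ℙ.∑ (λ R → 𝟙 (Q ≟ᴾ η R) ℤ.* 𝟙 (W? h R)) ≡ + 2 ℤ.* 𝟙 (W? (suc h) Q)
      fibre Q with W? (suc h) Q
      ... | no Q∉W = trans (sum-cong ℙ.elements term) (sum-0 ℙ.elements)
        where
        term : ∀ R → 𝟙 (Q ≟ᴾ η R) ℤ.* 𝟙 (W? h R) ≡ 0ℤ
        term R with Q ≟ᴾ η R | W? h R
        ... | yes refl | yes (A , on , refl) = contradiction (A , on , refl) Q∉W
        ... | yes _ | no _ = refl
        ... | no _ | yes _ = refl
        ... | no _ | no _ = refl
      ... | yes (A , on , refl) = trans (sum-cong ℙ.elements term)
        (trans (sum-+ ℙ.elements (λ R → 𝟙 (R ≟ᴾ R₀)) (λ R → 𝟙 (R ≟ᴾ τ R₀)))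
          (cong₂ ℤ._+_ (ℙ.∑-point-1 R₀) (ℙ.∑-point-1 (τ R₀))))
        where
        R₀ : Point
        R₀ = η^ h A

        R₀∈W : W h R₀
        R₀∈W = A , on , refl

        onR₀ : On R₀
        onR₀ = W-On h R₀∈W

        term : ∀ R → 𝟙 (η R₀ ≟ᴾ η R) ℤ.* 𝟙 (W? h R) ≡ 𝟙 (R ≟ᴾ R₀) ℤ.+ 𝟙 (R ≟ᴾ τ R₀)
        term R with R ≟ᴾ R₀ | R ≟ᴾ τ R₀
        ... | yes refl | yes e = contradiction (sym e) (τ-≢ onR₀)
        ... | yes refl | no _ = cong₂ ℤ._*_ (𝟙-yes refl (η R₀ ≟ᴾ η R₀)) (𝟙-yes R₀∈W (W? h R₀))
        ... | no _ | yes refl = cong₂ ℤ._*_ (𝟙-yes (sym (η-τ onR₀)) (η R₀ ≟ᴾ η (τ R₀)))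
                                           (𝟙-yes (W-τ h T∈W R₀∈W) (W? h (τ R₀)))
        ... | no R≢R₀ | no R≢τR₀ with η R₀ ≟ᴾ η R | W? h R
        ...   | no _ | yes _ = refl
        ...   | no _ | no _ = refl
        ...   | yes _ | no _ = refl
        ...   | yes e | yes R∈W with η-fibre onR₀ (W-On h R∈W) e
        ...     | inj₁ R≡R₀ = contradiction R≡R₀ R≢R₀
        ...     | inj₂ R≡τR₀ = contradiction R≡τR₀ R≢τR₀

    -- Here y = 0. Unless the point is T itself its slope is 0 and η maps it to T, which then lies
    -- even in ηʰ⁺¹ E(F).
    2-torsion⇒W-T : ∀ h {x y} → W h (aff x y) → y ≡ - y → W h T
    2-torsion⇒W-T h {x} {y} Q∈W@(A , onA , e) y≡-y = lemma (view (W-On h Q∈W)) refl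
      where
      y≡0 : y ≡ 0#
      y≡0 = x+x≡0⇒x≡0 2≢0 (trans (cong (_+_ y) y≡-y) (-‿inverseʳ y))

      lemma : ∀ {Q} → View Q → aff x y ≡ Q → W h T
      lemma view-T refl = Q∈W
      lemma (view-slope {x} s x≢0 _) refl with xy≡0⇒x≡0∨y≡0 y≡0
      ... | inj₂ x≡0 = contradiction x≡0 x≢0
      ... | inj₁ refl = W-pred h (A , onA , trans (cong η e) (trans (η-image 0# x≢0 refl) (cong₂ aff
        (solve 1 (λ d → d :* con 0ℤ :* (d :* con 0ℤ) := con 0ℤ) refl d)
        (solve 2 (λ d x → d :* d :* d :* (con 0ℤ :* (con (+ 2) :* x :- con 0ℤ :* con 0ℤ)) := con 0ℤ) refl d x))))

    -- Without T, negation has no fixed point in ηʰ E(F) besides ∞.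
    size-odd : ∀ h → ¬ W h T → ∃ λ M → size h ≡ 1ℤ ℤ.+ + 2 ℤ.* M
    size-odd h T∉W = M , (begin
      ℙ.∑ (λ Q → 𝟙 (W? h Q))
        ≡⟨ sum-cong ℙ.elements term ⟩
      ℙ.∑ (λ Q → 𝟙 (Q ≟ᴾ ∞) ℤ.+ (g Q ℤ.+ g (neg Q)))
        ≡⟨ trans (sum-+ ℙ.elements (λ Q → 𝟙 (Q ≟ᴾ ∞)) (λ Q → g Q ℤ.+ g (neg Q)))
                 (cong₂ ℤ._+_ (ℙ.∑-point-1 ∞) (sum-+ ℙ.elements g (g ∘ neg))) ⟩
      1ℤ ℤ.+ (M ℤ.+ ℙ.∑ (g ∘ neg))
        ≡⟨ cong (λ z → 1ℤ ℤ.+ (M ℤ.+ z)) (ℙ.∑-reindex neg neg neg-involutive neg-involutive g) ⟩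
      1ℤ ℤ.+ (M ℤ.+ M)
        ≡⟨ double M ⟩
      1ℤ ℤ.+ + 2 ℤ.* M ∎)
      where
      open ≡-Reasoning

      double : ∀ M → 1ℤ ℤ.+ (M ℤ.+ M) ≡ 1ℤ ℤ.+ + 2 ℤ.* M
      double = solve-∀

      -- The order of `Fin q` selects one point out of each pair {Q, -Q}, so that M counts half of
      -- the points other than ∞.
      small : Point → ℤ
      small ∞ = 0ℤ
      small (aff x y) = 𝟙 (y Fin.<? - y)

      g : Point → ℤ
      g Q = 𝟙 (W? h Q) ℤ.* small Q

      M : ℤ
      M = ℙ.∑ g

      term : ∀ Q → 𝟙 (W? h Q) ≡ 𝟙 (Q ≟ᴾ ∞) ℤ.+ (g Q ℤ.+ g (neg Q))
      term ∞ rewrite 𝟙-yes (W-∞ h) (W? h ∞) = refl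
      term Q@(aff x y) rewrite 𝟙-cong (λ w → subst (W h) (neg-involutive Q) (W-neg h w)) (W-neg h) (W? h (neg Q)) (W? h Q)
        | -‿involutive y with W? h Q
      ... | no _ = refl
      ... | yes w with Fin.<-cmp y (- y)
      ...   | tri< y<-y _ -y≮y = sym (cong₂ (λ a b → 0ℤ ℤ.+ (1ℤ ℤ.* a ℤ.+ 1ℤ ℤ.* b))
                                    (𝟙-yes y<-y (y Fin.<? - y)) (𝟙-no -y≮y (- y Fin.<? y)))
      ...   | tri≈ _ y≡-y _ = contradiction (2-torsion⇒W-T h w y≡-y) T∉W
      ...   | tri> y≮-y _ -y<y = sym (cong₂ (λ a b → 0ℤ ℤ.+ (1ℤ ℤ.* a ℤ.+ 1ℤ ℤ.* b))
                                    (𝟙-no y≮-y (y Fin.<? - y)) (𝟙-yes -y<y (- y Fin.<? y)))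

    -- Square abscissas and the points annihilated by powers of `η`

    -- Inverting η: (d s)² = r² is solved by s = (1 + i) r. The abscissa of the preimage must be a
    -- root of X² = s² X + m, whose discriminant -4 (r⁴ - m) is the square of 2 i y / r; one root is
    -- i (r² + y / r).
    square⇒W₁ : ∀ {x y r} → On (aff x y) → x ≢ 0# → r * r ≡ x → W 1 (aff x y)
    square⇒W₁ {y = y} {r} on rr≢0 refl = aff v (s * v) , slope-On v² , trans (η-image s v≢0 refl) (cong₂ aff
      (cong₂ _*_ ds≡r ds≡r) Y)
      where
      r≢0 : r ≢ 0#
      r≢0 refl = rr≢0 (zeroˡ 0#)

      e i s v : F
      e = y * inv r
      i = 1# - 2# * d
      s = (2# - 2# * d) * r
      v = i * (r * r + e)

      er≡y : e * r ≡ y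
      er≡y = slope*x r≢0

      e² : e * e ≡ r * r * (r * r) - m
      e² = *-cancelˡ rr≢0 (trans (solve 2 (λ r e → r :* r :* (e :* e) := e :* r :* (e :* r)) refl r e)
        (trans (trans (cong₂ _*_ er≡y er≡y) on) (solve 2 (λ r m →
          r :* r :* (r :* r) :* (r :* r) :- m :* (r :* r) := r :* r :* (r :* r :* (r :* r) :- m)) refl r m)))

      v² : v * v ≡ s * s * v + m
      v² = lin (2# * ((r * r + e) * (r * r + e)) - 2# * (r * r) * v - ι (+ 4) * (r * r) * (r * r + e)) d-eq
        (lin (- 1#) e² (solve 4 (λ d r e m → let
            2: = con (+ 2)
            R = r :* r
            v = (con 1ℤ :- 2: :* d) :* (R :+ e)
            s = (2: :- 2: :* d) :* r
            c = 2: :* ((R :+ e) :* (R :+ e)) :- 2: :* R :* v :- con (+ 4) :* R :* (R :+ e)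
          in v :* v :+ c :* (2: :* d :- con 1ℤ) :+ :- con 1ℤ :* (R :* R :- m)
             := s :* s :* v :+ m :+ c :* (2: :* (d :* d)) :+ :- con 1ℤ :* (e :* e)) refl d r e m))

      v≢0 : v ≢ 0#
      v≢0 v≡0 = m≢0 (lin (v - s * s) v≡0 (lin (- 1#) v² (solve 3 (λ s v m →
        m :+ (v :- s :* s) :* con 0ℤ :+ :- con 1ℤ :* (s :* s :* v :+ m)
        := con 0ℤ :+ (v :- s :* s) :* v :+ :- con 1ℤ :* (v :* v)) refl s v m)))

      ds≡r : d * s ≡ r
      ds≡r = lin (- r) d-eq (solve 2 (λ d r → let 2: = con (+ 2) in
        d :* ((2: :- 2: :* d) :* r) :+ :- r :* (2: :* d :- con 1ℤ) := r :+ :- r :* (2: :* (d :* d))) refl d r)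

      Y : d * d * d * (s * (2# * v - s * s)) ≡ y
      Y = trans (lin (2# * (d * d) * v - (d * s * (d * s) + d * s * r + r * r)) ds≡r
        (lin (r * v - 2# * r * (r * r + e)) d-eq (solve 4 (λ d s r e → let
            2: = con (+ 2)
            v = (con 1ℤ :- 2: :* d) :* (r :* r :+ e)
            c₁ = 2: :* (d :* d) :* v :- (d :* s :* (d :* s) :+ d :* s :* r :+ r :* r)
            c₂ = r :* v :- 2: :* r :* (r :* r :+ e)
          in d :* d :* d :* (s :* (2: :* v :- s :* s)) :+ c₁ :* r :+ c₂ :* (2: :* d :- con 1ℤ)
             := e :* r :+ c₁ :* (d :* s) :+ c₂ :* (2: :* (d :* d))) refl d s r e))) er≡y

    η≡∞⇒ : ∀ {R} → On R → η R ≡ ∞ → R ≡ ∞ ⊎ R ≡ T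
    η≡∞⇒ on e = η-fibre tt on (sym e)

    η≡T⇒ : ∀ {R} → On R → η R ≡ T → ∃ λ x → R ≡ aff x 0# × x * x ≡ m
    η≡T⇒ on e with view on
    ... | view-∞ = contradiction e ∞≢aff
    ... | view-T = contradiction (trans (sym (η-0 refl)) e) ∞≢aff
    ... | view-slope {x} s x≢0 x² = x , cong (aff x) (trans (cong (_* x) s≡0) (zeroˡ x)) ,
      trans x² (trans (cong (λ z → z * z * x + m) s≡0) (solve 2 (λ x m → con 0ℤ :* con 0ℤ :* x :+ m := m) refl x m))
      where
      s≡0 : s ≡ 0#
      s≡0 = *-cancelˡ d≢0 (trans (xx≡0⇒x≡0 (proj₁ (aff-injective (trans (sym (η-image s x≢0 refl)) e)))) (sym (zeroʳ d)))

    even≢odd : ∀ a M → + 2 ℤ.* a ≢ 1ℤ ℤ.+ + 2 ℤ.* M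
    even≢odd a M e = *-small {2} {1} (ℕ.s≤s (ℕ.s≤s ℕ.z≤n)) (a ℤ.- M) (trans (difference a M) (trans (cong (ℤ._- + 2 ℤ.* M) e) (cancel M)))
      where
      difference : ∀ a M → + 2 ℤ.* (a ℤ.- M) ≡ + 2 ℤ.* a ℤ.- + 2 ℤ.* M
      difference = solve-∀
      cancel : ∀ M → 1ℤ ℤ.+ + 2 ℤ.* M ℤ.- + 2 ℤ.* M ≡ 1ℤ
      cancel = solve-∀

    size-even⇒W-T : ∀ h a → size h ≡ + 2 ℤ.* + a → W h T
    size-even⇒W-T h a e with W? h T
    ... | yes T∈W = T∈W
    ... | no T∉W = let (M , odd) = size-odd h T∉W in contradiction (trans (sym e) odd) (even≢odd (+ a) M)

    -- A size 2ᵉ⁺¹ is even, which puts T into the image and allows one more halving; so the chain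
    -- descends without interruption to 1.
    size-power : ∀ n → size 0 ≡ + (2 ℕ.^ n) → ∀ h e → h ℕ.+ e ≡ n → size h ≡ + (2 ℕ.^ e)
    size-power n size₀ zero e refl = size₀
    size-power n size₀ (suc h) e h+e≡n = ℤ.*-cancelˡ-≡ (+ 2) _ _ (begin
      + 2 ℤ.* size (suc h)   ≡⟨ sym (size-halves h (size-even⇒W-T h (2 ℕ.^ e) size-h)) ⟩
      size h                 ≡⟨ size-h ⟩
      + 2 ℤ.* + (2 ℕ.^ e)    ∎)
      where
      open ≡-Reasoning
      size-h : size h ≡ + 2 ℤ.* + (2 ℕ.^ e)
      size-h = trans (size-power n size₀ h (suc e) (trans (ℕ.+-suc h e) h+e≡n)) (ℤ.pos-* 2 (2 ℕ.^ e))

    1≤size : ∀ h → 1ℤ ℤ.≤ size h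
    1≤size h = subst (ℤ._≤ size h) (𝟙-yes (W-∞ h) (W? h ∞))
      (term≤sum {f = λ Q → 𝟙 (W? h Q)} (λ Q → 𝟙-nonneg (W? h Q)) (ℙ.complete ∞))

    size≡1⇒∞ : ∀ h → size h ≡ 1ℤ → ∀ {Q} → W h Q → Q ≡ ∞
    size≡1⇒∞ h size≡1 {Q} Q∈W with Q ≟ᴾ ∞
    ... | yes Q≡∞ = Q≡∞
    ... | no Q≢∞ = contradiction (subst (ℤ._≤ 1ℤ) two≡2 (subst (two ℤ.≤_) size≡1 (sum-mono ℙ.elements term))) λ { (ℤ.+≤+ (ℕ.s≤s ())) }
      where
      two : ℤ
      two = ℙ.∑ (λ R → 𝟙 (R ≟ᴾ ∞) ℤ.+ 𝟙 (R ≟ᴾ Q))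

      two≡2 : two ≡ + 2
      two≡2 = trans (sum-+ ℙ.elements (λ R → 𝟙 (R ≟ᴾ ∞)) (λ R → 𝟙 (R ≟ᴾ Q)))
        (cong₂ ℤ._+_ (ℙ.∑-point-1 ∞) (ℙ.∑-point-1 Q))

      term : ∀ R → 𝟙 (R ≟ᴾ ∞) ℤ.+ 𝟙 (R ≟ᴾ Q) ℤ.≤ 𝟙 (W? h R)
      term R with R ≟ᴾ ∞ | R ≟ᴾ Q
      ... | yes refl | yes refl = contradiction refl Q≢∞
      ... | yes refl | no _ = ℤ.≤-reflexive (sym (𝟙-yes (W-∞ h) (W? h ∞)))
      ... | no _ | yes refl = ℤ.≤-reflexive (sym (𝟙-yes Q∈W (W? h Q)))
      ... | no _ | no _ = 𝟙-nonneg (W? h R)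

    W-T⇒size : ∀ n → (∀ h → h ℕ.< n → W h T) → size 0 ≡ + (2 ℕ.^ n) ℤ.* size n
    W-T⇒size zero T∈W = sym (ℤ.*-identityˡ (size 0))
    W-T⇒size (suc n) T∈W = begin
      size 0                                      ≡⟨ W-T⇒size n (λ h h<n → T∈W h (ℕ.m<n⇒m<1+n h<n)) ⟩
      + (2 ℕ.^ n) ℤ.* size n                      ≡⟨ cong (+ (2 ℕ.^ n) ℤ.*_) (size-halves n (T∈W n ℕ.≤-refl)) ⟩
      + (2 ℕ.^ n) ℤ.* (+ 2 ℤ.* size (suc n))      ≡⟨ assoc (+ (2 ℕ.^ n)) (+ 2) (size (suc n)) ⟩
      + 2 ℤ.* + (2 ℕ.^ n) ℤ.* size (suc n)        ≡⟨ cong (ℤ._* size (suc n)) (sym (ℤ.pos-* 2 (2 ℕ.^ n))) ⟩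
      + (2 ℕ.^ suc n) ℤ.* size (suc n)            ∎
      where
      open ≡-Reasoning
      assoc : ∀ a b c → a ℤ.* (b ℤ.* c) ≡ b ℤ.* a ℤ.* c
      assoc = solve-∀

    W-antitone : ∀ {h n Q} → h ℕ.≤ n → W n Q → W h Q
    W-antitone {n = zero} ℕ.z≤n w = w
    W-antitone {h} {suc n} h≤1+n w with ℕ.m≤n⇒m<n∨m≡n h≤1+n
    ... | inj₁ (ℕ.s≤s h≤n) = W-antitone h≤n (W-pred n w)
    ... | inj₂ refl = w

    -- Each h ≤ n with T ∈ ηʰ E(F) contributes a factor 2 to the number of points.
    size-bound : ∀ n → W n T → + (2 ℕ.^ suc n) ℤ.≤ size 0
    size-bound n T∈W = subst₂ ℤ._≤_ (ℤ.*-identityʳ _)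
      (sym (W-T⇒size (suc n) (λ { h (ℕ.s≤s h≤n) → W-antitone h≤n T∈W })))
      (ℤ.*-monoˡ-≤-nonNeg (+ (2 ℕ.^ suc n)) (1≤size (suc n)))

    module _ {μ : F} (μμ≡m : μ * μ ≡ m) where

      μ≢0 : μ ≢ 0#
      μ≢0 μ≡0 = m≢0 (trans (sym μμ≡m) (trans (cong (_* μ) μ≡0) (zeroˡ μ)))

      On-μ : On (aff μ 0#)
      On-μ = lin (- μ) μμ≡m (solve 2 (λ μ m → con 0ℤ :* con 0ℤ :+ :- μ :* m := μ :* μ :* μ :- m :* μ :+ :- μ :* (μ :* μ)) refl μ m)

      η-μ : η (aff μ 0#) ≡ T
      η-μ = trans (η-image 0# μ≢0 (zeroˡ μ)) (cong₂ aff
        (solve 1 (λ d → d :* con 0ℤ :* (d :* con 0ℤ) := con 0ℤ) refl d)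
        (solve 2 (λ d x → d :* d :* d :* (con 0ℤ :* (con (+ 2) :* x :- con 0ℤ :* con 0ℤ)) := con 0ℤ) refl d μ))

      W₁-T : W 1 T
      W₁-T = aff μ 0# , On-μ , η-μ

      W₂-T : Square μ → W 2 T
      W₂-T (r , rr≡μ) with (B , onB , ηB) ← square⇒W₁ On-μ μ≢0 rr≡μ = B , onB , trans (cong η ηB) η-μ

      -- T = η (μ, 0), and (μ, 0) is itself an image when μ is a square. So T lies in η² E(F), and
      -- the size halves at h = 0, 1 and 2.
      size₀≡8 : Square μ → size 0 ≡ + 8 ℤ.* size 3
      size₀≡8 sq = W-T⇒size 3 λ { h (ℕ.s≤s h≤2) → W-antitone h≤2 (W₂-T sq) }

    module _ (nonsquare-* : ∀ {x y} → ¬ Square x → ¬ Square y → Square (x * y)) (T∈W₁ : W 1 T) where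

      ∉W₁⇒nonsquare : ∀ {x y} → On (aff x y) → ¬ W 1 (aff x y) → x ≢ 0# × ¬ Square x
      ∉W₁⇒nonsquare {x} {y} on P∉W =
        (λ { refl → P∉W (subst (W 1 ∘ aff 0#) (sym (On-y≡0 on refl)) T∈W₁) }) ,
        (λ (r , rr≡x) → P∉W (square⇒W₁ on (λ { refl → P∉W (subst (W 1 ∘ aff 0#) (sym (On-y≡0 on refl)) T∈W₁) }) rr≡x))

      -- x₁ x₂ x₃ is the square of the intercept, so x mod squares is multiplicative.
      third-∈W₁ : ∀ {P Q R} → Collinear P Q R → On P → On Q → On R → ¬ W 1 P → ¬ W 1 Q → W 1 R
      third-∈W₁ (∞₁ _) _ _ _ P∉W _ = contradiction (W-∞ 1) P∉W
      third-∈W₁ (∞₂ _) _ _ _ _ Q∉W = contradiction (W-∞ 1) Q∉W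
      third-∈W₁ (∞₃ _) _ _ _ _ _ = W-∞ 1
      third-∈W₁ (line {x₁} {x₂} {x₃} l v sec) on₁ on₂ on₃ P∉W Q∉W with x₃ ≟ 0#
      ... | yes refl = subst (W 1 ∘ aff 0#) (sym (On-y≡0 on₃ refl)) T∈W₁
      ... | no x₃≢0 =
        let (x₁≢0 , x₁-nonsquare) = ∉W₁⇒nonsquare on₁ P∉W
            (x₂≢0 , x₂-nonsquare) = ∉W₁⇒nonsquare on₂ Q∉W
            (r , rr≡x₁x₂) = nonsquare-* x₁-nonsquare x₂-nonsquare
            r≢0 : r ≢ 0#
            r≢0 r≡0 = *-nonzero x₁≢0 x₂≢0 (trans (sym rr≡x₁x₂) (trans (cong (_* r) r≡0) (zeroˡ r)))
        in square⇒W₁ {r = v * inv r} on₃ x₃≢0 (*-cancelˡ r≢0 (*-cancelˡ r≢0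
             (lin (v * v * (r * inv r + 1#)) (*-inv r r≢0) (lin (- x₃) rr≡x₁x₂ (lin (- 1#) (Secant.e₃ sec)
               (solve 6 (λ r w v a b c →
                 r :* (r :* (v :* w :* (v :* w))) :+ v :* v :* (r :* w :+ con 1ℤ) :* con 1ℤ
                   :+ :- c :* (a :* b) :+ :- con 1ℤ :* (v :* v)
                 := r :* (r :* c) :+ v :* v :* (r :* w :+ con 1ℤ) :* (r :* w)
                   :+ :- c :* (r :* r) :+ :- con 1ℤ :* (a :* b :* c)) refl r (inv r) v x₁ x₂ x₃))))))

      -- Some A has ηⁿ A = T, and A lies outside η E(F), whose points are killed by ηⁿ. If ηⁿ P were
      -- ∞, the third point R on the line AP would lie in η E(F) and be killed as well; but ηⁿ R is
      -- collinear with T and ∞, hence equals T.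
      level : ∀ n → size 0 ≡ + (2 ℕ.^ suc n) → ∀ {P} → On P → ¬ W 1 P → η^ n P ≡ T
      level n size₀ {P} onP P∉W = cases (η≡∞⇒ (η^-On n onP) (killed onP))
        where
        killed : ∀ {Q} → On Q → η^ (suc n) Q ≡ ∞
        killed {Q} onQ = size≡1⇒∞ (suc n) (size-power (suc n) size₀ (suc n) 0 (ℕ.+-identityʳ (suc n))) (Q , onQ , refl)

        T∈Wₙ : W n T
        T∈Wₙ = size-even⇒W-T n 1 (size-power (suc n) size₀ n 1 (ℕ.+-comm n 1))

        W₁-killed : ∀ {Q} → W 1 Q → η^ n Q ≡ ∞
        W₁-killed (B , onB , refl) = trans (sym (η^-suc n B)) (killed onB)

        cases : η^ n P ≡ ∞ ⊎ η^ n P ≡ T → η^ n P ≡ T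
        cases (inj₂ e) = e
        cases (inj₁ η^nP≡∞) =
          let (A , onA , η^nA≡T) = T∈Wₙ
              A∉W : ¬ W 1 A
              A∉W A∈W = ∞≢aff (trans (sym (W₁-killed A∈W)) η^nA≡T)
              A≢P : A ≢ P
              A≢P A≡P = ∞≢aff (trans (sym η^nP≡∞) (trans (cong (η^ n) (sym A≡P)) η^nA≡T))
              (R , onR , col) = third-point onA onP A≢P
          in contradiction (trans (sym (W₁-killed (third-∈W₁ col onA onP onR A∉W P∉W)))
                                  (Collinear-T∞ (η^-Collinear n col) η^nA≡T η^nP≡∞)) ∞≢aff

      -- One application before T the slope is 0, which leaves a point (x, 0) with x² = m. For n = 2
      -- k - 1 the required size is 2²ᵏ⁺¹.
      level-pred : ∀ n → size 0 ≡ + (2 ℕ.^ suc (suc n)) → ∀ {P} → On P → ¬ W 1 P → ∃ λ x → η^ n P ≡ aff x 0# × x * x ≡ m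
      level-pred n size₀ onP P∉W = η≡T⇒ (η^-On n onP) (level (suc n) size₀ onP P∉W)

    -- The abscissa of an image is (d s)², so a point with nonsquare x lies outside η E(F).
    W₁⇒square : ∀ {x y} → W 1 (aff x y) → Square x
    W₁⇒square {x} (B , onB , e) with view onB
    ... | view-∞ = contradiction e ∞≢aff
    ... | view-T = contradiction (trans (sym (η-0 refl)) e) ∞≢aff
    ... | view-slope s b≢0 _ = d * s , proj₁ (aff-injective (trans (sym (η-image s b≢0 refl)) e))

-- The quadratic character and Jacobsthal sums

module _ {q : ℕ} (K : FieldOn q) where

  open FieldProperties K

  module Character (2≢0 : ι (+ 2) ≢ 0#) (i : F) (ii≡-1 : i * i ≡ - 1#) (1<q : 1 ℕ.< q) where

    open Finite (Fin-finite q) using (elements; any?; ∑; ∑-point; ∑-point-1; ∑-reindex; complete)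

    Square? : ∀ x → Dec (Square x)
    Square? x = any? (λ r → r * r ≟ x)

    -- The character is found by searching for a root and then sealed: afterwards only the three
    -- evaluations in this block are visible, packaged as `χ-View`.
    opaque
      χ : F → ℤ
      χ x with x ≟ 0# | Square? x
      ... | yes _ | _ = 0ℤ
      ... | no _ | yes _ = 1ℤ
      ... | no _ | no _ = -1ℤ

      χ-0 : χ 0# ≡ 0ℤ
      χ-0 with 0# ≟ 0#
      ... | yes _ = refl
      ... | no 0≢0 = contradiction refl 0≢0

      χ-square : ∀ {r} → r ≢ 0# → χ (r * r) ≡ 1ℤ
      χ-square {r} r≢0 with r * r ≟ 0# | Square? (r * r)
      ... | yes rr≡0 | _ = contradiction (xx≡0⇒x≡0 rr≡0) r≢0
      ... | no _ | yes _ = refl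
      ... | no _ | no ¬sq = contradiction (r , refl) ¬sq

      χ-nonsquare : ∀ {x} → ¬ Square x → χ x ≡ -1ℤ
      χ-nonsquare {x} ¬sq with x ≟ 0# | Square? x
      ... | yes refl | _ = contradiction (0# , zeroˡ 0#) ¬sq
      ... | no _ | yes sq = contradiction sq ¬sq
      ... | no _ | no _ = refl

    data χ-View (x : F) : Set where
      zero      : x ≡ 0# → χ x ≡ 0ℤ → χ-View x
      square    : ∀ r → r ≢ 0# → r * r ≡ x → χ x ≡ 1ℤ → χ-View x
      nonsquare : x ≢ 0# → ¬ Square x → χ x ≡ -1ℤ → χ-View x

    χ-view : ∀ x → χ-View x
    χ-view x = view (x ≟ 0#) (Square? x)
      where
      view : Dec (x ≡ 0#) → Dec (Square x) → χ-View x
      view (yes refl) _ = zero refl χ-0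
      view (no x≢0) (yes (r , refl)) = square r r≢0 refl (χ-square r≢0)
        where
        r≢0 : r ≢ 0#
        r≢0 refl = x≢0 (zeroˡ 0#)
      view (no x≢0) (no ¬sq) = nonsquare x≢0 ¬sq (χ-nonsquare ¬sq)

    χ≡1⇒Square : ∀ {x} → χ x ≡ 1ℤ → Square x
    χ≡1⇒Square {x} χx≡1 with χ-view x
    ... | zero _ χx≡0 = contradiction (trans (sym χx≡0) χx≡1) λ ()
    ... | square r _ rr≡x _ = r , rr≡x
    ... | nonsquare _ _ χx≡-1 = contradiction (trans (sym χx≡-1) χx≡1) λ ()

    χ≤1 : ∀ x → χ x ℤ.≤ 1ℤ
    χ≤1 x with χ-view x
    ... | zero _ χx≡0 = subst (ℤ._≤ 1ℤ) (sym χx≡0) (ℤ.+≤+ ℕ.z≤n)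
    ... | square _ _ _ χx≡1 = ℤ.≤-reflexive χx≡1
    ... | nonsquare _ _ χx≡-1 = subst (ℤ._≤ 1ℤ) (sym χx≡-1) ℤ.-≤+

    ∑-one : ∑ (λ _ → 1ℤ) ≡ + q
    ∑-one = trans (sum-1 elements) (cong +_ (length-tabulate id))

    x≢-x : ∀ {x} → x ≢ 0# → x ≢ - x
    x≢-x {x} x≢0 x≡-x = x≢0 (x+x≡0⇒x≡0 2≢0 (trans (cong (_+_ x) x≡-x) (-‿inverseʳ x)))

    𝟙-sqrt : ∀ {r} → r ≢ 0# → ∀ y → 𝟙 (y * y ≟ r * r) ≡ 𝟙 (y ≟ r) ℤ.+ 𝟙 (y ≟ - r)
    𝟙-sqrt {r} r≢0 y with y * y ≟ r * r | y ≟ r | y ≟ - r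
    ... | _ | yes refl | yes r≡-r = contradiction r≡-r (x≢-x r≢0)
    ... | yes _ | yes _ | no _ = refl
    ... | yes _ | no _ | yes _ = refl
    ... | no e | yes refl | no _ = contradiction refl e
    ... | no e | no _ | yes refl = contradiction (solve 1 (λ r → :- r :* :- r := r :* r) refl r) e
    ... | no _ | no _ | no _ = refl
    ... | yes e | no y≢r | no y≢-r with xx≡yy⇒x≡±y e
    ...   | inj₁ y≡r = contradiction y≡r y≢r
    ...   | inj₂ y≡-r = contradiction y≡-r y≢-r

    root-count : ∀ a → ∑ (λ y → 𝟙 (y * y ≟ a)) ≡ 1ℤ ℤ.+ χ a
    root-count a with χ-view a
    ... | zero refl χ≡0 = trans (sum-cong elements (λ y → 𝟙-cong xx≡0⇒x≡0 (λ { refl → zeroˡ 0# }) (y * y ≟ 0#) (y ≟ 0#)))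
      (trans (∑-point-1 0#) (cong (ℤ._+_ 1ℤ) (sym χ≡0)))
    ... | square r r≢0 refl χ≡1 = trans (sum-cong elements (𝟙-sqrt r≢0))
      (trans (sum-+ elements (λ y → 𝟙 (y ≟ r)) (λ y → 𝟙 (y ≟ - r)))
        (trans (cong₂ ℤ._+_ (∑-point-1 r) (∑-point-1 (- r))) (cong (ℤ._+_ 1ℤ) (sym χ≡1))))
    ... | nonsquare _ ¬sq χ≡-1 = trans (sum-cong elements (λ y → 𝟙-no (λ yy≡a → ¬sq (y , yy≡a)) (y * y ≟ a)))
      (trans (sum-0 elements) (cong (ℤ._+_ 1ℤ) (sym χ≡-1)))

    -- The pairs (a, y) with y² = a are counted twice: over each a there are 1 + χ a of them, over
    -- each y exactly one.
    ∑χ≡0 : ∑ χ ≡ 0ℤ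
    ∑χ≡0 = GroupProperties.∙-cancelˡ (AbelianGroup.group ℤ.+-0-abelianGroup) (+ q) _ _ (begin
      + q ℤ.+ ∑ χ                                ≡⟨ cong (ℤ._+ ∑ χ) (sym ∑-one) ⟩
      ∑ (λ _ → 1ℤ) ℤ.+ ∑ χ                       ≡⟨ sym (sum-+ elements (λ _ → 1ℤ) χ) ⟩
      ∑ (λ a → 1ℤ ℤ.+ χ a)                       ≡⟨ sum-cong elements (λ a → sym (root-count a)) ⟩
      ∑ (λ a → ∑ (λ y → 𝟙 (y * y ≟ a)))          ≡⟨ sum-swap elements elements (λ a y → 𝟙 (y * y ≟ a)) ⟩
      ∑ (λ y → ∑ (λ a → 𝟙 (y * y ≟ a)))          ≡⟨ sum-cong elements (λ y → trans (sum-cong elements (λ a →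
                                                      𝟙-cong sym sym (y * y ≟ a) (a ≟ y * y))) (∑-point-1 (y * y))) ⟩
      ∑ (λ _ → 1ℤ)                               ≡⟨ trans ∑-one (sym (ℤ.+-identityʳ (+ q))) ⟩
      + q ℤ.+ 0ℤ                                 ∎)
      where open ≡-Reasoning

    inv*x : ∀ {x} y → x ≢ 0# → inv x * (x * y) ≡ y
    inv*x {x} y x≢0 = lin y (*-inv x x≢0) (solve 3 (λ x y w → w :* (x :* y) :+ y :* con 1ℤ := y :+ y :* (x :* w)) refl x y (inv x))

    x*inv : ∀ {x} y → x ≢ 0# → x * (inv x * y) ≡ y
    x*inv {x} y x≢0 = trans (solve 3 (λ x y w → x :* (w :* y) := w :* (x :* y)) refl x y (inv x)) (inv*x y x≢0)

    ∑-scale : ∀ {c} → c ≢ 0# → ∀ h → ∑ (λ x → h (c * x)) ≡ ∑ h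
    ∑-scale {c} c≢0 h = ∑-reindex (c *_) (inv c *_) (λ x → x*inv x c≢0) (λ x → inv*x x c≢0) h

    χ-square-* : ∀ {r} x → r ≢ 0# → χ (r * r * x) ≡ χ x
    χ-square-* {r} x r≢0 with χ-view x
    ... | zero refl χ≡0 = trans (cong χ (zeroʳ (r * r))) (trans χ-0 (sym χ≡0))
    ... | square s s≢0 refl χ≡1 =
      trans (cong χ (solve 2 (λ r s → r :* r :* (s :* s) := r :* s :* (r :* s)) refl r s))
            (trans (χ-square (*-nonzero r≢0 s≢0)) (sym χ≡1))
    ... | nonsquare x≢0 ¬sq χ≡-1 = trans (χ-nonsquare (λ (t , tt≡) → ¬sq (inv r * t ,
      *-cancelˡ r≢0 (*-cancelˡ r≢0 (trans
        (solve 3 (λ r w t → r :* (r :* (w :* t :* (w :* t))) := r :* (w :* t) :* (r :* (w :* t))) refl r (inv r) t)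
        (trans (cong₂ _*_ (x*inv t r≢0) (x*inv t r≢0)) (trans tt≡ (*-assoc r r x))))))) ) (sym χ≡-1)

    -- The terms of ∑ (χ a + χ (g a)) = 0 are ≤ 0, hence all 0.
    χ-nonsquare-* : ∀ {g} → ¬ Square g → ∀ a → χ (g * a) ≡ ℤ.- χ a
    χ-nonsquare-* {g} g-nonsquare a = ℤ.i-j≡0⇒i≡j _ _ (trans (cong (ℤ._+_ (χ (g * a))) (ℤ.neg-involutive (χ a)))
      (trans (ℤ.+-comm (χ (g * a)) (χ a)) (ℤ.neg-injective (ℤ.≤-antisym (subst (f a ℤ.≤_) ∑f≡0 (term≤sum f-nonneg (complete a))) (f-nonneg a)))))
      where
      g≢0 : g ≢ 0#
      g≢0 refl = g-nonsquare (0# , zeroˡ 0#)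

      f : F → ℤ
      f a = ℤ.- (χ a ℤ.+ χ (g * a))

      ∑f≡0 : ∑ f ≡ 0ℤ
      ∑f≡0 = begin
        ∑ f                                            ≡⟨ sum-cong elements (λ a → sym (ℤ.-1*i≡-i _)) ⟩
        ∑ (λ a → -1ℤ ℤ.* (χ a ℤ.+ χ (g * a)))          ≡⟨ sum-*ˡ elements -1ℤ _ ⟩
        -1ℤ ℤ.* ∑ (λ a → χ a ℤ.+ χ (g * a))            ≡⟨ cong (ℤ._*_ -1ℤ) (sum-+ elements χ (λ a → χ (g * a))) ⟩
        -1ℤ ℤ.* (∑ χ ℤ.+ ∑ (λ a → χ (g * a)))          ≡⟨ cong (ℤ._*_ -1ℤ) (cong₂ ℤ._+_ ∑χ≡0 (trans (∑-scale g≢0 χ) ∑χ≡0)) ⟩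
        0ℤ                                             ∎
        where open ≡-Reasoning

      f-nonneg : ∀ a → 0ℤ ℤ.≤ f a
      f-nonneg a with χ-view a
      ... | zero refl χ≡0 rewrite χ≡0 | zeroʳ g | χ-0 = ℤ.≤-refl
      ... | square r r≢0 refl χ≡1 rewrite χ≡1 | *-comm g (r * r) | χ-square-* g r≢0 | χ-nonsquare g-nonsquare = ℤ.≤-refl
      ... | nonsquare _ _ χ≡-1 rewrite χ≡-1 = ℤ.neg-mono-≤ (ℤ.+-monoʳ-≤ -1ℤ (χ≤1 (g * a)))

    χ-* : ∀ x y → χ (x * y) ≡ χ x ℤ.* χ y
    χ-* x y with χ-view x
    ... | zero refl χ≡0 = trans (trans (cong χ (zeroˡ y)) χ-0) (sym (cong (ℤ._* χ y) χ≡0))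
    ... | square r r≢0 refl χ≡1 = trans (χ-square-* y r≢0) (trans (sym (ℤ.*-identityˡ (χ y))) (cong (ℤ._* χ y) (sym χ≡1)))
    ... | nonsquare _ ¬sq χ≡-1 = trans (χ-nonsquare-* ¬sq y) (trans (sym (ℤ.-1*i≡-i (χ y))) (cong (ℤ._* χ y) (sym χ≡-1)))

    nonsquare-* : ∀ {x y} → ¬ Square x → ¬ Square y → Square (x * y)
    nonsquare-* {x} {y} ¬x ¬y = χ≡1⇒Square (trans (χ-* x y) (cong₂ ℤ._*_ (χ-nonsquare ¬x) (χ-nonsquare ¬y)))

    χχ : ∀ x → χ x ℤ.* χ x ≡ 1ℤ ℤ.- 𝟙 (x ≟ 0#)
    χχ x with χ-view x | x ≟ 0#
    ... | zero _ χ≡0 | yes _ rewrite χ≡0 = refl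
    ... | zero x≡0 _ | no x≢0 = contradiction x≡0 x≢0
    ... | square r r≢0 rr≡x _ | yes x≡0 = contradiction (xx≡0⇒x≡0 (trans rr≡x x≡0)) r≢0
    ... | square _ _ _ χ≡1 | no _ rewrite χ≡1 = refl
    ... | nonsquare x≢0 _ _ | yes x≡0 = contradiction x≡0 x≢0
    ... | nonsquare _ _ χ≡-1 | no _ rewrite χ≡-1 = refl

    χ-neg : ∀ x → χ (- x) ≡ χ x
    χ-neg x = trans (cong χ (lin (- x) ii≡-1 (solve 2 (λ i x →
      :- x :+ :- x :* :- con 1ℤ := i :* i :* x :+ :- x :* (i :* i)) refl i x))) (χ-square-* x i≢0)
      where
      i≢0 : i ≢ 0#
      i≢0 refl = neg-nonzero 1≢0 (trans (sym ii≡-1) (zeroˡ 0#))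

    inv-involutive : ∀ x → inv (inv x) ≡ x
    inv-involutive x with x ≟ 0#
    ... | yes refl = trans (cong inv inv-0) inv-0
    ... | no x≢0 = *-cancelˡ (inv-nonzero x≢0) (trans (*-inv (inv x) (inv-nonzero x≢0))
      (trans (sym (*-inv x x≢0)) (*-comm x (inv x))))

    -- Character sums of quadratics and Jacobsthal's identity

    ∑-1-𝟙 : ∀ a → ∑ (λ n → 1ℤ ℤ.- 𝟙 (n ≟ a)) ≡ + q ℤ.- 1ℤ
    ∑-1-𝟙 a = begin
      ∑ (λ n → 1ℤ ℤ.- 𝟙 (n ≟ a))
        ≡⟨ sum-+ elements (λ _ → 1ℤ) (λ n → ℤ.- 𝟙 (n ≟ a)) ⟩
      ∑ (λ _ → 1ℤ) ℤ.+ ∑ (λ n → ℤ.- 𝟙 (n ≟ a))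
        ≡⟨ cong₂ ℤ._+_ ∑-one (trans (sum-cong elements (λ n → sym (ℤ.-1*i≡-i _)))
             (trans (sum-*ˡ elements -1ℤ (λ n → 𝟙 (n ≟ a))) (cong (ℤ._*_ -1ℤ) (∑-point-1 a)))) ⟩
      + q ℤ.- 1ℤ ∎
      where open ≡-Reasoning

    -- For a ≠ b, shifting n by a gives n (n + e) = n² (1 + e/n) with e = a - b, and reindexing by n
    -- ↦ 1/n, scaling and shifting reduces the sum to that of χ. At n = 0 the convention inv 0 = 0
    -- yields χ 1 = 1 in place of 0, whence the -1.
    ∑-χ-quadratic : ∀ a b → ∑ (λ n → χ ((n - a) * (n - b))) ≡ + q ℤ.* 𝟙 (a ≟ b) ℤ.- 1ℤ
    ∑-χ-quadratic a b with a ≟ b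
    ... | yes refl = trans (sum-cong elements (λ n → trans (χ-* (n - a) (n - a)) (trans (χχ (n - a))
        (cong (λ z → 1ℤ ℤ.- z) (𝟙-cong x-y≡0⇒x≡y (λ { refl → -‿inverseʳ a }) (n - a ≟ 0#) (n ≟ a))))))
      (trans (∑-1-𝟙 a) (cong (ℤ._- 1ℤ) (sym (ℤ.*-identityʳ (+ q)))))
    ... | no a≢b = begin
      ∑ (λ n → χ ((n - a) * (n - b)))
        ≡⟨ sym (∑-reindex (_+ a) (_- a) (λ x → solve 2 (λ x a → x :- a :+ a := x) refl x a)
                  (λ x → solve 2 (λ x a → x :+ a :- a := x) refl x a) (λ n → χ ((n - a) * (n - b)))) ⟩
      ∑ (λ n → χ ((n + a - a) * (n + a - b)))
        ≡⟨ sum-cong elements term ⟩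
      ∑ (λ n → χ (1# + e * inv n) ℤ.+ -1ℤ ℤ.* 𝟙 (n ≟ 0#))
        ≡⟨ sum-+ elements (λ n → χ (1# + e * inv n)) (λ n → -1ℤ ℤ.* 𝟙 (n ≟ 0#)) ⟩
      ∑ (λ n → χ (1# + e * inv n)) ℤ.+ ∑ (λ n → -1ℤ ℤ.* 𝟙 (n ≟ 0#))
        ≡⟨ cong₂ ℤ._+_ reindexed (trans (sum-*ˡ elements -1ℤ (λ n → 𝟙 (n ≟ 0#))) (cong (ℤ._*_ -1ℤ) (∑-point-1 0#))) ⟩
      0ℤ ℤ.- 1ℤ
        ≡⟨ cong (ℤ._- 1ℤ) (sym (ℤ.*-zeroʳ (+ q))) ⟩
      + q ℤ.* 0ℤ ℤ.- 1ℤ ∎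
      where
      open ≡-Reasoning

      e : F
      e = a - b

      reindexed : ∑ (λ n → χ (1# + e * inv n)) ≡ 0ℤ
      reindexed = begin
        ∑ (λ n → χ (1# + e * inv n)) ≡⟨ ∑-reindex inv inv inv-involutive inv-involutive (λ n → χ (1# + e * n)) ⟩
        ∑ (λ n → χ (1# + e * n))     ≡⟨ ∑-scale (a≢b ∘ x-y≡0⇒x≡y) (λ n → χ (1# + n)) ⟩
        ∑ (λ n → χ (1# + n))         ≡⟨ ∑-reindex (_+_ 1#) (_- 1#)
                                          (λ x → solve 1 (λ x → con 1ℤ :+ (x :- con 1ℤ) := x) refl x)
                                          (λ x → solve 1 (λ x → con 1ℤ :+ x :- con 1ℤ := x) refl x) χ ⟩
        ∑ χ                          ≡⟨ ∑χ≡0 ⟩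
        0ℤ ∎

      term : ∀ n → χ ((n + a - a) * (n + a - b)) ≡ χ (1# + e * inv n) ℤ.+ -1ℤ ℤ.* 𝟙 (n ≟ 0#)
      term n with n ≟ 0#
      ... | yes refl = begin
        χ ((0# + a - a) * (0# + a - b))   ≡⟨ cong χ (solve 2 (λ a b → (con 0ℤ :+ a :- a) :* (con 0ℤ :+ a :- b) := con 0ℤ) refl a b) ⟩
        χ 0#                              ≡⟨ χ-0 ⟩
        1ℤ ℤ.+ -1ℤ                        ≡⟨ cong (ℤ._+ -1ℤ) (sym (trans (cong χ one) (χ-square 1≢0))) ⟩
        χ (1# + e * inv 0#) ℤ.+ -1ℤ       ∎
        where
        one : 1# + e * inv 0# ≡ 1# * 1#
        one = trans (cong (λ z → 1# + e * z) inv-0) (solve 1 (λ e → con 1ℤ :+ e :* con 0ℤ := con 1ℤ :* con 1ℤ) refl e)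
      ... | no n≢0 = begin
        χ ((n + a - a) * (n + a - b))     ≡⟨ cong χ (lin (- (e * n)) (*-inv n n≢0) (solve 4 (λ n a b w → let c = :- ((a :- b) :* n) in
          (n :+ a :- a) :* (n :+ a :- b) :+ c :* con 1ℤ := n :* n :* (con 1ℤ :+ (a :- b) :* w) :+ c :* (n :* w)) refl n a b (inv n))) ⟩
        χ (n * n * (1# + e * inv n))      ≡⟨ χ-square-* _ n≢0 ⟩
        χ (1# + e * inv n)                ≡⟨ sym (ℤ.+-identityʳ _) ⟩
        χ (1# + e * inv n) ℤ.+ 0ℤ         ∎

    -- q + 1 + S n is the number of points of y² = x³ − n x.
    S : F → ℤ
    S n = ∑ (λ x → χ (x * x * x - n * x))

    sum-product : ∀ f g → ∑ f ℤ.* ∑ g ≡ ∑ (λ x → ∑ (λ u → f x ℤ.* g u))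
    sum-product f g = sym (begin
      ∑ (λ x → ∑ (λ u → f x ℤ.* g u))   ≡⟨ sum-cong elements (λ x → trans (sum-*ˡ elements (f x) g) (ℤ.*-comm (f x) (∑ g))) ⟩
      ∑ (λ x → ∑ g ℤ.* f x)             ≡⟨ sum-*ˡ elements (∑ g) f ⟩
      ∑ g ℤ.* ∑ f                       ≡⟨ ℤ.*-comm (∑ g) (∑ f) ⟩
      ∑ f ℤ.* ∑ g ∎)
      where open ≡-Reasoning

    -- The terms at u = x and u = -x count alike, because -1 is a square.
    ∑χχ𝟙 : ∀ x → ∑ (λ u → χ x ℤ.* χ u ℤ.* 𝟙 (x * x ≟ u * u)) ≡ + 2 ℤ.* (1ℤ ℤ.- 𝟙 (x ≟ 0#))
    ∑χχ𝟙 x with x ≟ 0#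
    ... | yes refl = trans (sum-cong elements (λ u → cong (λ z → z ℤ.* χ u ℤ.* 𝟙 (0# * 0# ≟ u * u)) χ-0)) (sum-0 elements)
    ... | no x≢0 = trans (sum-cong elements term)
        (trans (sum-+ elements (λ u → 𝟙 (u ≟ x)) (λ u → 𝟙 (u ≟ - x))) (cong₂ ℤ._+_ (∑-point-1 x) (∑-point-1 (- x))))
      where
      χxχx : χ x ℤ.* χ x ≡ 1ℤ
      χxχx = trans (sym (χ-* x x)) (χ-square x≢0)

      term : ∀ u → χ x ℤ.* χ u ℤ.* 𝟙 (x * x ≟ u * u) ≡ 𝟙 (u ≟ x) ℤ.+ 𝟙 (u ≟ - x)
      term u = trans (cong (ℤ._*_ (χ x ℤ.* χ u)) (𝟙-cong sym sym (x * x ≟ u * u) (u * u ≟ x * x)))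
        (trans (cong (ℤ._*_ (χ x ℤ.* χ u)) (𝟙-sqrt x≢0 u)) (cases (u ≟ x) (u ≟ - x)))
        where
        cases : (a : Dec (u ≡ x)) (b : Dec (u ≡ - x)) → χ x ℤ.* χ u ℤ.* (𝟙 a ℤ.+ 𝟙 b) ≡ 𝟙 a ℤ.+ 𝟙 b
        cases (yes refl) b rewrite χxχx = ℤ.*-identityˡ _
        cases (no _) (yes refl) rewrite χ-neg x | χxχx = refl
        cases (no _) (no _) = ℤ.*-zeroʳ (χ x ℤ.* χ u)

    -- Squaring turns S n into a double sum over x and u, and (x³ - n x)(u³ - n u) = x u (n - x²)(n
    -- - u²). Summed over n first, this is quadratic, and the factor q survives only where x² = u².
    jacobsthal-sum : ∑ (λ n → S n ℤ.* S n) ≡ + q ℤ.* (+ 2 ℤ.* (+ q ℤ.- 1ℤ))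
    jacobsthal-sum = begin
      ∑ (λ n → S n ℤ.* S n)
        ≡⟨ sum-cong elements (λ n → trans (sum-product (c n) (c n))
             (sum-cong elements (λ x → sum-cong elements (λ u → c-* x u n)))) ⟩
      ∑ (λ n → ∑ (λ x → ∑ (λ u → t x u n)))
        ≡⟨ sum-swap elements elements (λ n x → ∑ (λ u → t x u n)) ⟩
      ∑ (λ x → ∑ (λ n → ∑ (λ u → t x u n)))
        ≡⟨ sum-cong elements (λ x → sum-swap elements elements (λ n u → t x u n)) ⟩
      ∑ (λ x → ∑ (λ u → ∑ (λ n → t x u n)))
        ≡⟨ sum-cong elements (λ x → sum-cong elements (λ u → trans
             (sum-*ˡ elements (χ x ℤ.* χ u) (λ n → χ ((n - x * x) * (n - u * u))))
             (trans (cong (ℤ._*_ (χ x ℤ.* χ u)) (∑-χ-quadratic (x * x) (u * u))) (expand (χ x) (χ u) (+ q) (𝟙 (x * x ≟ u * u)))))) ⟩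
      ∑ (λ x → ∑ (λ u → + q ℤ.* A x u ℤ.+ -1ℤ ℤ.* (χ x ℤ.* χ u)))
        ≡⟨ sum-cong elements (λ x → trans (sum-+ elements (λ u → + q ℤ.* A x u) (λ u → -1ℤ ℤ.* (χ x ℤ.* χ u)))
             (cong₂ ℤ._+_ (trans (sum-*ˡ elements (+ q) (A x)) (cong (ℤ._*_ (+ q)) (∑χχ𝟙 x)))
                          (sum-*ˡ elements -1ℤ (λ u → χ x ℤ.* χ u)))) ⟩
      ∑ (λ x → + q ℤ.* (+ 2 ℤ.* (1ℤ ℤ.- 𝟙 (x ≟ 0#))) ℤ.+ -1ℤ ℤ.* ∑ (λ u → χ x ℤ.* χ u))
        ≡⟨ sum-+ elements (λ x → + q ℤ.* (+ 2 ℤ.* (1ℤ ℤ.- 𝟙 (x ≟ 0#)))) (λ x → -1ℤ ℤ.* ∑ (λ u → χ x ℤ.* χ u)) ⟩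
      ∑ (λ x → + q ℤ.* (+ 2 ℤ.* (1ℤ ℤ.- 𝟙 (x ≟ 0#)))) ℤ.+ ∑ (λ x → -1ℤ ℤ.* ∑ (λ u → χ x ℤ.* χ u))
        ≡⟨ cong₂ ℤ._+_
             (trans (sum-*ˡ elements (+ q) (λ x → + 2 ℤ.* (1ℤ ℤ.- 𝟙 (x ≟ 0#)))) (cong (ℤ._*_ (+ q))
               (trans (sum-*ˡ elements (+ 2) (λ x → 1ℤ ℤ.- 𝟙 (x ≟ 0#))) (cong (ℤ._*_ (+ 2)) (∑-1-𝟙 0#)))))
             (trans (sum-*ˡ elements -1ℤ (λ x → ∑ (λ u → χ x ℤ.* χ u)))
               (cong (ℤ._*_ -1ℤ) (trans (sym (sum-product χ χ)) (cong₂ ℤ._*_ ∑χ≡0 ∑χ≡0)))) ⟩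
      + q ℤ.* (+ 2 ℤ.* (+ q ℤ.- 1ℤ)) ℤ.+ 0ℤ
        ≡⟨ ℤ.+-identityʳ _ ⟩
      + q ℤ.* (+ 2 ℤ.* (+ q ℤ.- 1ℤ)) ∎
      where
      open ≡-Reasoning

      c : F → F → ℤ
      c n x = χ (x * x * x - n * x)

      t : F → F → F → ℤ
      t x u n = χ x ℤ.* χ u ℤ.* χ ((n - x * x) * (n - u * u))

      A : F → F → ℤ
      A x u = χ x ℤ.* χ u ℤ.* 𝟙 (x * x ≟ u * u)

      c-* : ∀ x u n → c n x ℤ.* c n u ≡ t x u n
      c-* x u n = trans (sym (χ-* _ _)) (trans (cong χ (solve 3 (λ x u n →
          (x :* x :* x :- n :* x) :* (u :* u :* u :- n :* u) := x :* u :* ((n :- x :* x) :* (n :- u :* u))) refl x u n))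
        (trans (χ-* (x * u) _) (cong (ℤ._* χ ((n - x * x) * (n - u * u))) (χ-* x u))))

      expand : ∀ a b q z → a ℤ.* b ℤ.* (q ℤ.* z ℤ.- 1ℤ) ≡ q ℤ.* (a ℤ.* b ℤ.* z) ℤ.+ -1ℤ ℤ.* (a ℤ.* b)
      expand = solve-∀

    S-0 : S 0# ≡ 0ℤ
    S-0 = trans (sum-cong elements term) ∑χ≡0
      where
      term : ∀ x → χ (x * x * x - 0# * x) ≡ χ x
      term x with x ≟ 0#
      ... | yes refl = cong χ (solve 0 (con 0ℤ :* con 0ℤ :* con 0ℤ :- con 0ℤ :* con 0ℤ := con 0ℤ) refl)
      ... | no x≢0 = trans (cong χ (solve 1 (λ x → x :* x :* x :- con 0ℤ :* x := x :* x :* x) refl x)) (χ-square-* x x≢0)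

    -- Substituting c x for x multiplies the cubic by c³, so S (c² n) = χ c · S n. Thus the square
    -- of S depends only on the square class of n.
    S²-scale : ∀ {c} n → c ≢ 0# → S (c * c * n) ℤ.* S (c * c * n) ≡ S n ℤ.* S n
    S²-scale {c} n c≢0 = begin
      S (c * c * n) ℤ.* S (c * c * n)          ≡⟨ cong₂ ℤ._*_ S-scale S-scale ⟩
      χ c ℤ.* S n ℤ.* (χ c ℤ.* S n)            ≡⟨ swap (χ c) (S n) ⟩
      χ c ℤ.* χ c ℤ.* (S n ℤ.* S n)            ≡⟨ cong (ℤ._* (S n ℤ.* S n)) (trans (sym (χ-* c c)) (χ-square c≢0)) ⟩
      1ℤ ℤ.* (S n ℤ.* S n)                     ≡⟨ ℤ.*-identityˡ _ ⟩
      S n ℤ.* S n                              ∎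
      where
      open ≡-Reasoning
      swap : ∀ a b → a ℤ.* b ℤ.* (a ℤ.* b) ≡ a ℤ.* a ℤ.* (b ℤ.* b)
      swap = solve-∀

      S-scale : S (c * c * n) ≡ χ c ℤ.* S n
      S-scale = begin
        S (c * c * n)
          ≡⟨ sym (∑-scale c≢0 (λ x → χ (x * x * x - c * c * n * x))) ⟩
        ∑ (λ x → χ (c * x * (c * x) * (c * x) - c * c * n * (c * x)))
          ≡⟨ sum-cong elements (λ x → trans (cong χ (solve 3 (λ c n x →
               c :* x :* (c :* x) :* (c :* x) :- c :* c :* n :* (c :* x) := c :* c :* (c :* (x :* x :* x :- n :* x))) refl c n x))
               (trans (χ-square-* _ c≢0) (χ-* c _))) ⟩
        ∑ (λ x → χ c ℤ.* χ (x * x * x - n * x))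
          ≡⟨ sum-*ˡ elements (χ c) _ ⟩
        χ c ℤ.* S n ∎

    module _ {μ g : F} (μ≢0 : μ ≢ 0#) (g-nonsquare : ¬ Square g) where

      private
        m : F
        m = μ * μ

        α β : ℤ
        α = S m ℤ.* S m
        β = S g ℤ.* S g

      -- S² takes the value 0, α or β according to χ n; this is the interpolation of the three
      -- values by a quadratic polynomial in χ n, doubled to clear the denominator.
      S²-by-χ : ∀ n → + 2 ℤ.* (S n ℤ.* S n) ≡ (α ℤ.+ β) ℤ.* (χ n ℤ.* χ n) ℤ.+ (α ℤ.- β) ℤ.* χ n
      S²-by-χ n with χ-view n
      ... | zero refl χ≡0 rewrite χ≡0 | S-0 = ring₀ α β
        where
        ring₀ : ∀ α β → + 2 ℤ.* (0ℤ ℤ.* 0ℤ) ≡ (α ℤ.+ β) ℤ.* (0ℤ ℤ.* 0ℤ) ℤ.+ (α ℤ.- β) ℤ.* 0ℤ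
        ring₀ = solve-∀
      ... | square r r≢0 rr≡n χ≡1 rewrite χ≡1 = trans (cong (ℤ._*_ (+ 2)) S²) (ring₁ α β)
        where
        ring₁ : ∀ α β → + 2 ℤ.* α ≡ (α ℤ.+ β) ℤ.* (1ℤ ℤ.* 1ℤ) ℤ.+ (α ℤ.- β) ℤ.* 1ℤ
        ring₁ = solve-∀

        n≡ : n ≡ inv μ * r * (inv μ * r) * m
        n≡ = trans (sym rr≡n) (trans (sym (cong₂ _*_ (x*inv r μ≢0) (x*inv r μ≢0)))
          (solve 3 (λ μ w r → μ :* (w :* r) :* (μ :* (w :* r)) := w :* r :* (w :* r) :* (μ :* μ)) refl μ (inv μ) r))

        S² : S n ℤ.* S n ≡ α
        S² = trans (cong (λ n → S n ℤ.* S n) n≡) (S²-scale m (*-nonzero (inv-nonzero μ≢0) r≢0))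
      ... | nonsquare n≢0 n-nonsquare χ≡-1 rewrite χ≡-1 = trans (cong (ℤ._*_ (+ 2)) S²) (ring₂ α β)
        where
        ring₂ : ∀ α β → + 2 ℤ.* β ≡ (α ℤ.+ β) ℤ.* (-1ℤ ℤ.* -1ℤ) ℤ.+ (α ℤ.- β) ℤ.* -1ℤ
        ring₂ = solve-∀

        g≢0 : g ≢ 0#
        g≢0 refl = g-nonsquare (0# , zeroˡ 0#)

        S² : S n ℤ.* S n ≡ β
        S² with nonsquare-* g-nonsquare n-nonsquare
        ... | r , rr≡gn = trans (cong (λ n → S n ℤ.* S n) n≡) (S²-scale g (*-nonzero (inv-nonzero g≢0) r≢0))
          where
          r≢0 : r ≢ 0#
          r≢0 refl = *-nonzero g≢0 n≢0 (trans (sym rr≡gn) (zeroˡ 0#))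

          n≡ : n ≡ inv g * r * (inv g * r) * g
          n≡ = *-cancelˡ g≢0 (trans (sym rr≡gn) (trans (sym (cong₂ _*_ (x*inv r g≢0) (x*inv r g≢0)))
            (solve 3 (λ g w r → g :* (w :* r) :* (g :* (w :* r)) := g :* (w :* r :* (w :* r) :* g)) refl g (inv g) r)))

      -- Summing `S²-by-χ` over n removes the part linear in χ and leaves (α + β)(q - 1) = 4 q (q -
      -- 1).
      jacobsthal : S (μ * μ) ℤ.* S (μ * μ) ℤ.+ S g ℤ.* S g ≡ + 4 ℤ.* + q
      jacobsthal = ℤ.*-cancelʳ-≡ _ _ (+ q ℤ.- 1ℤ) 
        {{ℤ.≢-nonZero (λ e → ℕ.<⇒≢ 1<q (sym (ℤ.+-injective (ℤ.i-j≡0⇒i≡j (+ q) 1ℤ e))))}} (begin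
        (α ℤ.+ β) ℤ.* (+ q ℤ.- 1ℤ)
          ≡⟨ cong (ℤ._*_ (α ℤ.+ β)) (sym (trans (sum-cong elements χχ) (∑-1-𝟙 0#))) ⟩
        (α ℤ.+ β) ℤ.* ∑ (λ n → χ n ℤ.* χ n)
          ≡⟨ add-zero (α ℤ.+ β) (α ℤ.- β) (∑ (λ n → χ n ℤ.* χ n)) ⟩
        (α ℤ.+ β) ℤ.* ∑ (λ n → χ n ℤ.* χ n) ℤ.+ (α ℤ.- β) ℤ.* 0ℤ
          ≡⟨ cong₂ ℤ._+_ (sym (sum-*ˡ elements (α ℤ.+ β) (λ n → χ n ℤ.* χ n)))
               (trans (cong (ℤ._*_ (α ℤ.- β)) (sym ∑χ≡0)) (sym (sum-*ˡ elements (α ℤ.- β) χ))) ⟩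
        ∑ (λ n → (α ℤ.+ β) ℤ.* (χ n ℤ.* χ n)) ℤ.+ ∑ (λ n → (α ℤ.- β) ℤ.* χ n)
          ≡⟨ sym (sum-+ elements (λ n → (α ℤ.+ β) ℤ.* (χ n ℤ.* χ n)) (λ n → (α ℤ.- β) ℤ.* χ n)) ⟩
        ∑ (λ n → (α ℤ.+ β) ℤ.* (χ n ℤ.* χ n) ℤ.+ (α ℤ.- β) ℤ.* χ n)
          ≡⟨ sum-cong elements (λ n → sym (S²-by-χ n)) ⟩
        ∑ (λ n → + 2 ℤ.* (S n ℤ.* S n))
          ≡⟨ sum-*ˡ elements (+ 2) (λ n → S n ℤ.* S n) ⟩
        + 2 ℤ.* ∑ (λ n → S n ℤ.* S n)
          ≡⟨ cong (ℤ._*_ (+ 2)) jacobsthal-sum ⟩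
        + 2 ℤ.* (+ q ℤ.* (+ 2 ℤ.* (+ q ℤ.- 1ℤ)))
          ≡⟨ collect (+ q) ⟩
        + 4 ℤ.* + q ℤ.* (+ q ℤ.- 1ℤ) ∎)
        where
        open ≡-Reasoning
        add-zero : ∀ a b x → a ℤ.* x ≡ a ℤ.* x ℤ.+ b ℤ.* 0ℤ
        add-zero = solve-∀
        collect : ∀ q → + 2 ℤ.* (q ℤ.* (+ 2 ℤ.* (q ℤ.- 1ℤ))) ≡ + 4 ℤ.* q ℤ.* (q ℤ.- 1ℤ)
        collect = solve-∀

-- The field of residues modulo p

module Residues (n : ℕ) where

  -- Writing the modulus as 3 + n lets 0, 1 and 2 be distinct residues by computation, and the
  -- Fermat exponent p - 2 becomes `suc n`.
  p : ℕ
  p = 3 ℕ.+ n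

  infixl 6 _+_
  infixl 7 _*_
  infix 8 -_

  ι : ℤ → Fin p
  ι a = fromℕ< (n%ℕd<d a p)

  ⌊_⌋ : Fin p → ℤ
  ⌊ x ⌋ = + toℕ x

  _+_ _*_ : Fin p → Fin p → Fin p
  x + y = ι (⌊ x ⌋ ℤ.+ ⌊ y ⌋)
  x * y = ι (⌊ x ⌋ ℤ.* ⌊ y ⌋)

  -_ : Fin p → Fin p
  - x = ι (ℤ.- ⌊ x ⌋)

  toℕ-ι : ∀ a → toℕ (ι a) ≡ a %ℕ p
  toℕ-ι a = Fin.toℕ-fromℕ< (n%ℕd<d a p)

  ι-⌊⌋ : ∀ x → ι ⌊ x ⌋ ≡ x
  ι-⌊⌋ x = Fin.toℕ-injective (trans (toℕ-ι ⌊ x ⌋) (m<n⇒m%n≡m (Fin.toℕ<n x)))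

  ∣-⌊ι⌋ : ∀ a → + p ∣ a ℤ.- ⌊ ι a ⌋
  ∣-⌊ι⌋ a = divides (a /ℕ p) (begin
    a ℤ.- ⌊ ι a ⌋                                    ≡⟨ cong (λ r → a ℤ.- + r) (toℕ-ι a) ⟩
    a ℤ.- + (a %ℕ p)                                 ≡⟨ cong (ℤ._- + (a %ℕ p)) (a≡a%ℕn+[a/ℕn]*n a p) ⟩
    + (a %ℕ p) ℤ.+ a /ℕ p ℤ.* + p ℤ.- + (a %ℕ p)     ≡⟨ cancel (+ (a %ℕ p)) (a /ℕ p ℤ.* + p) ⟩
    a /ℕ p ℤ.* + p                                   ∎)
    where
    open ≡-Reasoning
    cancel : ∀ r q → r ℤ.+ q ℤ.- r ≡ q
    cancel = solve-∀

  ∣⇒≡ : ∀ {x y : Fin p} → + p ∣ ⌊ x ⌋ ℤ.- ⌊ y ⌋ → x ≡ y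
  ∣⇒≡ {x} {y} p∣x-y = Fin.toℕ-injective (ℤ.+-injective (ℤ.i-j≡0⇒i≡j ⌊ x ⌋ ⌊ y ⌋ (ℤ.∣i∣≡0⇒i≡0 (small (∣⇒∣ᵤ p∣x-y) bound))))
    where
    small : ∀ {k} → p ℕ.∣ k → k ℕ.< p → k ≡ 0
    small {zero} _ _ = refl
    small {suc k} p∣k k<p = contradiction (ℕ.∣⇒≤ p∣k) (ℕ.<⇒≱ k<p)

    bound : ℤ.∣ ⌊ x ⌋ ℤ.- ⌊ y ⌋ ∣ ℕ.< p
    bound = ℕ.≤-<-trans (subst (λ z → ℤ.∣ z ∣ ℕ.≤ toℕ x ℕ.⊔ toℕ y) (sym (ℤ.m-n≡m⊖n (toℕ x) (toℕ y))) (ℤ.∣m⊝n∣≤m⊔n (toℕ x) (toℕ y)))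
      (ℕ.⊔-lub (Fin.toℕ<n x) (Fin.toℕ<n y))

  ι-cong : ∀ a b → + p ∣ a ℤ.- b → ι a ≡ ι b
  ι-cong a b (divides q a-b≡qp) with ∣-⌊ι⌋ a | ∣-⌊ι⌋ b
  ... | divides s ea | divides t eb = ∣⇒≡ (divides (q ℤ.- s ℤ.+ t) (trans (regroup a b ⌊ ι a ⌋ ⌊ ι b ⌋)
    (trans (cong₂ ℤ._+_ (cong₂ ℤ._-_ a-b≡qp ea) eb) (factor q s t (+ p)))))
    where
    regroup : ∀ a b x y → x ℤ.- y ≡ (a ℤ.- b) ℤ.- (a ℤ.- x) ℤ.+ (b ℤ.- y)
    regroup = solve-∀
    factor : ∀ q s t p → q ℤ.* p ℤ.- s ℤ.* p ℤ.+ t ℤ.* p ≡ (q ℤ.- s ℤ.+ t) ℤ.* p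
    factor = solve-∀

  ι≡⇒∣ : ∀ a b → ι a ≡ ι b → + p ∣ a ℤ.- b
  ι≡⇒∣ a b e with ∣-⌊ι⌋ a | ∣-⌊ι⌋ b
  ... | divides s ea | divides t eb = divides (s ℤ.- t) (trans (regroup a b ⌊ ι a ⌋ ⌊ ι b ⌋)
    (trans (cong₂ ℤ._+_ (cong₂ ℤ._-_ ea eb) (trans (cong (λ z → ⌊ z ⌋ ℤ.- ⌊ ι b ⌋) e) (ℤ.+-inverseʳ ⌊ ι b ⌋))) (factor s t (+ p))))
    where
    regroup : ∀ a b x y → a ℤ.- b ≡ (a ℤ.- x) ℤ.- (b ℤ.- y) ℤ.+ (x ℤ.- y)
    regroup = solve-∀
    factor : ∀ s t p → s ℤ.* p ℤ.- t ℤ.* p ℤ.+ 0ℤ ≡ (s ℤ.- t) ℤ.* p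
    factor = solve-∀

  ι-+ : ∀ a b → ι (a ℤ.+ b) ≡ ι a + ι b
  ι-+ a b with ∣-⌊ι⌋ a | ∣-⌊ι⌋ b
  ... | divides s ea | divides t eb = ι-cong (a ℤ.+ b) (⌊ ι a ⌋ ℤ.+ ⌊ ι b ⌋) (divides (s ℤ.+ t) (trans (regroup a b ⌊ ι a ⌋ ⌊ ι b ⌋)
    (trans (cong₂ ℤ._+_ ea eb) (sym (ℤ.*-distribʳ-+ (+ p) s t)))))
    where
    regroup : ∀ a b x y → a ℤ.+ b ℤ.- (x ℤ.+ y) ≡ (a ℤ.- x) ℤ.+ (b ℤ.- y)
    regroup = solve-∀

  ι-* : ∀ a b → ι (a ℤ.* b) ≡ ι a * ι b
  ι-* a b with ∣-⌊ι⌋ a | ∣-⌊ι⌋ b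
  ... | divides s ea | divides t eb = ι-cong (a ℤ.* b) (⌊ ι a ⌋ ℤ.* ⌊ ι b ⌋) (divides (s ℤ.* b ℤ.+ ⌊ ι a ⌋ ℤ.* t) (trans (regroup a b ⌊ ι a ⌋ ⌊ ι b ⌋)
    (trans (cong₂ (λ u v → u ℤ.* b ℤ.+ ⌊ ι a ⌋ ℤ.* v) ea eb) (factor s t b ⌊ ι a ⌋ (+ p)))))
    where
    regroup : ∀ a b x y → a ℤ.* b ℤ.- x ℤ.* y ≡ (a ℤ.- x) ℤ.* b ℤ.+ x ℤ.* (b ℤ.- y)
    regroup = solve-∀
    factor : ∀ s t b x p → s ℤ.* p ℤ.* b ℤ.+ x ℤ.* (t ℤ.* p) ≡ (s ℤ.* b ℤ.+ x ℤ.* t) ℤ.* p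
    factor = solve-∀

  ι-neg : ∀ a → ι (ℤ.- a) ≡ - ι a
  ι-neg a with ∣-⌊ι⌋ a
  ... | divides s ea = ι-cong (ℤ.- a) (ℤ.- ⌊ ι a ⌋) (divides (ℤ.- s) (trans (regroup a ⌊ ι a ⌋) (trans (cong ℤ.-_ ea) (ℤ.neg-distribˡ-* s (+ p)))))
    where
    regroup : ∀ a x → ℤ.- a ℤ.- ℤ.- x ≡ ℤ.- (a ℤ.- x)
    regroup = solve-∀

  -- Seeing each residue as some `ι a` allows the ring laws to be pushed forward from ℤ along the
  -- homomorphism.
  data Lift : Fin p → Set where
    lift : ∀ a → Lift (ι a)

  lift-of : ∀ x → Lift x
  lift-of x = subst Lift (ι-⌊⌋ x) (lift ⌊ x ⌋)

  +-assoc : ∀ x y z → (x + y) + z ≡ x + (y + z)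
  +-assoc x y z with lift-of x | lift-of y | lift-of z
  ... | lift a | lift b | lift c = begin
    (ι a + ι b) + ι c       ≡⟨ cong (_+ ι c) (sym (ι-+ a b)) ⟩
    ι (a ℤ.+ b) + ι c       ≡⟨ sym (ι-+ (a ℤ.+ b) c) ⟩
    ι ((a ℤ.+ b) ℤ.+ c)     ≡⟨ cong ι (ℤ.+-assoc a b c) ⟩
    ι (a ℤ.+ (b ℤ.+ c))     ≡⟨ ι-+ a (b ℤ.+ c) ⟩
    ι a + ι (b ℤ.+ c)       ≡⟨ cong (_+_ (ι a)) (ι-+ b c) ⟩
    ι a + (ι b + ι c)       ∎
    where open ≡-Reasoning

  *-assoc : ∀ x y z → (x * y) * z ≡ x * (y * z)
  *-assoc x y z with lift-of x | lift-of y | lift-of z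
  ... | lift a | lift b | lift c = begin
    (ι a * ι b) * ι c       ≡⟨ cong (_* ι c) (sym (ι-* a b)) ⟩
    ι (a ℤ.* b) * ι c       ≡⟨ sym (ι-* (a ℤ.* b) c) ⟩
    ι ((a ℤ.* b) ℤ.* c)     ≡⟨ cong ι (ℤ.*-assoc a b c) ⟩
    ι (a ℤ.* (b ℤ.* c))     ≡⟨ ι-* a (b ℤ.* c) ⟩
    ι a * ι (b ℤ.* c)       ≡⟨ cong (_*_ (ι a)) (ι-* b c) ⟩
    ι a * (ι b * ι c)       ∎
    where open ≡-Reasoning

  +-comm : ∀ x y → x + y ≡ y + x
  +-comm x y = cong ι (ℤ.+-comm ⌊ x ⌋ ⌊ y ⌋)

  *-comm : ∀ x y → x * y ≡ y * x
  *-comm x y = cong ι (ℤ.*-comm ⌊ x ⌋ ⌊ y ⌋)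

  *-distribˡ-+ : ∀ x y z → x * (y + z) ≡ x * y + x * z
  *-distribˡ-+ x y z with lift-of x | lift-of y | lift-of z
  ... | lift a | lift b | lift c = begin
    ι a * (ι b + ι c)               ≡⟨ cong (_*_ (ι a)) (sym (ι-+ b c)) ⟩
    ι a * ι (b ℤ.+ c)               ≡⟨ sym (ι-* a (b ℤ.+ c)) ⟩
    ι (a ℤ.* (b ℤ.+ c))             ≡⟨ cong ι (ℤ.*-distribˡ-+ a b c) ⟩
    ι (a ℤ.* b ℤ.+ a ℤ.* c)         ≡⟨ ι-+ (a ℤ.* b) (a ℤ.* c) ⟩
    ι (a ℤ.* b) + ι (a ℤ.* c)       ≡⟨ cong₂ _+_ (ι-* a b) (ι-* a c) ⟩
    ι a * ι b + ι a * ι c           ∎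
    where open ≡-Reasoning

  +-identityˡ : ∀ x → ι 0ℤ + x ≡ x
  +-identityˡ x with lift-of x
  ... | lift a = trans (sym (ι-+ 0ℤ a)) (cong ι (ℤ.+-identityˡ a))

  *-identityˡ : ∀ x → ι 1ℤ * x ≡ x
  *-identityˡ x with lift-of x
  ... | lift a = trans (sym (ι-* 1ℤ a)) (cong ι (ℤ.*-identityˡ a))

  -‿inverseˡ : ∀ x → - x + x ≡ ι 0ℤ
  -‿inverseˡ x with lift-of x
  ... | lift a = trans (cong (_+ ι a) (sym (ι-neg a))) (trans (sym (ι-+ (ℤ.- a) a)) (cong ι (ℤ.+-inverseˡ a)))

  isCommutativeRing : IsCommutativeRing _≡_ _+_ _*_ -_ (ι 0ℤ) (ι 1ℤ)
  isCommutativeRing = record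
    { isRing = record
      { +-isAbelianGroup = record
        { isGroup = record
          { isMonoid = record
            { isSemigroup = record
              { isMagma = record { isEquivalence = isEquivalence ; ∙-cong = cong₂ _+_ }
              ; assoc = +-assoc }
            ; identity = +-identityˡ , λ x → trans (+-comm x (ι 0ℤ)) (+-identityˡ x) }
          ; inverse = -‿inverseˡ , λ x → trans (+-comm x (- x)) (-‿inverseˡ x)
          ; ⁻¹-cong = cong -_ }
        ; comm = +-comm }
      ; *-cong = cong₂ _*_
      ; *-assoc = *-assoc
      ; *-identity = *-identityˡ , λ x → trans (*-comm x (ι 1ℤ)) (*-identityˡ x)
      ; distrib = *-distribˡ-+ , λ x y z → trans (*-comm (y + z) x) (trans (*-distribˡ-+ x y z) (cong₂ _+_ (*-comm x y) (*-comm x z)))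
      }
    ; *-comm = *-comm
    }

  commutativeRing : CommutativeRing _ _
  commutativeRing = record { isCommutativeRing = isCommutativeRing }

  open CommutativeRing commutativeRing using (*-commutativeMonoid; zeroˡ; zeroʳ; *-identityʳ)

  pow : Fin p → ℕ → Fin p
  pow x zero = ι 1ℤ
  pow x (suc k) = x * pow x k

  module _ (pr : Prime p) where

    -- Bézout inverses serve the proof of `fermat`; the inverse of the field itself is the power
    -- xᵖ⁻², as in `CurveFp`.
    inverse : ∀ x → x ≢ ι 0ℤ → ∃ λ y → y * x ≡ ι 1ℤ
    inverse x x≢0 with coprime-Bézout (prime⇒coprime pr {{ℕ.≢-nonZero toℕx≢0}} (Fin.toℕ<n x))
      where
      toℕx≢0 : toℕ x ≢ 0
      toℕx≢0 e = x≢0 (trans (sym (ι-⌊⌋ x)) (cong (ι ∘ +_) e))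
    ... | Bézout.+- s t 1+tx≡sp = ι (ℤ.- (+ t)) , trans (cong (ι (ℤ.- (+ t)) *_) (sym (ι-⌊⌋ x))) (trans (sym (ι-* (ℤ.- (+ t)) ⌊ x ⌋))
      (ι-cong (ℤ.- (+ t) ℤ.* ⌊ x ⌋) 1ℤ (divides (ℤ.- (+ s)) (trans (regroup (+ t) ⌊ x ⌋) (trans (cong ℤ.-_ (begin
        1ℤ ℤ.+ + t ℤ.* ⌊ x ⌋       ≡⟨ cong (ℤ._+_ 1ℤ) (sym (ℤ.pos-* t (toℕ x))) ⟩
        + (1 ℕ.+ t ℕ.* toℕ x)      ≡⟨ cong +_ 1+tx≡sp ⟩
        + (s ℕ.* p)                ≡⟨ ℤ.pos-* s p ⟩
        + s ℤ.* + p                ∎)) (ℤ.neg-distribˡ-* (+ s) (+ p)))))))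
      where
      open ≡-Reasoning
      regroup : ∀ t x → ℤ.- t ℤ.* x ℤ.- 1ℤ ≡ ℤ.- (1ℤ ℤ.+ t ℤ.* x)
      regroup = solve-∀
    ... | Bézout.-+ s t 1+sp≡tx = ι (+ t) , trans (cong (ι (+ t) *_) (sym (ι-⌊⌋ x))) (trans (sym (ι-* (+ t) ⌊ x ⌋))
      (ι-cong (+ t ℤ.* ⌊ x ⌋) 1ℤ (divides (+ s) (begin
        + t ℤ.* ⌊ x ⌋ ℤ.- 1ℤ         ≡⟨ cong (ℤ._- 1ℤ) (sym (ℤ.pos-* t (toℕ x))) ⟩
        + (t ℕ.* toℕ x) ℤ.- 1ℤ       ≡⟨ cong (λ z → + z ℤ.- 1ℤ) (sym 1+sp≡tx) ⟩
        + (1 ℕ.+ s ℕ.* p) ℤ.- 1ℤ     ≡⟨ cancel (+ (s ℕ.* p)) ⟩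
        + (s ℕ.* p)                  ≡⟨ ℤ.pos-* s p ⟩
        + s ℤ.* + p                  ∎))))
      where
      open ≡-Reasoning
      cancel : ∀ z → 1ℤ ℤ.+ z ℤ.- 1ℤ ≡ z
      cancel = solve-∀

    *-cancelˡ-nonzero : ∀ {x y z} → x ≢ ι 0ℤ → x * y ≡ x * z → y ≡ z
    *-cancelˡ-nonzero {x} {y} {z} x≢0 xy≡xz with inverse x x≢0
    ... | w , wx≡1 = begin
      y             ≡⟨ sym (*-identityˡ y) ⟩
      ι 1ℤ * y      ≡⟨ cong (_* y) (sym wx≡1) ⟩
      w * x * y     ≡⟨ *-assoc w x y ⟩
      w * (x * y)   ≡⟨ cong (w *_) xy≡xz ⟩
      w * (x * z)   ≡⟨ sym (*-assoc w x z) ⟩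
      w * x * z     ≡⟨ cong (_* z) wx≡1 ⟩
      ι 1ℤ * z      ≡⟨ *-identityˡ z ⟩
      z             ∎
      where open ≡-Reasoning

    1≢0 : ι 1ℤ ≢ ι 0ℤ
    1≢0 ()

    -- Multiplication by x permutes the nonzero residues, so comparing the products over all of them
    -- gives x ^ (p − 1) = 1; the factor at 0 is replaced by 1.
    fermat : ∀ x → x ≢ ι 0ℤ → x * pow x (suc n) ≡ ι 1ℤ
    fermat x x≢0 = *-cancelˡ-nonzero ∏h≢0 (begin
      ∏ h * (x * pow x (suc n))       ≡⟨ *-comm (∏ h) _ ⟩
      x * pow x (suc n) * ∏ h         ≡⟨ cong (_* ∏ h) (sym ∏c) ⟩
      ∏ c * ∏ h                       ≡⟨ sym (∑-distrib-+ c h) ⟩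
      ∏ (λ z → c z * h z)             ≡⟨ sum-cong-≗ scale ⟩
      ∏ (λ z → h (x * z))             ≡⟨ sym (∑-permute h π) ⟩
      ∏ h                             ≡⟨ sym (*-identityʳ (∏ h)) ⟩
      ∏ h * ι 1ℤ                      ∎)
      where
      open ≡-Reasoning
      open Product *-commutativeMonoid using (∑-distrib-+; ∑-permute; sum-cong-≗) renaming (sum to ∏)

      w = proj₁ (inverse x x≢0)
      wx≡1 = proj₂ (inverse x x≢0)

      cancel : ∀ u v → u * v ≡ ι 1ℤ → ∀ z → u * (v * z) ≡ z
      cancel u v uv≡1 z = trans (sym (*-assoc u v z)) (trans (cong (_* z) uv≡1) (*-identityˡ z))

      π = permutation (x *_) (w *_) (cancel x w (trans (*-comm x w) wx≡1)) (cancel w x wx≡1)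

      h c : Fin p → Fin p
      h Fin.zero = ι 1ℤ
      h z@(Fin.suc _) = z
      c Fin.zero = ι 1ℤ
      c (Fin.suc _) = x

      h≢0 : ∀ z → h z ≢ ι 0ℤ
      h≢0 Fin.zero ()
      h≢0 (Fin.suc z) ()

      h-nonzero : ∀ z → z ≢ ι 0ℤ → h z ≡ z
      h-nonzero Fin.zero z≢0 = contradiction refl z≢0
      h-nonzero (Fin.suc z) _ = refl

      product-nonzero : ∀ {k} (f : Fin k → Fin p) → (∀ j → f j ≢ ι 0ℤ) → ∏ f ≢ ι 0ℤ
      product-nonzero {zero} f _ = 1≢0
      product-nonzero {suc k} f f≢0 e = product-nonzero (f ∘ Fin.suc) (f≢0 ∘ Fin.suc)
        (*-cancelˡ-nonzero (f≢0 Fin.zero) (trans e (sym (zeroʳ (f Fin.zero)))))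

      ∏h≢0 : ∏ h ≢ ι 0ℤ
      ∏h≢0 = product-nonzero h h≢0

      ∏-constant : ∀ k → ∏ {k} (λ _ → x) ≡ pow x k
      ∏-constant zero = refl
      ∏-constant (suc k) = cong (x *_) (∏-constant k)

      ∏c : ∏ c ≡ x * pow x (suc n)
      ∏c = trans (*-identityˡ _) (∏-constant (2 ℕ.+ n))

      scale : ∀ z → c z * h z ≡ h (x * z)
      scale Fin.zero = trans (*-identityˡ (ι 1ℤ)) (cong h (sym (zeroʳ x)))
      scale z@(Fin.suc _) = sym (h-nonzero (x * z) (λ xz≡0 → h≢0 z (*-cancelˡ-nonzero x≢0 (trans xz≡0 (sym (zeroʳ x))))))

    field-of-residues : FieldOn p
    field-of-residues = record
      { _+_ = _+_ ; _*_ = _*_ ; -_ = -_ ; inv = λ x → pow x (suc n) ; ι = ι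
      ; isCommutativeRing = isCommutativeRing
      ; ι-+ = ι-+ ; ι-* = ι-* ; ι-neg = ι-neg
      ; 1≢0 = 1≢0
      ; inv-0 = zeroˡ (pow (ι 0ℤ) n)
      ; *-inv = fermat
      }

-- An interface to the residues: with the field a variable, the comparison with `CurveFp` goes
-- through these equations and never unfolds the construction.
record ResidueField (n : ℕ) : Set where
  field
    fieldOn : FieldOn (3 ℕ.+ n)
  open FieldProperties fieldOn public
  field
    toℕ-ι   : ∀ a → toℕ (ι a) ≡ a %ℕ (3 ℕ.+ n)
    ι-cong  : ∀ a b → + (3 ℕ.+ n) ∣ a ℤ.- b → ι a ≡ ι b
    ι≡⇒∣    : ∀ a b → ι a ≡ ι b → + (3 ℕ.+ n) ∣ a ℤ.- b
    inv≡pow : ∀ x → inv x ≡ pow x (suc n)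
    2≢0     : ι (+ 2) ≢ 0#

residueField : ∀ n → Prime (3 ℕ.+ n) → ResidueField n
residueField n pr = record
  { fieldOn = field-of-residues pr
  ; toℕ-ι = toℕ-ι ; ι-cong = ι-cong ; ι≡⇒∣ = ι≡⇒∣
  ; inv≡pow = λ x → pow≡pow x (suc n)
  ; 2≢0 = λ ()
  }
  where
  open Residues n
  pow≡pow : ∀ x k → pow x k ≡ FieldProperties.pow (field-of-residues pr) x k
  pow≡pow x zero = refl
  pow≡pow x (suc k) = cong (x *_) (pow≡pow x k)

-- Sums of two squares and the number of points

prime-∣-* : ∀ {q} → Prime q → ∀ a b → + q ∣ a ℤ.* b → + q ∣ a ⊎ + q ∣ b
prime-∣-* {q} pr a b q∣ab with euclidsLemma ℤ.∣ a ∣ ℤ.∣ b ∣ pr (subst (q ℕ.∣_) (ℤ.abs-* a b) (∣⇒∣ᵤ q∣ab))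
... | inj₁ q∣a = inj₁ (∣ᵤ⇒∣ q∣a)
... | inj₂ q∣b = inj₂ (∣ᵤ⇒∣ q∣b)

even⊎odd : ∀ a → ∃ (λ j → a ≡ + 2 ℤ.* j) ⊎ ∃ (λ j → a ≡ 1ℤ ℤ.+ + 2 ℤ.* j)
even⊎odd a with a %ℕ 2 | a /ℕ 2 | n%ℕd<d a 2 | a≡a%ℕn+[a/ℕn]*n a 2
... | 0 | j | _ | e = inj₁ (j , trans e (trans (ℤ.+-identityˡ _) (ℤ.*-comm j (+ 2))))
... | 1 | j | _ | e = inj₂ (j , trans e (cong (ℤ._+_ 1ℤ) (ℤ.*-comm j (+ 2))))
... | suc (suc _) | _ | ℕ.s≤s (ℕ.s≤s ()) | _

pos-*-abs : ∀ a → a ℤ.* a ≡ + (ℤ.∣ a ∣ ℕ.* ℤ.∣ a ∣)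
pos-*-abs (+ n) = sym (ℤ.pos-* n n)
pos-*-abs ℤ.-[1+ n ] = refl

∣k∣≤1 : ∀ {q} .{{_ : ℕ.NonZero q}} M k → M ℤ.* M ℤ.+ + q ℤ.* k ℤ.* (+ q ℤ.* k) ≡ + q ℤ.* + q → ℤ.∣ k ∣ ℕ.≤ 1
∣k∣≤1 {q} M k e with ℤ.∣ k ∣ ℕ.≤? 1
... | yes k≤1 = k≤1
... | no k≰1 = contradiction q*k≤q (ℕ.<⇒≱ (ℕ.m<m*n q ℤ.∣ k ∣ (ℕ.≰⇒> k≰1)))
  where
  open ℕ.≤-Reasoning

  abs-eq : ℤ.∣ M ∣ ℕ.* ℤ.∣ M ∣ ℕ.+ (q ℕ.* ℤ.∣ k ∣) ℕ.* (q ℕ.* ℤ.∣ k ∣) ≡ q ℕ.* q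
  abs-eq = ℤ.+-injective (trans (ℤ.pos-+ (ℤ.∣ M ∣ ℕ.* ℤ.∣ M ∣) _) (trans (cong₂ ℤ._+_ (sym (pos-*-abs M))
    (trans (cong (λ z → + (z ℕ.* z)) (sym (ℤ.abs-* (+ q) k))) (sym (pos-*-abs (+ q ℤ.* k))))) (trans e (sym (ℤ.pos-* q q)))))

  q*k≤q : q ℕ.* ℤ.∣ k ∣ ℕ.≤ q
  q*k≤q = ℕ.≮⇒≥ (λ q<qk → ℕ.<⇒≱ (ℕ.*-mono-< q<qk q<qk) (begin
    q ℕ.* ℤ.∣ k ∣ ℕ.* (q ℕ.* ℤ.∣ k ∣)   ≤⟨ ℕ.m≤n+m _ (ℤ.∣ M ∣ ℕ.* ℤ.∣ M ∣) ⟩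
    _                                   ≡⟨ abs-eq ⟩
    q ℕ.* q                             ∎))

∣k∣≤1⇒ : ∀ k → ℤ.∣ k ∣ ℕ.≤ 1 → k ≡ 0ℤ ⊎ k ≡ 1ℤ ⊎ k ≡ -1ℤ
∣k∣≤1⇒ (+ 0) _ = inj₁ refl
∣k∣≤1⇒ (+ 1) _ = inj₂ (inj₁ refl)
∣k∣≤1⇒ (+ suc (suc _)) (ℕ.s≤s ())
∣k∣≤1⇒ ℤ.-[1+ 0 ] _ = inj₂ (inj₂ refl)
∣k∣≤1⇒ ℤ.-[1+ suc _ ] (ℕ.s≤s ())

xx≡0⇒x≡0ᶻ : ∀ x → x ℤ.* x ≡ 0ℤ → x ≡ 0ℤ
xx≡0⇒x≡0ᶻ x e with ℤ.i*j≡0⇒i≡0∨j≡0 x e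
... | inj₁ x≡0 = x≡0
... | inj₂ x≡0 = x≡0

xx≡yy⇒x≡±yᶻ : ∀ x y → x ℤ.* x ≡ y ℤ.* y → x ≡ y ⊎ x ≡ ℤ.- y
xx≡yy⇒x≡±yᶻ x y e = Sum.map (ℤ.i-j≡0⇒i≡j x y)
    (λ x+y≡0 → ℤ.i-j≡0⇒i≡j x (ℤ.- y) (trans (cong (ℤ._+_ x) (ℤ.neg-involutive y)) x+y≡0))
    (ℤ.i*j≡0⇒i≡0∨j≡0 (x ℤ.- y) {x ℤ.+ y} (trans (factor x y) (ℤ.i≡j⇒i-j≡0 e)))
  where
  factor : ∀ x y → (x ℤ.- y) ℤ.* (x ℤ.+ y) ≡ x ℤ.* x ℤ.- y ℤ.* y
  factor = solve-∀

-- (A a + B b)² + (A b − a B)² = q², and q A = a (A a + B b) + b (A b − a B).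
two-squares-∣ : ∀ {q} .{{_ : ℕ.NonZero q}} A B a b → A ℤ.* A ℤ.+ B ℤ.* B ≡ + q → a ℤ.* a ℤ.+ b ℤ.* b ≡ + q →
                + q ∣ A ℤ.* b ℤ.- a ℤ.* B → (A ≡ a ⊎ A ≡ ℤ.- a) ⊎ (A ≡ b ⊎ A ≡ ℤ.- b)
two-squares-∣ {q} A B a b AB ab (divides k kq) = cases (∣k∣≤1⇒ k (∣k∣≤1 {q} M k M²+q²k²))
  where
  Q M : ℤ
  Q = + q
  M = A ℤ.* a ℤ.+ B ℤ.* b

  brahmagupta : ∀ A B a b → (A ℤ.* a ℤ.+ B ℤ.* b) ℤ.* (A ℤ.* a ℤ.+ B ℤ.* b) ℤ.+ (A ℤ.* b ℤ.- a ℤ.* B) ℤ.* (A ℤ.* b ℤ.- a ℤ.* B)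
                ≡ (A ℤ.* A ℤ.+ B ℤ.* B) ℤ.* (a ℤ.* a ℤ.+ b ℤ.* b)
  brahmagupta = solve-∀

  M²+q²k² : M ℤ.* M ℤ.+ Q ℤ.* k ℤ.* (Q ℤ.* k) ≡ Q ℤ.* Q
  M²+q²k² = trans (cong (λ z → M ℤ.* M ℤ.+ z ℤ.* z) (trans (ℤ.*-comm Q k) (sym kq)))
    (trans (brahmagupta A B a b) (cong₂ ℤ._*_ AB ab))

  qA : Q ℤ.* A ≡ a ℤ.* M ℤ.+ b ℤ.* (k ℤ.* Q)
  qA = trans (cong (ℤ._* A) (sym ab)) (trans (expand A B a b) (cong (λ z → a ℤ.* M ℤ.+ b ℤ.* z) kq))
    where
    expand : ∀ A B a b → (a ℤ.* a ℤ.+ b ℤ.* b) ℤ.* A ≡ a ℤ.* (A ℤ.* a ℤ.+ B ℤ.* b) ℤ.+ b ℤ.* (A ℤ.* b ℤ.- a ℤ.* B)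
    expand = solve-∀

  M²≡ : M ℤ.* M ≡ Q ℤ.* Q ℤ.- Q ℤ.* k ℤ.* (Q ℤ.* k)
  M²≡ = trans (isolate (M ℤ.* M) (Q ℤ.* k ℤ.* (Q ℤ.* k))) (cong (ℤ._- Q ℤ.* k ℤ.* (Q ℤ.* k)) M²+q²k²)
    where
    isolate : ∀ x y → x ≡ x ℤ.+ y ℤ.- y
    isolate = solve-∀

  cancel-q : ∀ {z} → Q ℤ.* A ≡ Q ℤ.* z → A ≡ z
  cancel-q {z} = ℤ.*-cancelˡ-≡ Q A z

  M≡0 : k ℤ.* k ≡ 1ℤ → M ≡ 0ℤ
  M≡0 kk≡1 = xx≡0⇒x≡0ᶻ M (trans M²≡ (trans (collect Q k) (trans (cong (λ z → Q ℤ.* Q ℤ.- Q ℤ.* Q ℤ.* z) kk≡1) (vanish Q))))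
    where
    collect : ∀ Q k → Q ℤ.* Q ℤ.- Q ℤ.* k ℤ.* (Q ℤ.* k) ≡ Q ℤ.* Q ℤ.- Q ℤ.* Q ℤ.* (k ℤ.* k)
    collect = solve-∀
    vanish : ∀ Q → Q ℤ.* Q ℤ.- Q ℤ.* Q ℤ.* 1ℤ ≡ 0ℤ
    vanish = solve-∀

  with-M : ∀ {M′ k′} → M ≡ M′ → k ≡ k′ → Q ℤ.* A ≡ a ℤ.* M′ ℤ.+ b ℤ.* (k′ ℤ.* Q)
  with-M refl refl = qA

  -- In M² + q² k² = q², k = 0 forces M = ± q and hence A = ± a, while k = ± 1 forces M = 0 and
  -- hence A = ± b.
  cases : k ≡ 0ℤ ⊎ k ≡ 1ℤ ⊎ k ≡ -1ℤ → (A ≡ a ⊎ A ≡ ℤ.- a) ⊎ (A ≡ b ⊎ A ≡ ℤ.- b)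
  cases (inj₁ k≡0) = inj₁ (Sum.map
      (λ M≡Q → cancel-q (trans (with-M M≡Q k≡0) (r₁ a b Q)))
      (λ M≡-Q → cancel-q (trans (with-M M≡-Q k≡0) (r₂ a b Q)))
      (xx≡yy⇒x≡±yᶻ M Q M²≡Q²))
    where
    drop : ∀ Q → Q ℤ.* Q ℤ.- Q ℤ.* 0ℤ ℤ.* (Q ℤ.* 0ℤ) ≡ Q ℤ.* Q
    drop = solve-∀
    r₁ : ∀ a b Q → a ℤ.* Q ℤ.+ b ℤ.* (0ℤ ℤ.* Q) ≡ Q ℤ.* a
    r₁ = solve-∀
    r₂ : ∀ a b Q → a ℤ.* ℤ.- Q ℤ.+ b ℤ.* (0ℤ ℤ.* Q) ≡ Q ℤ.* ℤ.- a
    r₂ = solve-∀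

    M²≡Q² : M ℤ.* M ≡ Q ℤ.* Q
    M²≡Q² = trans M²≡ (trans (cong (λ z → Q ℤ.* Q ℤ.- Q ℤ.* z ℤ.* (Q ℤ.* z)) k≡0) (drop Q))
  cases (inj₂ (inj₁ k≡1)) = inj₂ (inj₁ (cancel-q (trans (with-M (M≡0 (cong (λ z → z ℤ.* z) k≡1)) k≡1) (r a b Q))))
    where
    r : ∀ a b Q → a ℤ.* 0ℤ ℤ.+ b ℤ.* (1ℤ ℤ.* Q) ≡ Q ℤ.* b
    r = solve-∀
  cases (inj₂ (inj₂ k≡-1)) = inj₂ (inj₂ (cancel-q (trans (with-M (M≡0 (cong (λ z → z ℤ.* z) k≡-1)) k≡-1) (r a b Q))))
    where
    r : ∀ a b Q → a ℤ.* 0ℤ ℤ.+ b ℤ.* (-1ℤ ℤ.* Q) ≡ Q ℤ.* ℤ.- b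
    r = solve-∀

-- (A b - a B)(A b + a B) = q (b² - B²), so q divides one of the factors; replacing B by -B
-- exchanges them.
two-squares : ∀ {q} .{{_ : ℕ.NonZero q}} → Prime q → ∀ A B a b → A ℤ.* A ℤ.+ B ℤ.* B ≡ + q → a ℤ.* a ℤ.+ b ℤ.* b ≡ + q →
              (A ≡ a ⊎ A ≡ ℤ.- a) ⊎ (A ≡ b ⊎ A ≡ ℤ.- b)
two-squares {q} pr A B a b AB ab = cases (prime-∣-* pr (A ℤ.* b ℤ.- a ℤ.* B) (A ℤ.* b ℤ.+ a ℤ.* B) (divides (b ℤ.* b ℤ.- B ℤ.* B) factors))
  where
  factors : (A ℤ.* b ℤ.- a ℤ.* B) ℤ.* (A ℤ.* b ℤ.+ a ℤ.* B) ≡ (b ℤ.* b ℤ.- B ℤ.* B) ℤ.* + q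
  factors = trans (expand A B a b) (trans (cong₂ (λ u v → b ℤ.* b ℤ.* u ℤ.- B ℤ.* B ℤ.* v) AB ab) (factor (b ℤ.* b) (B ℤ.* B) (+ q)))
    where
    expand : ∀ A B a b → (A ℤ.* b ℤ.- a ℤ.* B) ℤ.* (A ℤ.* b ℤ.+ a ℤ.* B)
                         ≡ b ℤ.* b ℤ.* (A ℤ.* A ℤ.+ B ℤ.* B) ℤ.- B ℤ.* B ℤ.* (a ℤ.* a ℤ.+ b ℤ.* b)
    expand = solve-∀
    factor : ∀ x y q → x ℤ.* q ℤ.- y ℤ.* q ≡ (x ℤ.- y) ℤ.* q
    factor = solve-∀

  neg-B : ∀ A B a b → A ℤ.* b ℤ.+ a ℤ.* B ≡ A ℤ.* b ℤ.- a ℤ.* ℤ.- B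
  neg-B = solve-∀

  neg-sq : ∀ A B → A ℤ.* A ℤ.+ ℤ.- B ℤ.* ℤ.- B ≡ A ℤ.* A ℤ.+ B ℤ.* B
  neg-sq = solve-∀

  cases : + q ∣ A ℤ.* b ℤ.- a ℤ.* B ⊎ + q ∣ A ℤ.* b ℤ.+ a ℤ.* B → (A ≡ a ⊎ A ≡ ℤ.- a) ⊎ (A ≡ b ⊎ A ≡ ℤ.- b)
  cases (inj₁ q∣) = two-squares-∣ A B a b AB ab q∣
  cases (inj₂ q∣) = two-squares-∣ A (ℤ.- B) a b (trans (neg-sq A B) AB) ab (subst (+ q ∣_) (neg-B A B a b) q∣)

4j-1≢1+4c : ∀ j c → + 4 ℤ.* j ℤ.- 1ℤ ≢ 1ℤ ℤ.+ + 4 ℤ.* c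
4j-1≢1+4c j c e = *-small {4} {2} (ℕ.s≤s (ℕ.s≤s (ℕ.s≤s ℕ.z≤n))) (j ℤ.- c)
  (trans (shift j c) (cong (ℤ._+ + 2) (ℤ.i≡j⇒i-j≡0 e)))
  where
  shift : ∀ j c → + 4 ℤ.* (j ℤ.- c) ≡ + 4 ℤ.* j ℤ.- 1ℤ ℤ.- (1ℤ ℤ.+ + 4 ℤ.* c) ℤ.+ + 2
  shift = solve-∀

4j-1≢4c : ∀ j c → + 4 ℤ.* j ℤ.- 1ℤ ≢ + 4 ℤ.* c
4j-1≢4c j c e = *-small {4} {1} (ℕ.s≤s (ℕ.s≤s ℕ.z≤n)) (j ℤ.- c)
  (trans (shift j c) (cong (ℤ._+ 1ℤ) (ℤ.i≡j⇒i-j≡0 e)))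
  where
  shift : ∀ j c → + 4 ℤ.* (j ℤ.- c) ≡ + 4 ℤ.* j ℤ.- 1ℤ ℤ.- + 4 ℤ.* c ℤ.+ 1ℤ
  shift = solve-∀

-- Applied with 4 c = 2ᵏ: the divisibility by 8 decides between s = ± 2 (1 + 4 c) and s = ± 8 c.
trace-from-two-squares : ∀ {q} .{{_ : ℕ.NonZero q}} → Prime q → ∀ c s r t →
  + q ≡ (1ℤ ℤ.+ + 4 ℤ.* c) ℤ.* (1ℤ ℤ.+ + 4 ℤ.* c) ℤ.+ + 4 ℤ.* c ℤ.* (+ 4 ℤ.* c) →
  s ℤ.* s ℤ.+ r ℤ.* r ≡ + 4 ℤ.* + q → 1ℤ ℤ.+ (+ q ℤ.+ s) ≡ + 8 ℤ.* t →
  s ≡ ℤ.- (+ 2 ℤ.* (1ℤ ℤ.+ + 4 ℤ.* c))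
trace-from-two-squares {q} pr c s r t q≡ s²+r² 8∣ = with-parity (even⊎odd r)
  where
  -- As 1 + q = 2 + 8 c + 32 c², the divisibility makes s = 2 A with A congruent to -1 modulo 4;
  -- among ± (1 + 4 c) and ± 4 c only -(1 + 4 c) qualifies.
  j A : ℤ
  j = t ℤ.- + 4 ℤ.* c ℤ.* c ℤ.- c
  A = + 4 ℤ.* j ℤ.- 1ℤ

  s≡2A : s ≡ + 2 ℤ.* A
  s≡2A = trans (isolate (+ q) s) (trans (cong₂ (λ u v → u ℤ.- 1ℤ ℤ.- v) 8∣ q≡) (expand c t))
    where
    isolate : ∀ q s → s ≡ 1ℤ ℤ.+ (q ℤ.+ s) ℤ.- 1ℤ ℤ.- q
    isolate = solve-∀
    expand : ∀ c t → + 8 ℤ.* t ℤ.- 1ℤ ℤ.- ((1ℤ ℤ.+ + 4 ℤ.* c) ℤ.* (1ℤ ℤ.+ + 4 ℤ.* c) ℤ.+ + 4 ℤ.* c ℤ.* (+ 4 ℤ.* c))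
             ≡ + 2 ℤ.* (+ 4 ℤ.* (t ℤ.- + 4 ℤ.* c ℤ.* c ℤ.- c) ℤ.- 1ℤ)
    expand = solve-∀

  4A²+r² : + 4 ℤ.* (A ℤ.* A) ℤ.+ r ℤ.* r ≡ + 4 ℤ.* + q
  4A²+r² = trans (sym (trans (cong (λ z → z ℤ.* z ℤ.+ r ℤ.* r) s≡2A) (square A r))) s²+r²
    where
    square : ∀ A r → + 2 ℤ.* A ℤ.* (+ 2 ℤ.* A) ℤ.+ r ℤ.* r ≡ + 4 ℤ.* (A ℤ.* A) ℤ.+ r ℤ.* r
    square = solve-∀

  with-parity : ∃ (λ B → r ≡ + 2 ℤ.* B) ⊎ ∃ (λ B → r ≡ 1ℤ ℤ.+ + 2 ℤ.* B) → s ≡ ℤ.- (+ 2 ℤ.* (1ℤ ℤ.+ + 4 ℤ.* c))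
  with-parity (inj₂ (B , refl)) = contradiction (trans (odd A B (+ q)) (trans (cong (λ z → + 4 ℤ.* + q ℤ.- z ℤ.+ 1ℤ) 4A²+r²) (cancel (+ q))))
      (*-small {4} {1} (ℕ.s≤s (ℕ.s≤s ℕ.z≤n)) (+ q ℤ.- (A ℤ.* A ℤ.+ B ℤ.* B ℤ.+ B)))
    where
    odd : ∀ A B q → + 4 ℤ.* (q ℤ.- (A ℤ.* A ℤ.+ B ℤ.* B ℤ.+ B))
          ≡ + 4 ℤ.* q ℤ.- (+ 4 ℤ.* (A ℤ.* A) ℤ.+ (1ℤ ℤ.+ + 2 ℤ.* B) ℤ.* (1ℤ ℤ.+ + 2 ℤ.* B)) ℤ.+ 1ℤ
    odd = solve-∀
    cancel : ∀ q → + 4 ℤ.* q ℤ.- + 4 ℤ.* q ℤ.+ 1ℤ ≡ 1ℤ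
    cancel = solve-∀
  with-parity (inj₁ (B , refl)) = cases (two-squares pr A B (1ℤ ℤ.+ + 4 ℤ.* c) (+ 4 ℤ.* c)
      (ℤ.*-cancelˡ-≡ (+ 4) _ _ (trans (even A B) 4A²+r²)) (sym q≡))
    where
    even : ∀ A B → + 4 ℤ.* (A ℤ.* A ℤ.+ B ℤ.* B) ≡ + 4 ℤ.* (A ℤ.* A) ℤ.+ + 2 ℤ.* B ℤ.* (+ 2 ℤ.* B)
    even = solve-∀

    negate : ∀ a → + 2 ℤ.* ℤ.- a ≡ ℤ.- (+ 2 ℤ.* a)
    negate = solve-∀

    cases : (A ≡ 1ℤ ℤ.+ + 4 ℤ.* c ⊎ A ≡ ℤ.- (1ℤ ℤ.+ + 4 ℤ.* c)) ⊎ (A ≡ + 4 ℤ.* c ⊎ A ≡ ℤ.- (+ 4 ℤ.* c)) →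
            s ≡ ℤ.- (+ 2 ℤ.* (1ℤ ℤ.+ + 4 ℤ.* c))
    cases (inj₁ (inj₂ A≡-a)) = trans s≡2A (trans (cong (ℤ._*_ (+ 2)) A≡-a) (negate (1ℤ ℤ.+ + 4 ℤ.* c)))
    cases (inj₁ (inj₁ A≡a)) = contradiction A≡a (4j-1≢1+4c j c)
    cases (inj₂ (inj₁ A≡b)) = contradiction A≡b (4j-1≢4c j c)
    cases (inj₂ (inj₂ A≡-b)) = contradiction (trans A≡-b (ℤ.neg-distribʳ-* (+ 4) c)) (4j-1≢4c j (ℤ.- c))

-- The number of points of E over a finite field

module _ {q : ℕ} (K : FieldOn q) where

  open FieldProperties K

  module Count (2≢0 : ι (+ 2) ≢ 0#) (i : F) (ii≡-1 : i * i ≡ - 1#) (1<q : 1 ℕ.< q) (μ : F) (μ≢0 : μ ≢ 0#) where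

    -- The inverse of 1 + i, with the denominator made rational.
    d : F
    d = (1# - i) * inv (ι (+ 2))

    d+d≡1-i : ι (+ 2) * d ≡ 1# - i
    d+d≡1-i = lin (1# - i) (*-inv (ι (+ 2)) 2≢0) (solve 2 (λ i w → let 2: = con (+ 2) in
      2: :* ((con 1ℤ :- i) :* w) :+ (con 1ℤ :- i) :* con 1ℤ := con 1ℤ :- i :+ (con 1ℤ :- i) :* (2: :* w)) refl i (inv (ι (+ 2))))

    d-eq : ι (+ 2) * (d * d) ≡ ι (+ 2) * d - 1#
    d-eq = *-cancelˡ 2≢0 (lin (ι (+ 2) * d + 1# - i - ι (+ 2)) d+d≡1-i (lin 1# ii≡-1 (solve 2 (λ i d → let
        2: = con (+ 2)
        c = 2: :* d :+ con 1ℤ :- i :- 2: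
      in 2: :* (2: :* (d :* d)) :+ c :* (con 1ℤ :- i) :+ con 1ℤ :* :- con 1ℤ
         := 2: :* (2: :* d :- con 1ℤ) :+ c :* (2: :* d) :+ con 1ℤ :* (i :* i)) refl i d)))

    m : F
    m = μ * μ

    m≢0 : m ≢ 0#
    m≢0 = *-nonzero μ≢0 μ≢0

    module O = Curve K m d m≢0 2≢0 d-eq
    module X = Character K 2≢0 i ii≡-1 1<q

    open O using (size; Point; ∞; aff; On; On?; W; W?)
    open X using (χ; S)
    open Finite (Fin-finite q) using (∑; elements)

    size₀≡1+q+S : size 0 ≡ 1ℤ ℤ.+ (+ q ℤ.+ S m)
    size₀≡1+q+S = begin
      𝟙 (W? 0 ∞) ℤ.+ sum (cartesianProductWith aff (allFin q) (allFin q)) (λ Q → 𝟙 (W? 0 Q))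
        ≡⟨ cong₂ ℤ._+_ (𝟙-yes (O.W-∞ 0) (W? 0 ∞)) (sum-cartesianProductWith aff (allFin q) (allFin q) (λ Q → 𝟙 (W? 0 Q))) ⟩
      1ℤ ℤ.+ ∑ (λ x → ∑ (λ y → 𝟙 (W? 0 (aff x y))))
        ≡⟨ cong (ℤ._+_ 1ℤ) (sum-cong elements (λ x → trans (sum-cong elements (λ y →
             𝟙-cong (λ { (P , on , refl) → on }) (λ on → aff x y , on , refl) (W? 0 (aff x y)) (y * y ≟ x * x * x - m * x)))
             (X.root-count (x * x * x - m * x)))) ⟩
      1ℤ ℤ.+ ∑ (λ x → 1ℤ ℤ.+ χ (x * x * x - m * x))
        ≡⟨ cong (ℤ._+_ 1ℤ) (trans (sum-+ elements (λ _ → 1ℤ) (λ x → χ (x * x * x - m * x))) (cong (ℤ._+ S m) X.∑-one)) ⟩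
      1ℤ ℤ.+ (+ q ℤ.+ S m) ∎
      where open ≡-Reasoning

    size₀≤1+2q : size 0 ℤ.≤ + (1 ℕ.+ (q ℕ.+ q))
    size₀≤1+2q = subst (ℤ._≤ + (1 ℕ.+ (q ℕ.+ q))) (sym size₀≡1+q+S) (ℤ.+-monoʳ-≤ 1ℤ (ℤ.+-monoʳ-≤ (+ q)
      (subst (S m ℤ.≤_) X.∑-one (sum-mono elements (λ x → X.χ≤1 (x * x * x - m * x))))))

    W-T⇒2^n≤ : ∀ n → W n O.T → 2 ℕ.^ suc n ℕ.≤ 1 ℕ.+ (q ℕ.+ q)
    W-T⇒2^n≤ n T∈W = ℤ.drop‿+≤+ (ℤ.≤-trans (O.size-bound n T∈W) size₀≤1+2q)

    -- The given nonsquare supplies the second Jacobsthal sum. With the trace known, 1 + q - 2 (1 +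
    -- 4 c) = 2 (4 c)².
    size₀≡2b² : .{{_ : ℕ.NonZero q}} → Prime q → ∀ {x} → ¬ Square x → Square μ → ∀ c →
      + q ≡ (1ℤ ℤ.+ + 4 ℤ.* c) ℤ.* (1ℤ ℤ.+ + 4 ℤ.* c) ℤ.+ + 4 ℤ.* c ℤ.* (+ 4 ℤ.* c) →
      size 0 ≡ + 2 ℤ.* (+ 4 ℤ.* c ℤ.* (+ 4 ℤ.* c))
    size₀≡2b² pr {x} x-nonsquare μ-square c q≡ =
      trans size₀≡1+q+S (trans (cong₂ (λ u v → 1ℤ ℤ.+ (u ℤ.+ v)) q≡ trace) (simplify c))
      where
      trace : S m ≡ ℤ.- (+ 2 ℤ.* (1ℤ ℤ.+ + 4 ℤ.* c))
      trace = trace-from-two-squares {q} pr c (S m) (S x) (size 3) q≡ (X.jacobsthal μ≢0 x-nonsquare)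
        (trans (sym size₀≡1+q+S) (O.size₀≡8 {μ} refl μ-square))

      simplify : ∀ c → 1ℤ ℤ.+ ((1ℤ ℤ.+ + 4 ℤ.* c) ℤ.* (1ℤ ℤ.+ + 4 ℤ.* c) ℤ.+ + 4 ℤ.* c ℤ.* (+ 4 ℤ.* c) ℤ.- + 2 ℤ.* (1ℤ ℤ.+ + 4 ℤ.* c))
                 ≡ + 2 ℤ.* (+ 4 ℤ.* c ℤ.* (+ 4 ℤ.* c))
      simplify = solve-∀

    η^-nonsquare : ∀ j → size 0 ≡ + (2 ℕ.^ suc (suc j)) → ∀ {x y} → On (aff x y) → ¬ Square x →
                   ∃ λ z → O.η^ j (aff x y) ≡ aff z 0# × (z ≡ μ ⊎ z ≡ - μ)
    η^-nonsquare j size₀≡ {x} {y} on x-nonsquare =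
      ±μ (O.level-pred X.nonsquare-* (O.W₁-T {μ} refl) j size₀≡ {aff x y} on
                       (λ w → x-nonsquare (O.W₁⇒square {x} {y} w)))
      where
      ±μ : (∃ λ z → O.η^ j (aff x y) ≡ aff z 0# × z * z ≡ m) → ∃ λ z → O.η^ j (aff x y) ≡ aff z 0# × (z ≡ μ ⊎ z ≡ - μ)
      ±μ (z , Q≡ , zz≡m) = z , Q≡ , xx≡yy⇒x≡±y zz≡m

    -- The chord case of `_+E_`, transcribed to the field.
    chord-sum : F → F → F → F → Point
    chord-sum x₁ y₁ x₂ y₂ = aff x₃ (l * (x₁ - x₃) - y₁)
      where
      l x₃ : F
      l = (y₂ - y₁) * inv (x₂ - x₁)
      x₃ = l * l - x₁ - x₂

    d-1≡2d³ : d - 1# ≡ ι (+ 2) * (d * d * d)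
    d-1≡2d³ = lin (- d - 1#) d-eq (solve 1 (λ d → let 2: = con (+ 2) ; c = :- d :- con 1ℤ in
      d :- con 1ℤ :+ c :* (2: :* d :- con 1ℤ) := 2: :* (d :* d :* d) :+ c :* (2: :* (d :* d))) refl d)

    x≢0-x : ∀ {x} → x ≢ 0# → x ≢ 0# - x
    x≢0-x {x} x≢0 x≡-x = x≢0 (x+x≡0⇒x≡0 2≢0 (lin 1# x≡-x (solve 1 (λ x →
      x :+ x :+ con 1ℤ :* (con 0ℤ :- x) := con 0ℤ :+ con 1ℤ :* x) refl x)))

    -- The chord through (x, s x) and (-x, i s x) has slope (i - 1) s x / (-2 x) = d s, and its
    -- third abscissa is the square of that because x and -x cancel.
    chord-sum-image : ∀ {x s} → x ≢ 0# → chord-sum x (s * x) (0# - x) (i * (s * x)) ≡ O.image x s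
    chord-sum-image {x} {s} x≢0 = cong₂ aff x₃≡ (trans (cong₂ (λ l z → l * (x - z) - s * x) l≡ds x₃≡)
      (lin (s * x) d-1≡2d³ (solve 3 (λ d s x → let D = d :* d :* d in
        d :* s :* (x :- d :* s :* (d :* s)) :- s :* x :+ s :* x :* (con (+ 2) :* D)
        := D :* (s :* (con (+ 2) :* x :- s :* s)) :+ s :* x :* (d :- con 1ℤ)) refl d s x)))
      where
      l : F
      l = (i * (s * x) - s * x) * inv (0# - x - x)

      -2x≢0 : 0# - x - x ≢ 0#
      -2x≢0 e = x≢0-x x≢0 (lin (- 1#) e (solve 1 (λ x →
        x :+ :- con 1ℤ :* con 0ℤ := con 0ℤ :- x :+ :- con 1ℤ :* (con 0ℤ :- x :- x)) refl x))

      l≡ds : l ≡ d * s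
      l≡ds = *-cancelˡ -2x≢0 (lin (i * (s * x) - s * x) (*-inv _ -2x≢0) (lin (s * x) d+d≡1-i (solve 5 (λ i d s x w → let
          z = con 0ℤ :- x :- x
          a = i :* (s :* x) :- s :* x
        in z :* (a :* w) :+ a :* con 1ℤ :+ s :* x :* (con 1ℤ :- i)
           := z :* (d :* s) :+ a :* (z :* w) :+ s :* x :* (con (+ 2) :* d)) refl i d s x (inv (0# - x - x)))))

      x₃≡ : l * l - x - (0# - x) ≡ d * s * (d * s)
      x₃≡ = trans (solve 2 (λ l x → l :* l :- x :- (con 0ℤ :- x) := l :* l) refl l x) (cong₂ _*_ l≡ds l≡ds)

    0≡0-0 : 0# ≡ 0# - 0#
    0≡0-0 = solve 0 (con 0ℤ := con 0ℤ :- con 0ℤ) refl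

    0+i0≡0 : 0# + i * 0# ≡ 0#
    0+i0≡0 = solve 1 (λ i → con 0ℤ :+ i :* con 0ℤ := con 0ℤ) refl i

-- Comparison with CurveFp

module _ {n : ℕ} (R : ResidueField n) where

  open ResidueField R

  module Transport (m i sqrtm : ℤ) (ii≡-1 : ι i * ι i ≡ - 1#) (μμ≡m : ι sqrtm * ι sqrtm ≡ ι m) (m≢0 : ι m ≢ 0#) where

    p : ℕ
    p = 3 ℕ.+ n

    I μ : F
    I = ι i
    μ = ι sqrtm

    μ≢0 : μ ≢ 0#
    μ≢0 e = m≢0 (trans (sym μμ≡m) (trans (cong (_* μ) e) (zeroˡ μ)))

    module E = Count fieldOn 2≢0 I ii≡-1 (ℕ.s≤s (ℕ.s≤s ℕ.z≤n)) μ μ≢0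
    open E.O using (η^; On)

    module C = CurveFp p m i
    open C using (_⊕_; _⊗_; _⊖_; _+E_)

    toC : E.O.Point → C.Point
    toC E.O.∞ = C.∞
    toC (E.O.aff x y) = C.aff (toℕ x) (toℕ y)

    ⌊_⌋ : F → ℤ
    ⌊ x ⌋ = + toℕ x

    ι-⌊⌋ : ∀ x → ι ⌊ x ⌋ ≡ x
    ι-⌊⌋ x = Fin.toℕ-injective (trans (toℕ-ι ⌊ x ⌋) (m<n⇒m%n≡m (Fin.toℕ<n x)))

    toℕ-+ : ∀ x y → toℕ (x + y) ≡ toℕ x ⊕ toℕ y
    toℕ-+ x y = trans (cong toℕ (trans (sym (cong₂ _+_ (ι-⌊⌋ x) (ι-⌊⌋ y))) (sym (ι-+ ⌊ x ⌋ ⌊ y ⌋)))) (toℕ-ι (⌊ x ⌋ ℤ.+ ⌊ y ⌋))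

    toℕ-* : ∀ x y → toℕ (x * y) ≡ toℕ x ⊗ toℕ y
    toℕ-* x y = trans (cong toℕ (trans (sym (cong₂ _*_ (ι-⌊⌋ x) (ι-⌊⌋ y))) (sym (ι-* ⌊ x ⌋ ⌊ y ⌋))))
      (trans (toℕ-ι (⌊ x ⌋ ℤ.* ⌊ y ⌋)) (cong (ℤ._%ℕ p) (sym (ℤ.pos-* (toℕ x) (toℕ y)))))

    toℕ-- : ∀ x y → toℕ (x - y) ≡ toℕ x ⊖ toℕ y
    toℕ-- x y = trans (cong toℕ (trans (sym (cong₂ _-_ (ι-⌊⌋ x) (ι-⌊⌋ y))) (trans (cong (_+_ (ι ⌊ x ⌋)) (sym (ι-neg ⌊ y ⌋)))
      (sym (ι-+ ⌊ x ⌋ (ℤ.- ⌊ y ⌋)))))) (toℕ-ι (⌊ x ⌋ ℤ.- ⌊ y ⌋))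

    toℕ-0 : toℕ 0# ≡ 0
    toℕ-0 = toℕ-ι 0ℤ

    toℕ-inv : ∀ x → toℕ (inv x) ≡ C.inv (toℕ x)
    toℕ-inv x = trans (cong toℕ (inv≡pow x)) (toℕ-pow (suc n))
      where
      toℕ-pow : ∀ k → toℕ (pow x k) ≡ C.powF (toℕ x) k
      toℕ-pow zero = toℕ-ι 1ℤ
      toℕ-pow (suc k) = trans (toℕ-* x (pow x k)) (cong (toℕ x ⊗_) (toℕ-pow k))

    iMap-toC : ∀ x y → C.iMap (toC (E.O.aff x y)) ≡ toC (E.O.aff (0# - x) (I * y))
    iMap-toC x y = cong₂ C.aff (sym (trans (toℕ-- 0# x) (cong (_⊖ toℕ x) toℕ-0))) (sym (trans (toℕ-* I y) (cong (_⊗ toℕ y) (toℕ-ι i))))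

    -- The case distinctions of `_+E_` are settled on plain variables; the field expressions come in
    -- afterwards through equations.
    +E-vertical : ∀ {a b c e} → a ≡ c → b ⊕ e ≡ 0 → C.aff a b +E C.aff c e ≡ C.∞
    +E-vertical {a} {b} {c} {e} a≡c b⊕e≡0 with a ℕ.≟ c
    ... | no a≢c = contradiction a≡c a≢c
    ... | yes _ with (b ⊕ e) ℕ.≟ 0
    ...   | yes _ = refl
    ...   | no b⊕e≢0 = contradiction b⊕e≡0 b⊕e≢0

    +E-chord : ∀ {a b c e l z} → a ≢ c → l ≡ (e ⊖ b) ⊗ C.inv (c ⊖ a) → z ≡ ((l ⊗ l) ⊖ a) ⊖ c →
               C.aff a b +E C.aff c e ≡ C.aff z ((l ⊗ (a ⊖ z)) ⊖ b)
    +E-chord {a} {b} {c} {e} a≢c refl refl with a ℕ.≟ c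
    ... | yes a≡c = contradiction a≡c a≢c
    ... | no _ = refl

    η-vertical : ∀ a b c e → C.iMap (C.aff a b) ≡ C.aff c e → a ≡ c → b ⊕ e ≡ 0 → C.η (C.aff a b) ≡ C.∞
    η-vertical a b c e iP a≡c b⊕e≡0 = trans (cong (C.aff a b +E_) iP) (+E-vertical {a} {b} {c} {e} a≡c b⊕e≡0)

    η-chord : ∀ a b c e l z → C.iMap (C.aff a b) ≡ C.aff c e →
              a ≢ c → l ≡ (e ⊖ b) ⊗ C.inv (c ⊖ a) → z ≡ ((l ⊗ l) ⊖ a) ⊖ c →
              C.η (C.aff a b) ≡ C.aff z ((l ⊗ (a ⊖ z)) ⊖ b)
    η-chord a b c e l z iP a≢c l≡ z≡ = trans (cong (C.aff a b +E_) iP) (+E-chord {a} {b} {c} {e} {l} {z} a≢c l≡ z≡)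

    η-toC-chord : ∀ x₁ y₁ x₂ y₂ → C.iMap (toC (E.O.aff x₁ y₁)) ≡ toC (E.O.aff x₂ y₂) → x₁ ≢ x₂ →
                  C.η (toC (E.O.aff x₁ y₁)) ≡ toC (E.chord-sum x₁ y₁ x₂ y₂)
    η-toC-chord x₁ y₁ x₂ y₂ iP x₁≢x₂ = trans
      (η-chord (toℕ x₁) (toℕ y₁) (toℕ x₂) (toℕ y₂) (toℕ l) (toℕ x₃) iP (x₁≢x₂ ∘ Fin.toℕ-injective) toℕ-l toℕ-x₃)
      (cong (C.aff (toℕ x₃)) (sym (trans (toℕ-- (l * (x₁ - x₃)) y₁) (cong (_⊖ toℕ y₁)
        (trans (toℕ-* l (x₁ - x₃)) (cong (toℕ l ⊗_) (toℕ-- x₁ x₃)))))))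
      where
      l x₃ : F
      l = (y₂ - y₁) * inv (x₂ - x₁)
      x₃ = l * l - x₁ - x₂

      toℕ-l : toℕ l ≡ (toℕ y₂ ⊖ toℕ y₁) ⊗ C.inv (toℕ x₂ ⊖ toℕ x₁)
      toℕ-l = trans (toℕ-* (y₂ - y₁) (inv (x₂ - x₁)))
        (cong₂ _⊗_ (toℕ-- y₂ y₁) (trans (toℕ-inv (x₂ - x₁)) (cong C.inv (toℕ-- x₂ x₁))))

      toℕ-x₃ : toℕ x₃ ≡ ((toℕ l ⊗ toℕ l) ⊖ toℕ x₁) ⊖ toℕ x₂
      toℕ-x₃ = trans (toℕ-- (l * l - x₁) x₂) (cong (_⊖ toℕ x₂)
        (trans (toℕ-- (l * l) x₁) (cong (_⊖ toℕ x₁) (toℕ-* l l))))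

    η-toC-T : C.η (toC E.O.T) ≡ C.∞
    η-toC-T = η-vertical (toℕ 0#) (toℕ 0#) (toℕ (0# - 0#)) (toℕ (I * 0#)) (iMap-toC 0# 0#) (cong toℕ E.0≡0-0)
      (trans (sym (toℕ-+ 0# (I * 0#))) (trans (cong toℕ E.0+i0≡0) toℕ-0))

    η-toC-slope : ∀ {x} s → x ≢ 0# → C.η (toC (E.O.aff x (s * x))) ≡ toC (E.O.image x s)
    η-toC-slope {x} s x≢0 = trans
      (η-toC-chord x (s * x) (0# - x) (I * (s * x)) (iMap-toC x (s * x)) (E.x≢0-x x≢0))
      (cong toC (E.chord-sum-image {x} {s} x≢0))

    -- In P + iP the abscissas x and -x agree only at T, where the ordinates add up to 0 and the sum
    -- is ∞; all other affine points fall under the chord case.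
    η-toC : ∀ {P} → E.O.View P → C.η (toC P) ≡ toC (E.O.η P)
    η-toC E.O.view-∞ = refl
    η-toC E.O.view-T = trans η-toC-T (sym (cong toC (E.O.η-0 {0#} {0#} refl)))
    η-toC (E.O.view-slope s x≢0 _) = trans (η-toC-slope s x≢0) (cong toC (sym (E.O.η-image s x≢0 refl)))

    ηPow-toC : ∀ j {P} → On P → C.ηPow j (toC P) ≡ toC (η^ j P)
    ηPow-toC zero on = refl
    ηPow-toC (suc j) on = trans (cong C.η (ηPow-toC j on)) (η-toC (E.O.view (E.O.η^-On j on)))

    pt-toC : ∀ x y → C.pt x y ≡ toC (E.O.aff (ι x) (ι y))
    pt-toC x y = cong₂ C.aff (sym (toℕ-ι x)) (sym (toℕ-ι y))

    module PointOrbit (x y : ℤ) (curve : ι y * ι y ≡ ι x * ι x * ι x - ι m * ι x) where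

      open E using (module O; module X)
      open O using (Point; aff; η^; On; W; size; T)

      P : Point
      P = aff (ι x) (ι y)

      onP : On P
      onP = trans curve (cong (λ z → ι x * ι x * ι x - z * ι x) (sym μμ≡m))

      ηPow-pt : ∀ j → C.ηPow j (C.pt x y) ≡ toC (η^ j P)
      ηPow-pt j = trans (cong (C.ηPow j) (pt-toC x y)) (ηPow-toC j onP)

      aff-0⇒W-T : ∀ j {Q a} → η^ j P ≡ Q → toC Q ≡ C.aff a 0 → W j T
      aff-0⇒W-T j {O.∞} e ()
      aff-0⇒W-T j {aff x′ y′} e e′ = O.2-torsion⇒W-T j (P , onP , e) (trans y′≡0 (trans (sym -0≡0) (cong -_ (sym y′≡0))))
        where
        aff-injectiveʳ : ∀ {a b c e} → C.aff a b ≡ C.aff c e → b ≡ e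
        aff-injectiveʳ refl = refl

        y′≡0 : y′ ≡ 0#
        y′≡0 = Fin.toℕ-injective (trans (aff-injectiveʳ e′) (sym toℕ-0))

      ηPow≡⇒W-T : ∀ j {a} → C.ηPow j (C.pt x y) ≡ C.aff a 0 → W j T
      ηPow≡⇒W-T j e = aff-0⇒W-T j {η^ j P} refl (trans (sym (ηPow-pt j)) e)

      E2⇒W-T : ∀ j → C.InE2∖∞ sqrtm (C.ηPow j (C.pt x y)) → W j T
      E2⇒W-T j (inj₁ e) = ηPow≡⇒W-T j {0} e
      E2⇒W-T j (inj₂ (inj₁ e)) = ηPow≡⇒W-T j {C.red sqrtm} e
      E2⇒W-T j (inj₂ (inj₂ e)) = ηPow≡⇒W-T j {C.red (ℤ.- sqrtm)} e

      E2⇒bound : ∀ j → C.InE2∖∞ sqrtm (C.ηPow j (C.pt x y)) → 2 ℕ.^ suc j ≤ 1 ℕ.+ (p ℕ.+ p)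
      E2⇒bound j ∈E2 = E.W-T⇒2^n≤ j (E2⇒W-T j ∈E2)

      ±μ⇒E2 : ∀ j {z} → η^ j P ≡ aff z 0# → z ≡ μ ⊎ z ≡ - μ → C.InE2∖∞ sqrtm (C.ηPow j (C.pt x y))
      ±μ⇒E2 j {z} Q≡ z≡±μ = inj₂ (Sum.map
          (λ z≡μ → at (C.red sqrtm) (trans (cong toℕ z≡μ) (toℕ-ι sqrtm)))
          (λ z≡-μ → at (C.red (ℤ.- sqrtm)) (trans (cong toℕ (trans z≡-μ (sym (ι-neg sqrtm)))) (toℕ-ι (ℤ.- sqrtm))))
          z≡±μ)
        where
        at : ∀ a → toℕ z ≡ a → C.ηPow j (C.pt x y) ≡ C.aff a 0
        at a e = trans (ηPow-pt j) (trans (cong toC Q≡) (cong₂ C.aff e toℕ-0))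

      nonsquare⇒E2 : ∀ j → size 0 ≡ + (2 ℕ.^ suc (suc j)) → ¬ Square (ι x) → C.InE2∖∞ sqrtm (C.ηPow j (C.pt x y))
      nonsquare⇒E2 j size₀≡ x-nonsquare = on-E2 (E.η^-nonsquare j size₀≡ {ι x} {ι y} onP x-nonsquare)
        where
        on-E2 : (∃ λ z → η^ j P ≡ aff z 0# × (z ≡ μ ⊎ z ≡ - μ)) → C.InE2∖∞ sqrtm (C.ηPow j (C.pt x y))
        on-E2 (z , Q≡ , z≡±μ) = ±μ⇒E2 j {z} Q≡ z≡±μ

      two-squares⇒E2 : Prime p → ¬ Square (ι x) → Square μ → ∀ c →
        + p ≡ (1ℤ ℤ.+ + 4 ℤ.* c) ℤ.* (1ℤ ℤ.+ + 4 ℤ.* c) ℤ.+ + 4 ℤ.* c ℤ.* (+ 4 ℤ.* c) →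
        ∀ j → + 2 ℤ.* (+ 4 ℤ.* c ℤ.* (+ 4 ℤ.* c)) ≡ + (2 ℕ.^ suc (suc j)) →
        C.InE2∖∞ sqrtm (C.ηPow j (C.pt x y))
      two-squares⇒E2 pr x-nonsquare μ-square c p≡ j 2b²≡ =
        nonsquare⇒E2 j (trans (E.size₀≡2b² pr {ι x} x-nonsquare μ-square c p≡) 2b²≡) x-nonsquare

-- The hypotheses modulo a prime divisor of N

module PrimeDivisor {N n : ℕ} (R : ResidueField n) (p∣N : 3 ℕ.+ n ℕ.∣ N)
  (m i sqrtm x y : ℤ) (m-coprime : Coprime ℤ.∣ m ∣ N) (i² : (i ^ 2) ≡ ℤ.- (+ 1) [mod N ])
  (sqrtm² : (sqrtm ^ 2) ≡ m [mod N ]) (y² : (y ^ 2) ≡ (x ^ 3) ℤ.- m ℤ.* x [mod N ]) where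

  open ResidueField R

  ι-mod : ∀ {a b} → a ≡ b [mod N ] → ι a ≡ ι b
  ι-mod {a} {b} a≡b = ι-cong a b (∣ᵤ⇒∣ (ℕ.∣-trans p∣N a≡b))

  ι-^2 : ∀ a → ι (a ^ 2) ≡ ι a * ι a
  ι-^2 a = trans (cong (ι ∘ ℤ._*_ a) (ℤ.*-identityʳ a)) (ι-* a a)

  ι-^3 : ∀ a → ι (a ^ 3) ≡ ι a * ι a * ι a
  ι-^3 a = trans (ι-* a (a ^ 2)) (trans (cong (_*_ (ι a)) (ι-^2 a)) (sym (*-assoc (ι a) (ι a) (ι a))))

  ii≡-1 : ι i * ι i ≡ - 1#
  ii≡-1 = trans (sym (ι-^2 i)) (trans (ι-mod i²) (ι-neg 1ℤ))

  μμ≡m : ι sqrtm * ι sqrtm ≡ ι m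
  μμ≡m = trans (sym (ι-^2 sqrtm)) (ι-mod sqrtm²)

  m≢0 : ι m ≢ 0#
  m≢0 e with m-coprime (subst (λ z → 3 ℕ.+ n ℕ.∣ ℤ.∣ z ∣) (ℤ.+-identityʳ m) (∣⇒∣ᵤ (ι≡⇒∣ m 0ℤ e)) , p∣N)
  ... | ()

  curve : ι y * ι y ≡ ι x * ι x * ι x - ι m * ι x
  curve = trans (sym (ι-^2 y)) (trans (ι-mod y²) (trans (ι-+ (x ^ 3) (ℤ.- (m ℤ.* x)))
    (cong₂ _+_ (ι-^3 x) (trans (ι-neg (m ℤ.* x)) (cong -_ (ι-* m x))))))

  open Transport R m i sqrtm ii≡-1 μμ≡m m≢0
  open PointOrbit x y curve public

  -- √m = ± t², and -t² = (i t)² is a square as well.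
  fourth-power⇒square : (∃ λ t → (t ^ 4) ≡ m [mod N ]) → Square (ι sqrtm)
  fourth-power⇒square (t , t⁴) = Sum.[ (λ μ≡tt → ι t , sym μ≡tt) , (λ μ≡-tt → ι i * ι t , trans it (sym μ≡-tt)) ]′
    (xx≡yy⇒x≡±y (trans μμ≡m (trans (sym (ι-mod t⁴)) (trans (cong ι (t^4 t)) (trans (ι-* (t ℤ.* t) (t ℤ.* t)) (cong₂ _*_ (ι-* t t) (ι-* t t)))))))
    where
    t^4 : ∀ t → t ^ 4 ≡ t ℤ.* t ℤ.* (t ℤ.* t)
    t^4 t = trans (cong (λ z → t ℤ.* (t ℤ.* (t ℤ.* z))) (ℤ.*-identityʳ t)) (sym (ℤ.*-assoc t t (t ℤ.* t)))

    it : ι i * ι t * (ι i * ι t) ≡ - (ι t * ι t)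
    it = lin (ι t * ι t) ii≡-1 (solve 2 (λ i t →
      i :* t :* (i :* t) :+ t :* t :* :- con 1ℤ := :- (t :* t) :+ t :* t :* (i :* i)) refl (ι i) (ι t))

  -- A root modulo p is a root modulo N because p = N, which ties the use of the non-residue to the
  -- direction where N is prime.
  square⇒root : 3 ℕ.+ n ≡ N → Square (ι x) → ∃ λ z → (z ℤ.* z) ≡ x [mod N ]
  square⇒root refl (r , rr≡x) = ⌊ r ⌋ , ∣⇒∣ᵤ (ι≡⇒∣ (⌊ r ⌋ ℤ.* ⌊ r ⌋) x
      (trans (ι-* ⌊ r ⌋ ⌊ r ⌋) (trans (cong₂ _*_ (ι-⌊⌋ r) (ι-⌊⌋ r)) rr≡x)))

-- Arithmetic of `G k` and the conclusion

2^[2k]≡b² : ∀ k → 2 ℕ.^ (2 ℕ.* k) ≡ 2 ℕ.^ k ℕ.* 2 ℕ.^ k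
2^[2k]≡b² k = trans (cong (λ z → 2 ℕ.^ (k ℕ.+ z)) (ℕ.+-identityʳ k)) (ℕ.^-distribˡ-+-* 2 k k)

G≡2b²+2b+1 : ∀ k → let b = 2 ℕ.^ k in G k ≡ 2 ℕ.* (b ℕ.* b) ℕ.+ 2 ℕ.* b ℕ.+ 1
G≡2b²+2b+1 k = cong₂ (λ u v → u ℕ.+ v ℕ.+ 1)
  (trans (cong (2 ℕ.^_) (ℕ.+-comm (2 ℕ.* k) 1)) (cong (2 ℕ.*_) (2^[2k]≡b² k)))
  (cong (2 ℕ.^_) (ℕ.+-comm k 1))

2∤G : ∀ k → ¬ 2 ℕ.∣ G k
2∤G k 2∣G with ℕ.∣1⇒≡1 (ℕ.∣m+n∣m⇒∣n (subst (2 ℕ.∣_) (G≡2b²+2b+1 k) 2∣G) (ℕ.∣m∣n⇒∣m+n (ℕ.m∣m*n (2 ℕ.^ k ℕ.* 2 ℕ.^ k)) (ℕ.m∣m*n (2 ℕ.^ k))))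
... | ()

prime-divisor : ∀ c → 1 ℕ.< c → ∃ λ p → Prime p × p ℕ.∣ c
prime-divisor c 1<c = first (factors f) (isFactorisation f) (factorsPrime f)
  where
  open PrimeFactorisation
  f = factorise c {{ℕ.>-nonZero (ℕ.<-trans ℕ.z<s 1<c)}}

  first : ∀ ps → c ≡ product ps → All Prime ps → ∃ λ p → Prime p × p ℕ.∣ c
  first [] c≡1 _ = contradiction (sym c≡1) (ℕ.<⇒≢ 1<c)
  first (p ∷ ps) c≡ (pr ∷ _) = p , pr , subst (p ℕ.∣_) (sym c≡) (ℕ.m∣m*n (product ps))

small-prime-divisor : ∀ N → 1 ℕ.< N → ¬ Prime N → ∃ λ p → Prime p × p ℕ.∣ N × p ℕ.* p ≤ N
small-prime-divisor N 1<N ¬prime with ¬prime⇒composite {N} {{ℕ.n>1⇒nonTrivial 1<N}} ¬prime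
... | composite {d} d<N (ℕ.divides e N≡ed) = cases (ℕ.≤-total d e)
  where
  1<d : 1 ℕ.< d
  1<d = ℕ.nonTrivial⇒n>1 d

  1<e : 1 ℕ.< e
  1<e = ℕ.≰⇒> λ e≤1 → ℕ.<⇒≱ d<N (subst (_≤ d) (sym N≡ed) (subst (e ℕ.* d ≤_) (ℕ.*-identityˡ d) (ℕ.*-monoˡ-≤ d e≤1)))

  below : ∀ c → 1 ℕ.< c → c ℕ.∣ N → c ℕ.* c ≤ N → ∃ λ p → Prime p × p ℕ.∣ N × p ℕ.* p ≤ N
  below c 1<c c∣N cc≤N =
    let (p , pr , p∣c) = prime-divisor c 1<c
        p≤c = ℕ.∣⇒≤ {{ℕ.>-nonZero (ℕ.<-trans ℕ.z<s 1<c)}} p∣c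
    in p , pr , ℕ.∣-trans p∣c c∣N , ℕ.≤-trans (ℕ.*-mono-≤ p≤c p≤c) cc≤N

  cases : d ≤ e ⊎ e ≤ d → ∃ λ p → Prime p × p ℕ.∣ N × p ℕ.* p ≤ N
  cases (inj₁ d≤e) = below d 1<d (ℕ.divides e N≡ed) (subst (d ℕ.* d ≤_) (sym N≡ed) (ℕ.*-monoˡ-≤ d d≤e))
  cases (inj₂ e≤d) = below e 1<e (ℕ.divides d (trans N≡ed (ℕ.*-comm e d))) (subst (e ℕ.* e ≤_) (sym N≡ed) (ℕ.*-monoʳ-≤ e e≤d))

-- p² ≤ 2 b² + 2 b + 1 < 4 b² forces p < 2 b, and then 1 + 2 p < 4 b ≤ b². Both estimates rest on 4
-- ≤ b, that is k ≥ 2.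
no-small-divisor : ∀ b p → 4 ≤ b → p ℕ.* p ≤ 2 ℕ.* (b ℕ.* b) ℕ.+ 2 ℕ.* b ℕ.+ 1 → ¬ b ℕ.* b ≤ 1 ℕ.+ (p ℕ.+ p)
no-small-divisor b p 4≤b pp≤N bb≤1+2p with 2 ℕ.* b ℕ.≤? p
... | yes 2b≤p = ℕ.<-irrefl refl (begin-strict
    2 ℕ.* b ℕ.* (2 ℕ.* b)                                  ≤⟨ ℕ.*-mono-≤ 2b≤p 2b≤p ⟩
    p ℕ.* p                                                ≤⟨ pp≤N ⟩
    2 ℕ.* (b ℕ.* b) ℕ.+ 2 ℕ.* b ℕ.+ 1                      <⟨ ℕ.+-monoʳ-< (2 ℕ.* (b ℕ.* b) ℕ.+ 2 ℕ.* b) 1<b ⟩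
    -- Padding by 5 b raises 3 b to 8 b = 2 (4 b), which 4 ≤ b bounds by 2 b².
    2 ℕ.* (b ℕ.* b) ℕ.+ 2 ℕ.* b ℕ.+ b                      ≤⟨ ℕ.m≤m+n _ (5 ℕ.* b) ⟩
    2 ℕ.* (b ℕ.* b) ℕ.+ 2 ℕ.* b ℕ.+ b ℕ.+ 5 ℕ.* b          ≡⟨ collect b ⟩
    2 ℕ.* (b ℕ.* b) ℕ.+ 2 ℕ.* (4 ℕ.* b)                    ≤⟨ ℕ.+-monoʳ-≤ (2 ℕ.* (b ℕ.* b)) (ℕ.*-monoʳ-≤ 2 (ℕ.*-monoˡ-≤ b 4≤b)) ⟩
    2 ℕ.* (b ℕ.* b) ℕ.+ 2 ℕ.* (b ℕ.* b)                    ≡⟨ square b ⟩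
    2 ℕ.* b ℕ.* (2 ℕ.* b)                                  ∎)
  where
  open ℕ.≤-Reasoning
  1<b : 1 ℕ.< b
  1<b = ℕ.≤-trans (ℕ.s≤s (ℕ.s≤s ℕ.z≤n)) 4≤b
  collect : ∀ b → 2 ℕ.* (b ℕ.* b) ℕ.+ 2 ℕ.* b ℕ.+ b ℕ.+ 5 ℕ.* b ≡ 2 ℕ.* (b ℕ.* b) ℕ.+ 2 ℕ.* (4 ℕ.* b)
  collect = ℕ-solver.solve-∀
  square : ∀ b → 2 ℕ.* (b ℕ.* b) ℕ.+ 2 ℕ.* (b ℕ.* b) ≡ 2 ℕ.* b ℕ.* (2 ℕ.* b)
  square = ℕ-solver.solve-∀
... | no 2b≰p = ℕ.<-irrefl refl (begin-strict
    b ℕ.* b                    ≤⟨ bb≤1+2p ⟩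
    1 ℕ.+ (p ℕ.+ p)            <⟨ ℕ.n<1+n _ ⟩
    2 ℕ.+ (p ℕ.+ p)            ≡⟨ double p ⟩
    2 ℕ.* suc p                ≤⟨ ℕ.*-monoʳ-≤ 2 (ℕ.≰⇒> 2b≰p) ⟩
    2 ℕ.* (2 ℕ.* b)            ≡⟨ sym (ℕ.*-assoc 2 2 b) ⟩
    4 ℕ.* b                    ≤⟨ ℕ.*-monoˡ-≤ b 4≤b ⟩
    b ℕ.* b                    ∎)
  where
  open ℕ.≤-Reasoning
  double : ∀ p → 2 ℕ.+ (p ℕ.+ p) ≡ 2 ℕ.* suc p
  double = ℕ-solver.solve-∀

2^[2+k]≡4e : ∀ k → 2 ℕ.^ (2 ℕ.+ k) ≡ 4 ℕ.* 2 ℕ.^ k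
2^[2+k]≡4e k = sym (ℕ.*-assoc 2 2 (2 ℕ.^ k))

4≤2^[2+k] : ∀ k → 4 ≤ 2 ℕ.^ (2 ℕ.+ k)
4≤2^[2+k] k = subst (4 ≤_) (sym (2^[2+k]≡4e k)) (ℕ.*-monoʳ-≤ 4 (ℕ.m^n>0 2 k))

-- N = (1 + b)² + b² with b = 2²⁺ᵏ; shifting the exponent by 2 makes c = b / 4 the natural number
-- 2ᵏ.
G-two-squares : ∀ k → let c = + (2 ℕ.^ k) in
  + G (2 ℕ.+ k) ≡ (1ℤ ℤ.+ + 4 ℤ.* c) ℤ.* (1ℤ ℤ.+ + 4 ℤ.* c) ℤ.+ + 4 ℤ.* c ℤ.* (+ 4 ℤ.* c)
G-two-squares k = begin
  + G (2 ℕ.+ k)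
    ≡⟨ cong +_ (trans (G≡2b²+2b+1 (2 ℕ.+ k)) (squares (2 ℕ.^ (2 ℕ.+ k)))) ⟩
  + ((1 ℕ.+ b) ℕ.* (1 ℕ.+ b) ℕ.+ b ℕ.* b)
    ≡⟨ trans (ℤ.pos-+ ((1 ℕ.+ b) ℕ.* (1 ℕ.+ b)) (b ℕ.* b)) (cong₂ ℤ._+_ (ℤ.pos-* (1 ℕ.+ b) (1 ℕ.+ b)) (ℤ.pos-* b b)) ⟩
  (1ℤ ℤ.+ + b) ℤ.* (1ℤ ℤ.+ + b) ℤ.+ + b ℤ.* + b
    ≡⟨ cong (λ z → (1ℤ ℤ.+ z) ℤ.* (1ℤ ℤ.+ z) ℤ.+ z ℤ.* z) (trans (cong +_ (2^[2+k]≡4e k)) (ℤ.pos-* 4 (2 ℕ.^ k))) ⟩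
  (1ℤ ℤ.+ + 4 ℤ.* c) ℤ.* (1ℤ ℤ.+ + 4 ℤ.* c) ℤ.+ + 4 ℤ.* c ℤ.* (+ 4 ℤ.* c) ∎
  where
  open ≡-Reasoning
  b = 2 ℕ.^ (2 ℕ.+ k)
  c = + (2 ℕ.^ k)
  squares : ∀ b → 2 ℕ.* (b ℕ.* b) ℕ.+ 2 ℕ.* b ℕ.+ 1 ≡ (1 ℕ.+ b) ℕ.* (1 ℕ.+ b) ℕ.+ b ℕ.* b
  squares = ℕ-solver.solve-∀

2b²≡2^[1+2k] : ∀ k → let c = + (2 ℕ.^ k) in + 2 ℤ.* (+ 4 ℤ.* c ℤ.* (+ 4 ℤ.* c)) ≡ + (2 ℕ.^ suc (2 ℕ.* (2 ℕ.+ k)))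
2b²≡2^[1+2k] k = begin
  + 2 ℤ.* (+ 4 ℤ.* c ℤ.* (+ 4 ℤ.* c))   ≡⟨ cong (λ z → + 2 ℤ.* (z ℤ.* z)) (sym (trans (cong +_ (2^[2+k]≡4e k)) (ℤ.pos-* 4 (2 ℕ.^ k)))) ⟩
  + 2 ℤ.* (+ b ℤ.* + b)                 ≡⟨ cong (ℤ._*_ (+ 2)) (sym (ℤ.pos-* b b)) ⟩
  + 2 ℤ.* + (b ℕ.* b)                   ≡⟨ sym (ℤ.pos-* 2 (b ℕ.* b)) ⟩
  + (2 ℕ.* (b ℕ.* b))                   ≡⟨ cong (λ z → + (2 ℕ.* z)) (sym (2^[2k]≡b² (2 ℕ.+ k))) ⟩
  + (2 ℕ.^ suc (2 ℕ.* (2 ℕ.+ k)))       ∎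
  where
  open ≡-Reasoning
  b = 2 ℕ.^ (2 ℕ.+ k)
  c = + (2 ℕ.^ k)

theorem3p3 : (k : ℕ) → 2 ≤ k →
    (m : ℤ) → Coprime ℤ.∣ m ∣ (G k) → (∃ λ t → (t ^ 4) ≡ m [mod G k ]) →
    (i : ℤ) → (i ^ 2) ≡ ℤ.- (+ 1) [mod G k ] →
    (sqrtm : ℤ) → (sqrtm ^ 2) ≡ m [mod G k ] →
    (x y : ℤ) → (y ^ 2) ≡ (x ^ 3) ℤ.- m ℤ.* x [mod G k ] →
    QNR (G k) x →
    Prime (G k) ⇔ EtaCond (G k) m i sqrtm x y (2 ℕ.* k ∸ 1)
theorem3p3 (suc (suc k)) (ℕ.s≤s (ℕ.s≤s _)) m m-coprime m-fourth i i² sqrtm sqrtm² x y y² (_ , x-nonresidue) = mk⇔ ⇒ ⇐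
  where
  K j : ℕ
  K = 2 ℕ.+ k
  -- `2 ℕ.* K` computes to a successor, so `suc j` is `2 ℕ.* K` by definition, and both size
  -- formulas apply without further arithmetic.
  j = 2 ℕ.* K ∸ 1

  module PD {n : ℕ} (R : ResidueField n) (p∣N : 3 ℕ.+ n ℕ.∣ G K) =
    PrimeDivisor R p∣N m i sqrtm x y m-coprime i² sqrtm² y²

  E2 : ∀ {n} (R : ResidueField n) (p∣N : 3 ℕ.+ n ℕ.∣ G K) → Prime (3 ℕ.+ n) → 3 ℕ.+ n ≡ G K →
       CurveFp.InE2∖∞ (3 ℕ.+ n) m i sqrtm (CurveFp.ηPow (3 ℕ.+ n) m i j (CurveFp.pt (3 ℕ.+ n) m i x y))
  E2 R p∣N pr p≡N = PD.two-squares⇒E2 R p∣N pr (λ sq → x-nonresidue (PD.square⇒root R p∣N p≡N sq))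
    (PD.fourth-power⇒square R p∣N m-fourth) (+ (2 ℕ.^ k)) (trans (cong +_ p≡N) (G-two-squares k)) j (2b²≡2^[1+2k] k)

  ⇒ : Prime (G K) → EtaCond (G K) m i sqrtm x y j
  ⇒ prN 0 pr _ = contradiction pr ¬prime[0]
  ⇒ prN 1 pr _ = contradiction pr ¬prime[1]
  ⇒ prN 2 pr 2∣N = contradiction 2∣N (2∤G K)
  ⇒ prN (suc (suc (suc n))) pr p∣N with prime⇒irreducible prN p∣N
  ... | inj₂ p≡N = E2 (residueField n pr) p∣N pr p≡N

  ⇐ : EtaCond (G K) m i sqrtm x y j → Prime (G K)
  ⇐ η-cond with prime? (G K)
  ... | yes prN = prN
  ... | no ¬prN = contradiction (small-prime-divisor (G K) 1<G ¬prN) no-divisor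
    where
    1<G : 1 ℕ.< G K
    1<G = subst (1 ℕ.<_) (ℕ.+-comm 1 _) (ℕ.s≤s (ℕ.≤-trans (ℕ.m^n>0 2 (2 ℕ.* K ℕ.+ 1)) (ℕ.m≤m+n _ _)))

    no-divisor : ¬ ∃ λ p → Prime p × p ℕ.∣ G K × p ℕ.* p ≤ G K
    no-divisor (0 , pr , _) = ¬prime[0] pr
    no-divisor (1 , pr , _) = ¬prime[1] pr
    no-divisor (2 , _ , 2∣N , _) = 2∤G K 2∣N
    no-divisor (suc (suc (suc n)) , pr , p∣N , pp≤N) = no-small-divisor (2 ℕ.^ K) (3 ℕ.+ n) (4≤2^[2+k] k)
      (subst ((3 ℕ.+ n) ℕ.* (3 ℕ.+ n) ≤_) (G≡2b²+2b+1 K) pp≤N)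
      (subst (_≤ 1 ℕ.+ (3 ℕ.+ n ℕ.+ (3 ℕ.+ n))) (2^[2k]≡b² K)
        (PD.E2⇒bound (residueField n pr) p∣N j (η-cond (3 ℕ.+ n) pr p∣N)))
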